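{- Let $G=\langle V,E\rangle$ be a connected weighted directed graph with $n$ vertices and real (possibly negative) arc weights, let $d:V\to\{1,\dots,n\}$ be a vertex ordering, let $w_d$ be the width of $G$ induced by $d$, and let $s_d$ be the size of the largest minimal separator in the chordal graph obtained by triangulating $G$ along $d$. Then the algorithm Snowball–Separators, run on input $(G,d)$, correctly computes all-pairs shortest paths in $\mathcal{O}(n w_d^2+n^2 s_d)$ time.
   Context: Graphs are finite, without self-loops, with at most one arc $i\to j$ for each ordered pair. A vertex ordering is a bijection $d:V\to\{1,\dots,n\}$; vertices are identified with their positions, so $V=\{1,\dots,n\}$. $w_{i\to j}\in\mathbb{R}$ is the weight of the arc $i\to j$ (read as $+\infty$ if that arc is absent, and as $0$ if $i=j$). We write $\{i,j\}\in E$ if there is an arc between $i$ and $j$ in either direction; "edges", "neighbours", "cliques", "separators" and "connected" refer to this underlying undirected graph. A negative cycle is a closed path with negative total weight. The specified output of Snowball–Separators is the matrix $D$ of shortest-path distances ($D[i][j]$ being the length of a shortest directed path from $i$ to $j$ in $G$), or INCONSISTENT if $G$ contains a negative cycle. Induced width: for $1\le k\le n$ let $E'_k=\{\{j,k\}\subseteq V : j<k$ and there is a path from $k$ to $j$ in the underlying undirected graph of $G$ induced on $\{j\}\cup\{k,k+1,\dots,n\}\}$. Then $w_d=\max_{k\in V}|E'_k|$. Triangulating along $d$ means: for $k=n,n-1,\dots,1$, add an edge between every pair of neighbours $i<j<k$ of $k$; the result is a chordal graph (every cycle of length greater than 3 has a chord). Separators: given a connected graph with vertex set $V$, a separator is a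 set $V'\subseteq V$ such that the subgraph induced on $V\setminus V'$ is no longer connected. A separator $V'$ is minimal if no proper subset of $V'$ is a separator. Clique tree of a chordal graph: a tree $T=\langle C,S\rangle$ whose nodes $c\in C$ correspond to the maximal cliques $V_c\subseteq V$ of the graph, such that for each $v\in V$ the nodes $c$ with $v\in V_c$ induce a subtree of $T$. Algorithm DPC (input $G$, $d$): For $k=n$ down to $1$, for all $i<j<k$ with $\{i,k\},\{j,k\}\in E$: set $w_{i\to j}\leftarrow\min\{w_{i\to j},w_{i\to k}+w_{k\to j}\}$, $w_{j\to i}\leftarrow\min\{w_{j\to i},w_{j\to k}+w_{k\to i}\}$, $E\leftarrow E\cup\{\{i,j\}\}$; if $w_{i\to j}+w_{j\to i}<0$, return INCONSISTENT. Return the modified graph $G$. Algorithm P$^3$C (input $G$, $d$): Replace $G$ by DPC$(G,d)$; return INCONSISTENT if DPC did. For $k=1$ to $n$, for all $i,j<k$ with $\{i,k\},\{j,k\}\in E$: $w_{i\to k}\leftarrow\min\{w_{i\to k},w_{i\to j}+w_{j\to k}\}$ and $w_{k\to j}\leftarrow\min\{w_{k\to j},w_{k\to i}+w_{i\to j}\}$. Return $G$. Algorithm Snowball–Separators (input $G$, $d$): Replace $G$ by P$^3$C$(G,d)$; return INCONSISTENT if P$^3$C did. Set $D[i][j]\leftarrow\infty$ for all $i,j\in V$; $D[i][i]\leftarrow 0$ for all $i\in V$; $D[i][j]\leftarrow w_{i\to j}$ and $D[j][i]\leftarrow w_{j\to i}$ for all $\{i,j\}\in E$ (the edge set after P$^3$C).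 Build a clique tree $T=\langle C,S\rangle$ of $G$, select an arbitrary root node $c_{\mathrm{root}}\in C$, set $(D,V_{\mathrm{visited}})\leftarrow$ Process($c_{\mathrm{root}},\mathrm{nil},D,\varnothing$), and return $D$. Procedure Process($c,c_{\mathrm{parent}},D,V_{\mathrm{visited}}$): If $c_{\mathrm{parent}}\ne\mathrm{nil}$, let $V_{\mathrm{new}}=V_c\setminus V_{c_{\mathrm{parent}}}$, $V_{\mathrm{sep}}=V_c\cap V_{c_{\mathrm{parent}}}$, $V_{\mathrm{other}}=V_{\mathrm{visited}}\setminus V_c$, and for all $(i,j,k)\in V_{\mathrm{new}}\times V_{\mathrm{sep}}\times V_{\mathrm{other}}$ set $D[i][k]\leftarrow\min\{D[i][k],D[i][j]+D[j][k]\}$ and $D[k][i]\leftarrow\min\{D[k][i],D[k][j]+D[j][i]\}$. Then set $V_{\mathrm{visited}}\leftarrow V_{\mathrm{visited}}\cup V_c$. Then for every child $c'$ of $c$ in the rooted tree, set $(D,V_{\mathrm{visited}})\leftarrow$ Process($c',c,D,V_{\mathrm{visited}}$). Return $(D,V_{\mathrm{visited}})$.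
   Formalization: Minimal separators are minimal for some separated pair of vertices (globally minimal ones make the time bound false); that a negative cycle gives INCONSISTENT is claimed only if no two opposite arcs have negative sum, since DPC can miss such 2-cycles. -}

module Defs where

open import Algebra.Bundles using (AbelianGroup)
open import Algebra.Structures using (IsAbelianGroup)
open import Data.Bool.Base using (Bool; true; false; if_then_else_; _∨_)
import Data.Bool.Properties as Bool
open import Data.Fin.Base as Fin using (Fin)
import Data.Fin.Properties as Fin
open import Data.Fin.Permutation using (Permutation′; _⟨$⟩ˡ_)
open import Data.Fin.Subset using (Subset; _∈_; _∉_; _⊆_; _⊂_; _∩_; _∪_; _─_; _-_; ⁅_⁆; ∣_∣; ⊥)
open import Data.Fin.Subset.Properties using (_∈?_)
open import Data.List.Base as List using (List; []; _∷_; allFin; filter; reverse; last)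
import Data.List.Membership.Propositional as List
open import Data.Maybe.Base using (Maybe; just; nothing; is-just; maybe)
open import Data.Nat.Base as ℕ using (ℕ; _+_; _*_)
open import Data.Product.Base using (∃-syntax; _×_; _,_)
open import Data.Sum.Base using (_⊎_)
open import Data.Unit.Base using (⊤; tt)
open import Data.Vec.Base using (Vec; lookup; tabulate; replicate; updateAt)
import Data.Vec.Properties as Vec
open import Function.Base using (const)
open import Function.Bundles using (_⇔_)
open import Level using (Level; 0ℓ; suc; _⊔_)
open import Relation.Binary.Bundles using (DecTotalOrder)
open import Relation.Binary.Construct.Closure.Equivalence using (EqClosure)
open import Relation.Binary.Construct.Closure.ReflexiveTransitive using (Star)
import Relation.Binary.Construct.Add.Supremum.NonStrict as Supremum
import Relation.Binary.Construct.NonStrictToStrict as ToStrict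
open import Relation.Binary.Core using (Rel)
open import Relation.Binary.Definitions using (Decidable)
open import Relation.Binary.PropositionalEquality.Core using (_≡_; _≢_)
open import Relation.Binary.Structures using (IsDecTotalOrder)
open import Relation.Nullary.Construct.Add.Supremum using (_⁺; ⊤⁺; [_])
open import Relation.Nullary.Decidable.Core using (does)
open import Relation.Nullary.Negation.Core using (¬_)

------------------------------------------------------------------------
-- Arc weights

-- The weights are real numbers, of which only the ordered additive
-- group matters.  The order is decidable because comparing two weights
-- is a primitive operation of the algorithms.

record OrderedAbelianGroup a ℓ₁ ℓ₂ : Set (suc (a ⊔ ℓ₁ ⊔ ℓ₂)) where
  infixl 6 _⊕_
  infix  4 _≈_ _≤_
  field
    Carrier         : Set a
    _≈_             : Rel Carrier ℓ₁
    _≤_             : Rel Carrier ℓ₂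
    _⊕_             : Carrier → Carrier → Carrier
    0#              : Carrier
    neg             : Carrier → Carrier
    isAbelianGroup  : IsAbelianGroup _≈_ _⊕_ 0# neg
    isDecTotalOrder : IsDecTotalOrder _≈_ _≤_
    ⊕-monoˡ-≤       : ∀ {x y} z → x ≤ y → (x ⊕ z) ≤ (y ⊕ z)

  abelianGroup : AbelianGroup a ℓ₁
  abelianGroup = record { isAbelianGroup = isAbelianGroup }

  decTotalOrder : DecTotalOrder a ℓ₁ ℓ₂
  decTotalOrder = record { isDecTotalOrder = isDecTotalOrder }

  open IsDecTotalOrder isDecTotalOrder public using (_≟_; _≤?_)
  open ToStrict _≈_ _≤_ public using (_<_)

  _<?_ : Decidable _<_
  _<?_ = ToStrict.<-decidable _≈_ _≤_ _≟_ _≤?_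

------------------------------------------------------------------------
-- Programs with a step count, which may stop with INCONSISTENT

private variable
  a b : Level
  A : Set a
  B : Set b
  n : ℕ

data Result (A : Set a) : Set a where
  INCONSISTENT : Result A
  ok           : A → Result A

record Run (A : Set a) : Set a where
  constructor run
  field
    steps  : ℕ
    result : Result A
open Run public

infixl 1 _>>=_ _>>_

return : A → Run A
return x = run 0 (ok x)

inconsistent : Run A
inconsistent = run 0 INCONSISTENT

cost : ℕ → A → Run A
cost c x = run c (ok x)

_>>=_ : Run A → (A → Run B) → Run B
run c INCONSISTENT >>= f = run c INCONSISTENT
run c (ok x)       >>= f = run (c + steps (f x)) (result (f x))

_>>_ : Run A → Run B → Run B
p >> q = p >>= λ _ → q

step : Run ⊤
step = cost 1 tt

-- Each iteration costs one step on top of its body; this pays for the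
-- loop counter and one constant-time test in the body.

forEach : List A → B → (B → A → Run B) → Run B
forEach []       s f = return s
forEach (x ∷ xs) s f = step >> f s x >>= λ s′ → forEach xs s′ f

Matrix : Set a → ℕ → Set a
Matrix A n = Vec (Vec A n) n

infix 9 _⟨_,_⟩

_⟨_,_⟩ : Matrix A n → Fin n → Fin n → A
M ⟨ i , j ⟩ = lookup (lookup M i) j

-- An assignment costs one step, which also pays for evaluating a
-- right-hand side made of boundedly many reads, sums and comparisons.

assign : Matrix A n → Fin n → Fin n → A → Run (Matrix A n)
assign M i j x = cost 1 (updateAt M i (λ row → updateAt row j (const x)))

-- Vertex sets are bit vectors: set operations, equality tests and
-- enumerations of elements take n steps.

scan : ∀ {n} → (Subset n → A) → Subset n → Run A
scan {n = n} f S = cost n (f S)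

elements : Subset n → List (Fin n)
elements {n} S = filter (_∈? S) (allFin n)

------------------------------------------------------------------------
-- Undirected graphs, as adjacency matrices

Graph : ℕ → Set
Graph = Matrix Bool

neighbours : Graph n → Fin n → Subset n
neighbours E i = lookup E i

Adjacent : Graph n → Rel (Fin n) 0ℓ
Adjacent E i j = j ∈ neighbours E i

record IsSimple (E : Graph n) : Set where
  field
    symmetric   : ∀ {i j} → Adjacent E i j → Adjacent E j i
    irreflexive : ∀ {i} → ¬ Adjacent E i i

PathWithin : Graph n → (Fin n → Set) → Rel (Fin n) 0ℓ
PathWithin E P = Star (λ x y → P x × P y × Adjacent E x y)

below : Fin n → Subset n
below k = tabulate (λ i → does (i Fin.<? k))

lower : Graph n → Fin n → Subset n
lower E k = neighbours E k ∩ below k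

eliminate : Fin n → Graph n → Graph n
eliminate k E = tabulate λ i →
  if does (i ∈? lower E k)
  then neighbours E i ∪ (lower E k - i)
  else neighbours E i

-- foldr applies `eliminate` to the last vertex first.

triangulate : Graph n → Graph n
triangulate {n} E = List.foldr eliminate E (allFin n)

IsMaximum : (ℕ → Set) → ℕ → Set
IsMaximum P m = P m × (∀ x → P x → x ℕ.≤ m)

IsMaximumOr0 : (ℕ → Set) → ℕ → Set
IsMaximumOr0 P m = IsMaximum P m ⊎ ((∀ x → ¬ P x) × m ≡ 0)

HasSize : (Fin n → Set) → ℕ → Set
HasSize P m = ∃[ S ] (∀ x → x ∈ S ⇔ P x) × ∣ S ∣ ≡ m

-- E′ E k j: {j , k} belongs to E′ₖ.

E′ : Graph n → Fin n → Fin n → Set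
E′ E k j = j Fin.< k × PathWithin E (λ x → x ≡ j ⊎ k Fin.≤ x) k j

IsInducedWidth : Graph n → ℕ → Set
IsInducedWidth E = IsMaximum (λ m → ∃[ k ] HasSize (E′ E k) m)

-- Minimality is relative to a separated pair u, v, the usual notion for
-- chordal graphs, under which adjacent cliques of a clique tree always
-- meet in a minimal separator.  It is weaker than minimality among the
-- separators of all pairs.  That stronger reading makes the running
-- time bound fail: if vertices i, j < N are adjacent whenever
-- ∣ i - j ∣ ≤ k, and every k-th vertex carries a pendant vertex, then
-- only singletons are minimal separators, but cliques meet in k vertices.

Separates : Graph n → Fin n → Fin n → Subset n → Set
Separates E u v S = u ∉ S × v ∉ S × ¬ PathWithin E (_∉ S) u v

IsMinimalSeparator : Graph n → Subset n → Set
IsMinimalSeparator E S = ∃[ u ] ∃[ v ]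
  Separates E u v S × (∀ S′ → S′ ⊂ S → ¬ Separates E u v S′)

-- A complete graph has no separators; the size is then 0.

IsLargestMinimalSeparatorSize : Graph n → ℕ → Set
IsLargestMinimalSeparatorSize E =
  IsMaximumOr0 (λ m → ∃[ S ] IsMinimalSeparator E S × ∣ S ∣ ≡ m)

IsClique : Graph n → Subset n → Set
IsClique E C = ∀ {i j} → i ∈ C → j ∈ C → i ≢ j → Adjacent E i j

IsMaximalClique : Graph n → Subset n → Set
IsMaximalClique E C = IsClique E C × (∀ C′ → IsClique E C′ → C ⊆ C′ → C′ ⊆ C)

------------------------------------------------------------------------
-- Clique trees

-- A tree on vertex sets together with a choice of root and an order on
-- the children of each node.

data Tree (n : ℕ) : Set where
  node : Subset n → List (Tree n) → Tree n

data Node {n} : Tree n → Set where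
  root  : ∀ {C ts} → Node (node C ts)
  child : ∀ {C t ts} → t List.∈ ts → Node t → Node (node C ts)

label : {t : Tree n} → Node t → Subset n
label {t = node C ts} root = C
label (child _ c)          = label c

data Link {n} : {t : Tree n} → Rel (Node t) 0ℓ where
  top   : ∀ {C C′ ts ts′} (p : node C′ ts′ List.∈ ts) →
          Link {t = node C ts} root (child p root)
  under : ∀ {C t ts} (p : t List.∈ ts) {c c′ : Node t} →
          Link c c′ → Link {t = node C ts} (child p c) (child p c′)

record IsCliqueTree (E : Graph n) (t : Tree n) : Set where
  field
    maximal   : ∀ (c : Node t) → IsMaximalClique E (label c)
    complete  : ∀ C → IsMaximalClique E C → ∃[ c ] label {t = t} c ≡ C
    injective : ∀ (c c′ : Node t) → label c ≡ label c′ → c ≡ c′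
    subtree   : ∀ v (c c′ : Node t) → v ∈ label c → v ∈ label c′ →
                EqClosure (λ x y → Link x y × v ∈ label x × v ∈ label y) c c′

-- The step "build a clique tree and select a root", in time
-- proportional to the size of the adjacency matrix.

record IsCliqueTreeRoutine (build : ∀ n → Graph n → Run (Tree n)) : Set where
  field
    correct : ∀ n (E : Graph n) → IsSimple E →
              ∃[ t ] result (build n (triangulate E)) ≡ ok t
                     × IsCliqueTree (triangulate E) t
    fast    : ∃[ K ] (∀ n (E : Graph n) → IsSimple E →
              steps (build n (triangulate E)) ℕ.≤ K * (n * n))

-- One such routine.  Vertices are added in increasing order.  With N
-- the clique of earlier neighbours of k and p the greatest of them, the
-- node closest to the root that contains p has a label including N: it
-- is extended by k if it equals N, and gets a new child N ∪ ⁅ k ⁆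
-- otherwise.  If N is empty the root plays the role of that node.

_==_ : Subset n → Subset n → Bool
S == S′ = does (Vec.≡-dec Bool._≟_ S S′)

extend : Fin n → Subset n → Subset n → List (Tree n) → Run (Tree n)
extend k N C ts = do
  equal ← scan (_== N) C
  if equal
    then (do C′ ← scan (_∪ ⁅ k ⁆) C
             return (node C′ ts))
    else (do N′ ← scan (_∪ ⁅ k ⁆) N
             return (node C (node N′ [] ∷ ts)))

mutual
  insert : Fin n → Subset n → Maybe (Fin n) → Tree n → Run (Tree n)
  insert k N p (node C ts) = do
    step
    if maybe (λ i → does (i ∈? C)) true p
      then extend k N C ts
      else (do ts′ ← insertAll k N p ts
               return (node C ts′))

  insertAll : Fin n → Subset n → Maybe (Fin n) → List (Tree n) →
              Run (List (Tree n))
  insertAll k N p []       = return []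
  insertAll k N p (t ∷ ts) = do
    t′  ← insert k N p t
    ts′ ← insertAll k N p ts
    return (t′ ∷ ts′)

buildCliqueTree : ∀ n → Graph n → Run (Tree n)
buildCliqueTree n E = forEach (allFin n) (node ⊥ []) λ t k → do
  N ← scan (_∩ below k) (neighbours E k)
  p ← scan (λ S → last (elements S)) N
  insert k N p t

------------------------------------------------------------------------
-- Weighted digraphs and the algorithms

module APSP {a ℓ₁ ℓ₂} (R : OrderedAbelianGroup a ℓ₁ ℓ₂) where
  open OrderedAbelianGroup R

  -- The weights and ∞ = ⊤⁺.

  infixl 6 _⊕∞_ _⊓∞_

  R∞ : Set a
  R∞ = Carrier ⁺

  _≤∞?_ : Decidable (Supremum._≤⁺_ _≤_)
  _≤∞?_ = Supremum.≤⁺-dec _≤_ _≤?_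

  _⊕∞_ : R∞ → R∞ → R∞
  [ x ] ⊕∞ [ y ] = [ x ⊕ y ]
  [ x ] ⊕∞ ⊤⁺    = ⊤⁺
  ⊤⁺    ⊕∞ y     = ⊤⁺

  _⊓∞_ : R∞ → R∞ → R∞
  x ⊓∞ y = if does (x ≤∞? y) then x else y

  negative? : R∞ → Bool
  negative? [ x ] = does (x <? 0#)
  negative? ⊤⁺    = false

  -- An absent arc has weight ∞.

  record Digraph (n : ℕ) : Set a where
    field
      arc      : Fin n → Fin n → R∞
      loopless : ∀ i → arc i i ≡ ⊤⁺
  open Digraph public

  underlying : Digraph n → Graph n
  underlying G = tabulate λ i → tabulate λ j →
    is-just (arc G i j) ∨ is-just (arc G j i)

  Connected : Digraph n → Set
  Connected G = ∀ i j → Star (Adjacent (underlying G)) i j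

  -- Vertices identified with their positions in the ordering d.

  relabel : Digraph n → Permutation′ n → Digraph n
  relabel G d = record
    { arc      = λ i j → arc G (d ⟨$⟩ˡ i) (d ⟨$⟩ˡ j)
    ; loopless = λ i → loopless G (d ⟨$⟩ˡ i)
    }

  data Path (G : Digraph n) : Fin n → Fin n → Carrier → Set a where
    []  : ∀ {i} → Path G i i 0#
    _∷_ : ∀ {i j k x y} →
          arc G i j ≡ [ x ] → Path G j k y → Path G i k (x ⊕ y)

  HasNegativeCycle : Digraph n → Set (a ⊔ ℓ₁ ⊔ ℓ₂)
  HasNegativeCycle G = ∃[ i ] ∃[ x ] Path G i i x × x < 0#

  -- DPC only tests a pair of vertices after updating it, so it does not
  -- notice a negative cycle i → j → i in the input when i and j have no
  -- common later neighbour.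

  NoNegative2Cycle : Digraph n → Set (a ⊔ ℓ₂)
  NoNegative2Cycle G = ∀ i j x y →
    arc G i j ≡ [ x ] → arc G j i ≡ [ y ] → 0# ≤ (x ⊕ y)

  data IsDistance (G : Digraph n) (i j : Fin n) : R∞ → Set (a ⊔ ℓ₁ ⊔ ℓ₂) where
    infinite : (∀ y → ¬ Path G i j y) → IsDistance G i j ⊤⁺
    finite   : ∀ {x y} → Path G i j y → x ≈ y →
               (∀ z → Path G i j z → x ≤ z) → IsDistance G i j [ x ]

  record Network (n : ℕ) : Set a where
    constructor network
    field
      weights : Matrix R∞ n
      edges   : Graph n
  open Network public

  initial : Digraph n → Network n
  initial G = network
    (tabulate λ i → tabulate λ j →
      if does (i Fin.≟ j) then [ 0# ] else arc G i j)
    (underlying G)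

  -- M[i][k] ← min{M[i][k], M[i][j] + M[j][k]}

  relax : Matrix R∞ n → Fin n → Fin n → Fin n → Run (Matrix R∞ n)
  relax M i j k =
    assign M i k (M ⟨ i , k ⟩ ⊓∞ (M ⟨ i , j ⟩ ⊕∞ M ⟨ j , k ⟩))

  lowerNeighbours : Graph n → Fin n → Run (List (Fin n))
  lowerNeighbours E k = do
    N ← scan (_∩ below k) (neighbours E k)
    scan elements N

  dpc : Network n → Run (Network n)
  dpc {n} net = forEach (reverse (allFin n)) net λ net k → do
    ns ← lowerNeighbours (edges net) k
    forEach ns net λ net i → forEach ns net λ net j →
      if does (i Fin.<? j)
        then (do w ← relax (weights net) i k j
                 w ← relax w j k i
                 E ← assign (edges net) i j true
                 E ← assign E j i true
                 if negative? (w ⟨ i , j ⟩ ⊕∞ w ⟨ j , i ⟩)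
                   then inconsistent
                   else return (network w E))
        else return net

  p³c : Network n → Run (Network n)
  p³c {n} net = do
    net ← dpc net
    forEach (allFin n) net λ net k → do
      ns ← lowerNeighbours (edges net) k
      forEach ns net λ net i → forEach ns net λ net j → do
        w ← relax (weights net) i j k
        w ← relax w k i j
        return (network w (edges net))

  initialDistances : Network n → Run (Matrix R∞ n)
  initialDistances {n} net = do
    D ← cost (n * n) (replicate n (replicate n ⊤⁺))
    forEach (allFin n) D λ D i → do
      D  ← assign D i i [ 0# ]
      js ← scan elements (neighbours (edges net) i)
      forEach js D λ D j → do
        D ← assign D i j (weights net ⟨ i , j ⟩)
        assign D j i (weights net ⟨ j , i ⟩)

  fromParent : Maybe (Subset n) → Subset n → Matrix R∞ n → Subset n →
               Run (Matrix R∞ n)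
  fromParent nothing        C D visited = return D
  fromParent (just Cparent) C D visited = do
    new   ← scan (_─ Cparent) C
    sep   ← scan (_∩ Cparent) C
    other ← scan (_─ C) visited
    is ← scan elements new
    js ← scan elements sep
    ks ← scan elements other
    forEach is D λ D i → forEach js D λ D j → forEach ks D λ D k → do
      D ← relax D i j k
      relax D k j i

  mutual
    process : Tree n → Maybe (Subset n) → Matrix R∞ n × Subset n →
              Run (Matrix R∞ n × Subset n)
    process (node C ts) parent (D , visited) = do
      D       ← fromParent parent C D visited
      visited ← scan (_∪ C) visited
      processChildren ts C (D , visited)

    processChildren : List (Tree n) → Subset n → Matrix R∞ n × Subset n →
                      Run (Matrix R∞ n × Subset n)
    processChildren []       C s = return s
    processChildren (t ∷ ts) C s = do
      step
      s ← process t (just C) s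
      processChildren ts C s

  -- The output is indexed by positions.

  snowballSeparators : (∀ n → Graph n → Run (Tree n)) →
                       Digraph n → Permutation′ n → Run (Matrix R∞ n)
  snowballSeparators {n} build G d = do
    net     ← p³c (initial (relabel G d))
    D       ← initialDistances net
    t       ← build n (edges net)
    (D , _) ← process t nothing (D , ⊥)
    return D

{-# OPTIONS --safe #-}

-- After DPC, w i j ≤ w i k + w k j for all i , j < k, so every walk can
-- be shortened to one built outwards, each step reaching a vertex greater
-- than both previous ends.  Such a walk never closes, which excludes
-- negative cycles, and its last step is one relaxation of P³C, which
-- therefore gets the distances along the edges.
--
-- In the clique tree, a path between a new vertex of a node and a vertex
-- visited earlier meets the intersection of the node with its parent, so
-- relaxing through that intersection suffices.  The intersection is a
-- minimal separator, hence has at most s vertices, and each vertex is new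
-- once: this gives n² s.  The terms of order n² are absorbed, since s = 0
-- only if the triangulation is complete, and then w = n - 1.
--
-- The clique tree is correct because the topmost node containing a vertex
-- contains its lower neighbours as well, so the home of the greatest
-- vertex of a clique contains the clique.

module Submission where

open import Defs

open import Algebra.Bundles using (AbelianGroup)
open import Data.Bool.Base using (Bool; true; false; if_then_else_; _∨_)
import Data.Bool.Properties as Bool
import Data.Empty as Empty
open import Data.Empty using (⊥-elim)
open import Data.Fin.Base as Fin using (Fin; zero; suc; toℕ)
import Data.Fin.Properties as Fin
open import Data.Fin.Permutation using (Permutation′; _⟨$⟩ʳ_; _⟨$⟩ˡ_; inverseˡ; inverseʳ)
open import Data.Fin.Subset
  using (Subset; _∈_; _∉_; _⊆_; _⊈_; _∩_; _∪_; _─_; _-_; ⁅_⁆; ∣_∣; ⊥; ⊤)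
open import Data.Fin.Subset.Properties
open import Data.List.Base as List using (List; []; _∷_; allFin; filter; reverse; last; length; drop)
import Data.List.Membership.Propositional as List hiding (find)
open import Data.List.Membership.Propositional using (find; lose)
import Data.List.Membership.Propositional.Properties as List
import Data.List.Properties as List
open import Data.List.Relation.Unary.All as All using (All; []; _∷_)
open import Data.List.Relation.Unary.AllPairs as AllPairs using (AllPairs; []; _∷_)
import Data.List.Relation.Unary.AllPairs.Properties as AllPairs
open import Data.List.Relation.Unary.Any using (Any; here; there)
open import Data.Maybe.Base using (Maybe; just; nothing; is-just)
open import Data.Nat.Base as ℕ using (ℕ; zero; suc; _+_; _*_; _^_; _≤_; _<_; z≤n; s≤s)
import Data.Nat.Properties as ℕ
open import Data.Nat.Solver using (module +-*-Solver)
open import Data.Product.Base using (∃-syntax; _×_; _,_; proj₁; proj₂; map₂; swap)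
open import Data.Sum.Base as Sum using (_⊎_; inj₁; inj₂; [_,_]′)
open import Data.Vec.Base as Vec using (Vec; []; _∷_; lookup; tabulate; replicate; updateAt; here; there)
import Data.Vec.Properties as Vec
open import Function.Base using (_∘_; id; const; case_of_)
open import Function.Bundles using (_⇔_; mk⇔; module Equivalence)
open import Level using (Level; 0ℓ; _⊔_)
open import Relation.Binary.Construct.Closure.Equivalence using (EqClosure)
open import Relation.Binary.Construct.Closure.ReflexiveTransitive as Star using (Star; ε; _◅_; _◅◅_)
open import Relation.Binary.Construct.Closure.Symmetric as Sym using (fwd; bwd)
import Relation.Binary.Construct.Add.Supremum.NonStrict as Supremum
open import Relation.Binary.Core using (Rel)
open import Relation.Binary.Structures using (IsDecTotalOrder)
open import Relation.Binary.Definitions using (Reflexive; Transitive; tri<; tri≈; tri>)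
open import Relation.Binary.PropositionalEquality
  using (_≡_; _≢_; refl; sym; trans; cong; cong₂; subst; subst₂; module ≡-Reasoning)
open import Relation.Nullary.Construct.Add.Supremum using (⊤⁺; [_])
open import Relation.Nullary.Decidable using (Dec; yes; no; does; dec-true; dec-false; _×-dec_; decidable-stable; ¬¬-excluded-middle)
open import Relation.Nullary.Negation using (¬_; contradiction)
open import Relation.Unary using (Pred)

-- One set of triples serves both claims. `Runs p N F Q` bounds the steps, and its failure clause
-- carries `F`, instantiated with a negative cycle, so stopping with INCONSISTENT is always
-- justified. The whole program is analysed once, for arbitrary bounds on the lower neighbourhoods
-- and on the intersections along links: the bounds `n` and `n` give correctness, the width and the
-- separator size give the time.
--
-- Two obstacles shape the invariants. Negative 2-cycles may escape DPC, so the two halves of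
-- correctness are kept apart: `Sound` (a finite entry is the length of a path) is unconditional,
-- `Tight` (an entry is at most every path length) assumes `NoNegative2Cycle`. And the matrices are
-- updated in place, so what a loop achieves is stated against the matrix it started from, which is
-- legitimate because entries only decrease.
--
-- The clique tree is arbitrary, whereas the algorithm proceeds from a root. The axioms of a clique
-- tree are therefore turned into the recursive property `Coherent`, which both the construction and
-- the traversal work with.

private variable
  a b ℓᶠ ℓⁱ ℓᵖ ℓᑫ ℓʳ : Level
  A : Set a
  B : Set b
  n : ℕ

-- Programs with a running time

data Post {A : Set a} (F : Set ℓᶠ) (Q : Pred A ℓᑫ) : Result A → Set (a ⊔ ℓᶠ ⊔ ℓᑫ) where
  failed : F → Post F Q INCONSISTENT
  done   : ∀ {x} → Q x → Post F Q (ok x)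

-- A Hoare triple with a time bound; stopping with INCONSISTENT proves F.

record Runs {A : Set a} (p : Run A) (N : ℕ) (F : Set ℓᶠ) (Q : Pred A ℓᑫ) : Set (a ⊔ ℓᶠ ⊔ ℓᑫ) where
  constructor runs
  field
    time : steps p ≤ N
    post : Post F Q (result p)
open Runs

Runs-result : {Q : Pred A ℓᑫ} {p : Run A} {N : ℕ} → Runs p N Empty.⊥ Q → ∃[ x ] result p ≡ ok x × Q x
Runs-result {p = run _ (ok x)} (runs _ (done y)) = x , refl , y

module _ {F : Set ℓᶠ} where

  Post-map : {Q : Pred A ℓᑫ} {Q′ : Pred A ℓʳ} → (∀ {x} → Q x → Q′ x) →
             ∀ {x} → Post F Q x → Post F Q′ x
  Post-map g (failed e) = failed e
  Post-map g (done y)   = done (g y)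

  Runs-map : {Q : Pred A ℓᑫ} {Q′ : Pred A ℓʳ} {p : Run A} {M N : ℕ} → M ≤ N →
             (∀ {x} → Q x → Q′ x) → Runs p M F Q → Runs p N F Q′
  Runs-map M≤N g (runs t o) = runs (ℕ.≤-trans t M≤N) (Post-map g o)

  Runs-safe : {Q : Pred A ℓᑫ} {p : Run A} {N : ℕ} → Runs p N Empty.⊥ Q → Runs p N F Q
  Runs-safe (runs t (done y)) = runs t (done y)

  Runs-return : {Q : Pred A ℓᑫ} {x : A} → Q x → Runs (return x) 0 F Q
  Runs-return y = runs z≤n (done y)

  Runs-cost : ∀ c {Q : Pred A ℓᑫ} {p : Run A} {N} →
              Runs p N F Q → Runs (run (c + steps p) (result p)) (c + N) F Q
  Runs-cost c (runs t o) = runs (ℕ.+-monoʳ-≤ c t) o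

  Runs-bind : {Q : Pred A ℓᑫ} {Q′ : Pred B ℓʳ} {p : Run A} {k : A → Run B} {M N : ℕ} →
              Runs p M F Q → (∀ {x} → Q x → Runs (k x) N F Q′) →
              Runs (p >>= k) (M + N) F Q′
  Runs-bind {p = run c INCONSISTENT} (runs t (failed e)) g =
    runs (ℕ.≤-trans t (ℕ.m≤m+n _ _)) (failed e)
  Runs-bind {p = run c (ok x)} (runs t (done y)) g =
    runs (ℕ.+-mono-≤ t (time (g y))) (post (g y))

  Runs-if : {P : Set ℓᵖ} {Q : Pred A ℓᑫ} {r r′ : Run A} {N : ℕ} (P? : Dec P) →
            (P → Runs r N F Q) → (¬ P → Runs r′ N F Q) → Runs (if does P? then r else r′) N F Q
  Runs-if (yes p) f g = f p
  Runs-if (no ¬p) f g = g ¬p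

  module _ {A : Set a} {B : Set b} {f : B → A → Run B} {c : ℕ}
           (I : Pred B ℓⁱ) {_⊑_ : Rel B ℓʳ} (⊑-refl : Reflexive _⊑_) (⊑-trans : Transitive _⊑_)
           {P : A → B → Set ℓᵖ} (P-resp : ∀ {x s s′} → s ⊑ s′ → P x s → P x s′) where

    -- `P x` is what the iteration for `x` achieves. Later iterations preserve it because each of
    -- them moves the state up along `_⊑_`, for which `P` is monotone.
    Runs-forEach : ∀ xs {s} →
      (∀ {x s} → x List.∈ xs → I s → Runs (f s x) c F (λ s′ → I s′ × s ⊑ s′ × P x s′)) →
      I s →
      Runs (forEach xs s f) (length xs * suc c) F
           (λ s′ → I s′ × s ⊑ s′ × (∀ x → x List.∈ xs → P x s′))
    Runs-forEach []       body Is = Runs-return (Is , ⊑-refl , λ _ ())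
    Runs-forEach (x ∷ xs) body Is =
      Runs-bind (Runs-cost 1 (body (here refl) Is)) λ (Is′ , s⊑s′ , Px) →
      Runs-map ℕ.≤-refl
        (λ (Is″ , s′⊑s″ , Pxs) → Is″ , ⊑-trans s⊑s′ s′⊑s″ ,
          λ { _ (here refl) → P-resp s′⊑s″ Px ; _ (there x∈xs) → Pxs _ x∈xs })
        (Runs-forEach xs (body ∘ there) Is′)

  module _ {A : Set a} {B : Set b} {f : B → A → A → Run B} {c : ℕ}
           (I : Pred B ℓⁱ) {_⊑_ : Rel B ℓʳ} (⊑-refl : Reflexive _⊑_) (⊑-trans : Transitive _⊑_)
           {P : A → A → B → Set ℓᵖ} (P-resp : ∀ {x y s s′} → s ⊑ s′ → P x y s → P x y s′) where

    Runs-forEach₂ : ∀ xs ys {s} →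
      (∀ {x y s} → x List.∈ xs → y List.∈ ys → I s →
        Runs (f s x y) c F (λ s′ → I s′ × s ⊑ s′ × P x y s′)) →
      I s →
      Runs (forEach xs s λ s x → forEach ys s λ s y → f s x y)
           (length xs * suc (length ys * suc c)) F
           (λ s′ → I s′ × s ⊑ s′ × (∀ x → x List.∈ xs → ∀ y → y List.∈ ys → P x y s′))
    Runs-forEach₂ xs ys body =
      Runs-forEach I ⊑-refl ⊑-trans (λ s⊑s′ Pxs y y∈ys → P-resp s⊑s′ (Pxs y y∈ys)) xs
        (λ x∈xs → Runs-forEach I ⊑-refl ⊑-trans P-resp ys (body x∈xs))

  -- The invariant is indexed by the number of vertices already processed. The list is a general
  -- `tabulate g` because the induction passes to `g ∘ suc`.
  Runs-forEach-tabulate : ∀ {B : Set b} {f : B → A → Run B} {c} {n} (g : Fin n → A) →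
    (I : ℕ → Pred B ℓⁱ) →
    (∀ k {s} → I (toℕ k) s → Runs (f s (g k)) c F (I (suc (toℕ k)))) →
    ∀ {s} → I 0 s → Runs (forEach (List.tabulate g) s f) (n * suc c) F (I n)
  Runs-forEach-tabulate {n = zero}  g I body Is = Runs-return Is
  Runs-forEach-tabulate {n = suc n} g I body Is =
    Runs-bind (Runs-cost 1 (body zero Is))
      (Runs-forEach-tabulate (g ∘ suc) (I ∘ suc) (body ∘ suc))

  -- Needed for descending loops: the reverse of a nonempty list ends with its head.
  Runs-forEach-∷ʳ : ∀ {B : Set b} {f : B → A → Run B} {M N} {Q : Pred B ℓᑫ} {Q′ : Pred B ℓʳ} xs {x s} →
    Runs (forEach xs s f) M F Q → (∀ {s} → Q s → Runs (f s x) N F Q′) →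
    Runs (forEach (xs List.∷ʳ x) s f) (M + suc N) F Q′
  Runs-forEach-∷ʳ {f = f} {M} {N} {Q′ = Q′} xs {x} {s} before last = 
    subst (λ p → Runs p _ F Q′) (sym (forEach-∷ʳ xs s)) (Runs-bind before λ Qs →
      Runs-map (ℕ.≤-reflexive (cong suc (ℕ.+-identityʳ _))) id (Runs-bind (Runs-cost 1 (last Qs)) Runs-return))
    where
    >>=-assoc : ∀ {A : Set a} {B : Set b} {C : Set ℓᑫ} (p : Run A) {f : A → Run B} {g : B → Run C} →
                (p >>= f >>= g) ≡ (p >>= λ x → f x >>= g)
    >>=-assoc (run c INCONSISTENT) = refl
    >>=-assoc (run c (ok x)) {f} {g} with f x
    ... | run d INCONSISTENT = refl
    ... | run d (ok y) = cong (λ e → run e (result (g y))) (ℕ.+-assoc c d _)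
    forEach-∷ʳ : ∀ xs s → forEach (xs List.∷ʳ x) s f ≡ (forEach xs s f >>= λ s → forEach (x ∷ []) s f)
    forEach-∷ʳ []       s = refl
    forEach-∷ʳ (y ∷ xs) s with f s y
    ... | run c INCONSISTENT = refl
    ... | run c (ok s′) rewrite forEach-∷ʳ xs s′ = sym (>>=-assoc (run (suc c) (ok s′)) {λ s → forEach xs s f})

  Runs-forEach-reverse-tabulate : ∀ {B : Set b} {f : B → A → Run B} {c} {n} (g : Fin n → A) →
    (I : ℕ → Pred B ℓⁱ) →
    (∀ k {s} → I (suc (toℕ k)) s → Runs (f s (g k)) c F (I (toℕ k))) →
    ∀ {s} → I n s → Runs (forEach (reverse (List.tabulate g)) s f) (n * suc c) F (I 0)
  Runs-forEach-reverse-tabulate {n = zero}  g I body Is = Runs-return Is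
  Runs-forEach-reverse-tabulate {f = f} {c} {suc n} g I body {s} Is =
    subst (λ xs → Runs (forEach xs s f) _ F _)
      (sym (List.unfold-reverse (g zero) (List.tabulate (g ∘ suc))))
      (Runs-map (ℕ.≤-reflexive (ℕ.+-comm (n * suc c) (suc c))) id
        (Runs-forEach-∷ʳ (reverse (List.tabulate (g ∘ suc)))
          (Runs-forEach-reverse-tabulate (g ∘ suc) (I ∘ suc) (body ∘ suc) Is)
          (body zero)))

-- Matrices and vertex sets

infixl 8 _[_,_]≔_

-- Unfolds to the matrix computed by `assign`, so that facts about matrices apply to the programs as
-- they stand.
_[_,_]≔_ : Matrix A n → Fin n → Fin n → A → Matrix A n
M [ i , j ]≔ x = updateAt M i (λ row → updateAt row j (const x))

module _ (M : Matrix A n) {x : A} where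

  lookup-≔-same : ∀ i j → (M [ i , j ]≔ x) ⟨ i , j ⟩ ≡ x
  lookup-≔-same i j = trans (cong (λ row → lookup row j) (Vec.lookup∘updateAt i M))
                            (Vec.lookup∘updateAt j (lookup M i))

  lookup-≔-other : ∀ i j {k l} → k ≢ i ⊎ l ≢ j → (M [ i , j ]≔ x) ⟨ k , l ⟩ ≡ M ⟨ k , l ⟩
  lookup-≔-other i j {k} {l} ne with k Fin.≟ i
  ... | no k≢i = cong (λ row → lookup row l) (Vec.lookup∘updateAt′ k i k≢i M)
  lookup-≔-other i j {l = l} (inj₁ k≢i) | yes k≡i = contradiction k≡i k≢i
  lookup-≔-other i j {l = l} (inj₂ l≢j) | yes refl =
    trans (cong (λ row → lookup row l) (Vec.lookup∘updateAt i M))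
          (Vec.lookup∘updateAt′ l j l≢j (lookup M i))

Matrix-ext : {M N : Matrix A n} → (∀ i j → M ⟨ i , j ⟩ ≡ N ⟨ i , j ⟩) → M ≡ N
Matrix-ext M≗N = lookup-ext λ i → lookup-ext λ j → M≗N i j
  where
  lookup-ext : ∀ {A : Set a} {n} {xs ys : Vec A n} → (∀ i → lookup xs i ≡ lookup ys i) → xs ≡ ys
  lookup-ext {xs = xs} {ys} xs≗ys =
    trans (sym (Vec.tabulate∘lookup xs)) (trans (Vec.tabulate-cong xs≗ys) (Vec.tabulate∘lookup ys))

lookup₂-tabulate : ∀ (f : Fin n → Fin n → A) i j → tabulate (λ i → tabulate (f i)) ⟨ i , j ⟩ ≡ f i j
lookup₂-tabulate f i j = trans (cong (λ row → lookup row j) (Vec.lookup∘tabulate (λ i → tabulate (f i)) i))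
                               (Vec.lookup∘tabulate (f i) j)

∈⇒lookup : ∀ {S : Subset n} {x} → x ∈ S → lookup S x ≡ true
∈⇒lookup = Vec.[]=⇒lookup

lookup⇒∈ : ∀ {S : Subset n} {x} → lookup S x ≡ true → x ∈ S
lookup⇒∈ {S = S} {x} = Vec.lookup⇒[]= x S

module _ {S : Subset n} where

  ∈-elements⁺ : ∀ {x} → x ∈ S → x List.∈ elements S
  ∈-elements⁺ x∈S = List.∈-filter⁺ (_∈? S) (List.∈-allFin _) x∈S

  ∈-elements⁻ : ∀ {x} → x List.∈ elements S → x ∈ S
  ∈-elements⁻ x∈ = proj₂ (List.∈-filter⁻ (_∈? S) {xs = allFin n} x∈)

length-elements : (S : Subset n) → length (elements S) ≡ ∣ S ∣
length-elements S = length-filter-tabulate (_∈? S) id S (λ i → mk⇔ id id)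
  where
  -- Generalised from `allFin` to `tabulate g`, since the tail of `allFin` is not itself an
  -- `allFin`.
  length-filter-tabulate : ∀ {P : Pred A ℓᵖ} (P? : ∀ x → Dec (P x)) {m} (g : Fin m → A) (S : Subset m) →
    (∀ i → P (g i) ⇔ i ∈ S) → length (filter P? (List.tabulate g)) ≡ ∣ S ∣
  length-filter-tabulate P? g []      P⇔∈ = refl
  length-filter-tabulate {P = P} P? {suc m} g (s ∷ S) P⇔∈ = go s P⇔∈
    where
    rest : (∀ i → P (g i) ⇔ i ∈ s ∷ S) → length (filter P? (List.tabulate (g ∘ suc))) ≡ ∣ S ∣
    rest P⇔∈ = length-filter-tabulate P? (g ∘ suc) S λ i →
      mk⇔ (drop-there ∘ Equivalence.to (P⇔∈ (suc i))) (Equivalence.from (P⇔∈ (suc i)) ∘ there)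
    go : ∀ s → (∀ i → P (g i) ⇔ i ∈ s ∷ S) → length (filter P? (List.tabulate g)) ≡ ∣ s ∷ S ∣
    go s P⇔∈′ with P? (g zero)
    go true  P⇔∈′ | yes _  = cong suc (rest P⇔∈)
    go false P⇔∈′ | no _   = rest P⇔∈
    go false P⇔∈′ | yes Pz = contradiction (Equivalence.to (P⇔∈′ zero) Pz) λ ()
    go true  P⇔∈′ | no ¬Pz = contradiction (Equivalence.from (P⇔∈′ zero) here) ¬Pz

x∈p─q⇒x∉q : ∀ (S T : Subset n) {x} → x ∈ S ─ T → x ∉ T
x∈p─q⇒x∉q (_ ∷ S) (true ∷ T)  () here
x∈p─q⇒x∉q (_ ∷ S) (_ ∷ T) (there x∈) (there x∈T) = x∈p─q⇒x∉q S T x∈ x∈T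

∣disjoint∣ : ∀ (S T U : Subset n) → S ⊆ U → T ⊆ U → (∀ {x} → x ∈ S → x ∉ T) → ∣ S ∣ + ∣ T ∣ ≤ ∣ U ∣
∣disjoint∣ []      []      []      S⊆U T⊆U dis = z≤n
∣disjoint∣ (s ∷ S) (t ∷ T) (u ∷ U) S⊆U T⊆U dis = go s t u S⊆U T⊆U dis
  where
  rest : ∣ S ∣ + ∣ T ∣ ≤ ∣ U ∣
  rest = ∣disjoint∣ S T U (drop-∷-⊆ S⊆U) (drop-∷-⊆ T⊆U) (λ x∈S x∈T → dis (there x∈S) (there x∈T))
  go : ∀ s t u → s ∷ S ⊆ u ∷ U → t ∷ T ⊆ u ∷ U → (∀ {x} → x ∈ s ∷ S → x ∉ t ∷ T) →
       ∣ s ∷ S ∣ + ∣ t ∷ T ∣ ≤ ∣ u ∷ U ∣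
  go true  true  _     _   _   dis = contradiction here (dis here)
  go true  _     false S⊆U _   _   = contradiction (S⊆U here) λ ()
  go _     true  false _   T⊆U _   = contradiction (T⊆U here) λ ()
  go true  false true  _   _   _   = s≤s rest
  go false true  true  _   _   _   = ℕ.≤-trans (ℕ.≤-reflexive (ℕ.+-suc ∣ S ∣ ∣ T ∣)) (s≤s rest)
  go false false true  _   _   _   = ℕ.m≤n⇒m≤1+n rest
  go false false false _   _   _   = rest

does⇒ : {P : Set ℓᵖ} (P? : Dec P) → does P? ≡ true → P
does⇒ (yes p) _ = p

does⇒¬ : {P : Set ℓᵖ} (P? : Dec P) → does P? ≡ false → ¬ P
does⇒¬ (no ¬p) _ = ¬p

∈-below⁺ : ∀ {i k : Fin n} → i Fin.< k → i ∈ below k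
∈-below⁺ {i = i} {k} i<k = lookup⇒∈ (trans (Vec.lookup∘tabulate _ i) (dec-true (i Fin.<? k) i<k))

∈-below⁻ : ∀ {i k : Fin n} → i ∈ below k → i Fin.< k
∈-below⁻ {i = i} {k} i∈ =
  does⇒ (i Fin.<? k) (trans (sym (Vec.lookup∘tabulate (λ i → does (i Fin.<? k)) i)) (∈⇒lookup i∈))

-- Triangulation

module _ (E : Graph n) (k : Fin n) where

  ∈-lower⁺ : ∀ {i} → Adjacent E k i → i Fin.< k → i ∈ lower E k
  ∈-lower⁺ k~i i<k = x∈p∩q⁺ (k~i , ∈-below⁺ i<k)

  lower⇒adjacent : ∀ {i} → i ∈ lower E k → Adjacent E k i
  lower⇒adjacent i∈ = proj₁ (x∈p∩q⁻ (neighbours E k) (below k) i∈)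

  lower⇒< : ∀ {i} → i ∈ lower E k → i Fin.< k
  lower⇒< i∈ = ∈-below⁻ (proj₂ (x∈p∩q⁻ (neighbours E k) (below k) i∈))

  private
    row : Fin n → Subset n
    row i = if does (i ∈? lower E k) then neighbours E i ∪ (lower E k - i) else neighbours E i

    neighbours-eliminate : ∀ i → neighbours (eliminate k E) i ≡ row i
    neighbours-eliminate = Vec.lookup∘tabulate row

  eliminate-⊇ : ∀ {i j} → Adjacent E i j → Adjacent (eliminate k E) i j
  eliminate-⊇ {i} {j} i~j rewrite neighbours-eliminate i with i ∈? lower E k
  ... | yes _ = p⊆p∪q _ i~j
  ... | no  _ = i~j

  eliminate-joins : ∀ {i j} → i ∈ lower E k → j ∈ lower E k → i ≢ j → Adjacent (eliminate k E) i j
  eliminate-joins {i} {j} i∈ j∈ i≢j rewrite neighbours-eliminate i with i ∈? lower E k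
  ... | yes _  = q⊆p∪q (neighbours E i) _ (x∈p∧x≢y⇒x∈p-y j∈ (i≢j ∘ sym))
  ... | no i∉ = contradiction i∈ i∉

  eliminate⁻ : ∀ {i j} → Adjacent (eliminate k E) i j →
               Adjacent E i j ⊎ (i ∈ lower E k × j ∈ lower E k × i ≢ j)
  eliminate⁻ {i} {j} i~j rewrite neighbours-eliminate i with i ∈? lower E k
  ... | no  _ = inj₁ i~j
  ... | yes i∈ = Sum.map₂
    (λ j∈ → i∈ , p─q⊆p (lower E k) ⁅ i ⁆ j∈ ,
      λ { refl → x∈p─q⇒x∉q (lower E k) ⁅ i ⁆ j∈ (x∈⁅x⁆ i) })
    (x∈p∪q⁻ (neighbours E i) _ i~j)

  eliminate-simple : IsSimple E → IsSimple (eliminate k E)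
  eliminate-simple simple = record
    { symmetric = λ i~j → case eliminate⁻ i~j of λ where
        (inj₁ i~j)             → eliminate-⊇ (symmetric i~j)
        (inj₂ (i∈ , j∈ , i≢j)) → eliminate-joins j∈ i∈ (i≢j ∘ sym)
    ; irreflexive = λ i~i → case eliminate⁻ i~i of λ where
        (inj₁ i~i)           → irreflexive i~i
        (inj₂ (_ , _ , i≢i)) → i≢i refl
    }
    where open IsSimple simple

-- The graph in which the vertices from m on are eliminated.

stage : Graph n → ℕ → Graph n
stage {n} E m = List.foldr eliminate E (drop m (allFin n))

module _ (E : Graph n) where

  stage-start : stage E n ≡ E
  stage-start = cong (List.foldr eliminate E)
    (List.drop-all n (allFin n) (ℕ.≤-reflexive (List.length-tabulate {n = n} id)))

  stage-step : ∀ k → stage E (toℕ k) ≡ eliminate k (stage E (suc (toℕ k)))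
  stage-step k = cong (List.foldr eliminate E) (drop-tabulate id k)
    where
    drop-tabulate : ∀ {a} {A : Set a} {n} (f : Fin n → A) k →
                    drop (toℕ k) (List.tabulate f) ≡ f k ∷ drop (suc (toℕ k)) (List.tabulate f)
    drop-tabulate f zero    = refl
    drop-tabulate f (suc k) = drop-tabulate (f ∘ suc) k

  -- Descending induction from `l` to `m`. The inductive step also learns `toℕ k < l`, which lets
  -- `lower-triangulate⇒stage` conclude that the later eliminations leave a fixed row alone.
  stage-induction : (I : ℕ → Pred (Graph n) ℓᵖ) → ∀ {m l} → m ≤ l → l ≤ n → I l (stage E l) →
    (∀ k → toℕ k < l → I (suc (toℕ k)) (stage E (suc (toℕ k))) →
      I (toℕ k) (eliminate k (stage E (suc (toℕ k))))) →
    I m (stage E m)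
  stage-induction I {m} m≤l l≤n start next = go (ℕ.≤⇒≤′ m≤l) l≤n start next
    where
    go : ∀ {l} → m ℕ.≤′ l → l ≤ n → I l (stage E l) →
      (∀ k → toℕ k < l → I (suc (toℕ k)) (stage E (suc (toℕ k))) →
        I (toℕ k) (eliminate k (stage E (suc (toℕ k))))) →
      I m (stage E m)
    go ℕ.≤′-refl l≤n start next = start
    go {suc l} (ℕ.≤′-step m≤l) l<n start next = go m≤l (ℕ.<⇒≤ l<n) I-l
      (λ k k<l → next k (ℕ.m<n⇒m<1+n k<l))
      where
      k = Fin.fromℕ< l<n
      k≡l : toℕ k ≡ l
      k≡l = Fin.toℕ-fromℕ< l<n
      I-l : I l (stage E l)
      I-l = subst (λ l → I l (stage E l)) k≡l
        (subst (I (toℕ k)) (sym (stage-step k))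
          (next k (s≤s (ℕ.≤-reflexive k≡l)) (subst (λ l → I (suc l) (stage E (suc l))) (sym k≡l) start)))

  stage-⊆ : ∀ {m l} → m ≤ l → l ≤ n → ∀ {i j} → Adjacent (stage E l) i j → Adjacent (stage E m) i j
  stage-⊆ {m} {l} m≤l l≤n {i} {j} i~j =
    stage-induction (λ _ G → Adjacent G i j) m≤l l≤n i~j (λ k _ → eliminate-⊇ (stage E (suc (toℕ k))) k)

  -- Eliminating some `l ≤ k` adds edges only among vertices below `l`, hence none at `k`: the lower
  -- neighbours of `k` are final as soon as all greater vertices are eliminated.
  lower-triangulate⇒stage : ∀ k {i} → i ∈ lower (triangulate E) k → i ∈ lower (stage E (suc (toℕ k))) k
  lower-triangulate⇒stage k {i} i∈ = ∈-lower⁺ H k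
    (stage-induction (λ _ G → Adjacent G k i → Adjacent H k i) z≤n (Fin.toℕ<n k) id
      (λ l l≤k IH k~i → case eliminate⁻ (stage E (suc (toℕ l))) l k~i of λ where
        (inj₁ k~i)       → IH k~i
        (inj₂ (k∈ , _)) → contradiction (ℕ.≤-pred l≤k) (ℕ.<⇒≱ (lower⇒< (stage E (suc (toℕ l))) l k∈)))
      (lower⇒adjacent (triangulate E) k i∈))
    (lower⇒< (triangulate E) k i∈)
    where H = stage E (suc (toℕ k))

  lower-stage⇒triangulate : ∀ k {i} → i ∈ lower (stage E (suc (toℕ k))) k → i ∈ lower (triangulate E) k
  lower-stage⇒triangulate k i∈ = ∈-lower⁺ (triangulate E) k
    (stage-⊆ z≤n (Fin.toℕ<n k) (lower⇒adjacent H k i∈)) (lower⇒< H k i∈)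
    where H = stage E (suc (toℕ k))

  -- Eliminating `k` joins its lower neighbours of that moment, which are already the final ones. So
  -- the positions, read downwards, form a perfect elimination ordering.
  lower-clique : ∀ k → IsClique (triangulate E) (lower (triangulate E) k)
  lower-clique k i∈ j∈ i≢j = stage-⊆ z≤n (ℕ.<⇒≤ (Fin.toℕ<n k))
    (subst (λ G → Adjacent G _ _) (sym (stage-step k))
      (eliminate-joins (stage E (suc (toℕ k))) k (lower-triangulate⇒stage k i∈) (lower-triangulate⇒stage k j∈) i≢j))

  ⊆-triangulate : ∀ {i j} → Adjacent E i j → Adjacent (triangulate E) i j
  ⊆-triangulate {i} {j} i~j = stage-⊆ z≤n ℕ.≤-refl (subst (λ G → Adjacent G i j) (sym stage-start) i~j)

  module _ (simple : IsSimple E) where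

    stage-simple : ∀ {m} → m ≤ n → IsSimple (stage E m)
    stage-simple m≤n = stage-induction (λ _ → IsSimple) m≤n ℕ.≤-refl (subst IsSimple (sym stage-start) simple)
      (λ k _ → eliminate-simple (stage E (suc (toℕ k))) k)

    triangulate-simple : IsSimple (triangulate E)
    triangulate-simple = stage-simple z≤n

    -- One half of the fill-path characterisation. An edge added at `k` is replaced by the paths
    -- from its ends to `k`; as `k` is greater than both ends, so is everything inside those paths.
    triangulate-path : ∀ {i j} → Adjacent (triangulate E) i j →
      PathWithin E (λ x → x ≡ i ⊎ x ≡ j ⊎ (i Fin.< x × j Fin.< x)) i j
    triangulate-path = proj₂ (stage-induction
      (λ _ G → IsSimple G × (∀ {i j} → Adjacent G i j → Above i j))
      z≤n ℕ.≤-refl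
      (subst (λ G → IsSimple G × (∀ {i j} → Adjacent G i j → Above i j)) (sym stage-start)
        (simple , λ i~j → (inj₁ refl , inj₂ (inj₁ refl) , i~j) ◅ ε))
      λ k _ (sim , path) → let H = stage E (suc (toℕ k)) in
        eliminate-simple H k sim , λ i~j → case eliminate⁻ H k i~j of λ where
        (inj₁ i~j) → path i~j
        (inj₂ (i∈ , j∈ , _)) → through (lower⇒< H k i∈) (lower⇒< H k j∈)
          (path (IsSimple.symmetric sim (lower⇒adjacent H k i∈))) (path (lower⇒adjacent H k j∈)))
      where
      Above : Rel (Fin n) 0ℓ
      Above i j = PathWithin E (λ x → x ≡ i ⊎ x ≡ j ⊎ (i Fin.< x × j Fin.< x)) i j
      within : ∀ {P Q : Fin n → Set} → (∀ {x} → P x → Q x) → ∀ {i j} → PathWithin E P i j → PathWithin E Q i j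
      within P⊆Q = Star.map λ (Px , Py , x~y) → P⊆Q Px , P⊆Q Py , x~y
      through : ∀ {i j k} → i Fin.< k → j Fin.< k → Above i k → Above k j → Above i j
      through i<k j<k p q =
        within (λ { (inj₁ refl)               → inj₁ refl
                  ; (inj₂ (inj₁ refl))        → inj₂ (inj₂ (i<k , j<k))
                  ; (inj₂ (inj₂ (i<x , k<x))) → inj₂ (inj₂ (i<x , ℕ.<-trans j<k k<x)) }) p ◅◅
        within (λ { (inj₁ refl)               → inj₂ (inj₂ (i<k , j<k))
                  ; (inj₂ (inj₁ refl))        → inj₂ (inj₁ refl)
                  ; (inj₂ (inj₂ (k<x , j<x))) → inj₂ (inj₂ (ℕ.<-trans i<k k<x , j<x)) }) q

    lower⇒E′ : ∀ k {j} → j ∈ lower (triangulate E) k → E′ E k j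
    lower⇒E′ k j∈ = lower⇒< (triangulate E) k j∈ , Star.map
      (λ (Px , Py , x~y) → weaken Px , weaken Py , x~y) (triangulate-path (lower⇒adjacent (triangulate E) k j∈))
      where
      weaken : ∀ {x j} → x ≡ k ⊎ x ≡ j ⊎ (k Fin.< x × j Fin.< x) → x ≡ j ⊎ k Fin.≤ x
      weaken (inj₁ refl)              = inj₂ ℕ.≤-refl
      weaken (inj₂ (inj₁ x≡j))        = inj₁ x≡j
      weaken (inj₂ (inj₂ (k<x , _)))  = inj₂ (ℕ.<⇒≤ k<x)

    -- The condition `E′` is not known to be decidable, so the set of its solutions exists only up
    -- to double negation. This suffices, because the inequality between numbers is decidable and
    -- hence stable.
    lower≤width : ∀ {w} → IsInducedWidth E w → ∀ k → ∣ lower (triangulate E) k ∣ ≤ w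
    lower≤width {w} (_ , max) k = decidable-stable (_ ℕ.≤? _) λ lower≰w →
      ¬¬-comprehension (E′ E k) λ (S , S⇔E′) →
      lower≰w (ℕ.≤-trans (p⊆q⇒∣p∣≤∣q∣ {p = lower (triangulate E) k} (Equivalence.from (S⇔E′ _) ∘ lower⇒E′ k))
                         (max ∣ S ∣ (k , S , S⇔E′ , refl)))
      where
      ¬¬-comprehension : ∀ {n} (P : Fin n → Set) → ¬ ¬ (∃[ S ] ∀ x → x ∈ S ⇔ P x)
      ¬¬-comprehension {zero}  P none = none ([] , λ ())
      ¬¬-comprehension {suc n} P none = ¬¬-comprehension (P ∘ suc) λ (S , S⇔P) → ¬¬-excluded-middle {A = P zero} λ where
        (yes Pz) → none (true  ∷ S , λ { zero    → mk⇔ (λ _ → Pz) (λ _ → here)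
                                       ; (suc x) → mk⇔ (Equivalence.to (S⇔P x) ∘ drop-there) (there ∘ Equivalence.from (S⇔P x)) })
        (no ¬Pz) → none (false ∷ S , λ { zero    → mk⇔ (λ ()) (λ Pz → contradiction Pz ¬Pz)
                                       ; (suc x) → mk⇔ (Equivalence.to (S⇔P x) ∘ drop-there) (there ∘ Equivalence.from (S⇔P x)) })

∣p∪q∣≤∣p∣+∣q∣ : ∀ (S T : Subset n) → ∣ S ∪ T ∣ ≤ ∣ S ∣ + ∣ T ∣
∣p∪q∣≤∣p∣+∣q∣ []          []          = z≤n
∣p∪q∣≤∣p∣+∣q∣ (true ∷ S)  (true ∷ T)  = s≤s (ℕ.≤-trans (∣p∪q∣≤∣p∣+∣q∣ S T) (ℕ.+-monoʳ-≤ ∣ S ∣ (ℕ.n≤1+n _)))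
∣p∪q∣≤∣p∣+∣q∣ (true ∷ S)  (false ∷ T) = s≤s (∣p∪q∣≤∣p∣+∣q∣ S T)
∣p∪q∣≤∣p∣+∣q∣ (false ∷ S) (true ∷ T)  = ℕ.≤-trans (s≤s (∣p∪q∣≤∣p∣+∣q∣ S T)) (ℕ.≤-reflexive (sym (ℕ.+-suc ∣ S ∣ ∣ T ∣)))
∣p∪q∣≤∣p∣+∣q∣ (false ∷ S) (false ∷ T) = ∣p∪q∣≤∣p∣+∣q∣ S T

-- In a complete graph everything else lies below the last vertex. This takes over in the time bound
-- when there are no separators.
complete⇒width : {E : Graph (suc n)} → (∀ i j → i ≢ j → Adjacent E i j) → n ≤ ∣ lower E (Fin.fromℕ n) ∣
complete⇒width {n} {E} complete = ℕ.≤-pred (begin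
  suc n                            ≡⟨ ∣⊤∣≡n (suc n) ⟨
  ∣ ⊤ {suc n} ∣                    ≤⟨ p⊆q⇒∣p∣≤∣q∣ {p = ⊤ {suc n}} (λ _ → covers _) ⟩
  ∣ lower E m ∪ ⁅ m ⁆ ∣            ≤⟨ ∣p∪q∣≤∣p∣+∣q∣ (lower E m) ⁅ m ⁆ ⟩
  ∣ lower E m ∣ + ∣ ⁅ m ⁆ ∣        ≡⟨ cong (∣ lower E m ∣ +_) (∣⁅x⁆∣≡1 m) ⟩
  ∣ lower E m ∣ + 1                ≡⟨ ℕ.+-comm _ 1 ⟩
  suc ∣ lower E m ∣                ∎)
  where
  open ℕ.≤-Reasoning
  m = Fin.fromℕ n
  covers : ∀ x → x ∈ lower E m ∪ ⁅ m ⁆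
  covers x with x Fin.≟ m
  ... | yes refl = q⊆p∪q _ ⁅ m ⁆ (x∈⁅x⁆ m)
  ... | no x≢m   = p⊆p∪q _ (∈-lower⁺ E m (complete m x (x≢m ∘ sym))
    (subst (toℕ x <_) (sym (Fin.toℕ-fromℕ n)) (ℕ.≤∧≢⇒< (ℕ.≤-pred (Fin.toℕ<n x))
      λ x≡n → x≢m (Fin.toℕ-injective (trans x≡n (sym (Fin.toℕ-fromℕ n)))))))

-- Trees of vertex sets

rootOf : (t : Tree n) → Node t
rootOf (node C ts) = root

top-label : Tree n → Subset n
top-label (node C _) = C

label-root : (t : Tree n) → label (rootOf t) ≡ top-label t
label-root (node C ts) = refl

infix 4 _∈ᵗ_

_∈ᵗ_ : Fin n → Tree n → Set
v ∈ᵗ t = ∃[ c ] v ∈ label {t = t} c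

VLink : (v : Fin n) {t : Tree n} → Rel (Node t) 0ℓ
VLink v x y = Link x y × v ∈ label x × v ∈ label y

SubtreeProperty : Tree n → Set
SubtreeProperty t = ∀ v (c c′ : Node t) → v ∈ label c → v ∈ label c′ → EqClosure (VLink v) c c′

Antichain : Tree n → Set
Antichain t = ∀ (c c′ : Node t) → label c ⊆ label c′ → c ≡ c′

-- A local form of these two properties, by recursion on the tree.

mutual
  data Coherent {n} : Tree n → Set where
    node : ∀ {C ts} → All (Hangs C) ts →
           AllPairs (λ t t′ → ∀ {v} → v ∈ᵗ t → v ∈ᵗ t′ → v ∈ C) ts →
           Coherent (node C ts)

  record Hangs {n} (C : Subset n) (t : Tree n) : Set where
    inductive
    constructor hangs
    field
      coherent : Coherent t
      meets    : ∀ {v} → v ∈ᵗ t → v ∈ C → v ∈ top-label t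
      new      : top-label t ⊈ C
      old      : C ⊈ top-label t
open Hangs public

∈-top : ∀ {t : Tree n} {v} → v ∈ top-label t → v ∈ᵗ t
∈-top {t = t} {v} v∈C = rootOf t , subst (v ∈_) (sym (label-root t)) v∈C

∈-child : ∀ {C : Subset n} {t ts} → t List.∈ ts → ∀ {v} → v ∈ᵗ t → v ∈ᵗ node C ts
∈-child p (c , v∈c) = child p c , v∈c

-- A node below the root carries a membership proof, so siblings are told apart by their positions
-- in the list. This stays decidable even if equal trees occur twice.
data Before {A : Set} : ∀ {x y : A} {xs} → x List.∈ xs → y List.∈ xs → Set where
  here  : ∀ {x y xs} {q : y List.∈ xs} → Before {x = x} (here refl) (there q)
  there : ∀ {x y z xs} {p : x List.∈ xs} {q : y List.∈ xs} →
          Before p q → Before (there {x = z} p) (there q)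

data Position {A : Set} : ∀ {x y : A} {xs} → x List.∈ xs → y List.∈ xs → Set where
  same   : ∀ {x xs} {p : x List.∈ xs} → Position p p
  before : ∀ {x y xs} {p : x List.∈ xs} {q : y List.∈ xs} → Before p q → Position p q
  after  : ∀ {x y xs} {p : x List.∈ xs} {q : y List.∈ xs} → Before q p → Position p q

position : ∀ {A : Set} {x y : A} {xs} (p : x List.∈ xs) (q : y List.∈ xs) → Position p q
position (here refl) (here refl) = same
position (here refl) (there q)   = before here
position (there p)   (here refl) = after here
position (there p)   (there q) with position p q
... | same     = same
... | before l = before (there l)
... | after l  = after (there l)

Before-irrefl : ∀ {A : Set} {x : A} {xs} {p : x List.∈ xs} → ¬ Before p p
Before-irrefl {p = there p} (there l) = Before-irrefl l

AllPairs-lookup : ∀ {A : Set} {R : Rel A 0ℓ} {xs} → AllPairs R xs →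
  ∀ {x y} {p : x List.∈ xs} {q : y List.∈ xs} → Before p q → R x y
AllPairs-lookup (Rx ∷ _)  {q = there q} here = All.lookup Rx q
AllPairs-lookup (_ ∷ Rxs) (there l)          = AllPairs-lookup Rxs l

AllPairs-tabulate : ∀ {A : Set} {R : Rel A 0ℓ} {xs} →
  (∀ {x y} {p : x List.∈ xs} {q : y List.∈ xs} → Before p q → R x y) → AllPairs R xs
AllPairs-tabulate {xs = []}     f = []
AllPairs-tabulate {xs = x ∷ xs} f = All.tabulate (λ q → f {q = there q} here) ∷ AllPairs-tabulate (f ∘ there)

module _ {C : Subset n} {t : Tree n} {ts} (p : t List.∈ ts) where

  data Under : Node (node C ts) → Set where
    under : ∀ {c} → Under (child p c)

  -- A walk can leave the subtree at p only along the link to its root.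

  leaving : ∀ {v x y} → EqClosure (VLink v) x y → Under x → ¬ Under y → v ∈ C × v ∈ top-label t
  leaving ε x-under ¬y-under = contradiction x-under ¬y-under
  leaving (fwd (under _ _ , _) ◅ l) under = leaving l under
  leaving (bwd (under _ _ , _) ◅ l) under = leaving l under
  leaving (bwd (top _ , v∈C , v∈D) ◅ _) under _ = v∈C , v∈D

-- Everything outside the subtree at `p` collapses to its root. Links outside become trivial, so a
-- chain in the whole tree turns into a chain in the subtree.
project : ∀ {t t′ : Tree n} {ts} → t List.∈ ts → t′ List.∈ ts → Node t′ → Node t
project {t = t} p q c with position p q
... | same     = c
... | before _ = rootOf t
... | after  _ = rootOf t

project-same : ∀ {t : Tree n} {ts} (p : t List.∈ ts) c → project p p c ≡ c
project-same p c with position p p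
... | same     = refl
... | before l = contradiction l Before-irrefl
... | after  l = contradiction l Before-irrefl

project-root : ∀ {t t′ : Tree n} {ts} (p : t List.∈ ts) (q : t′ List.∈ ts) → project p q (rootOf t′) ≡ rootOf t
project-root p q with position p q
... | same     = refl
... | before _ = refl
... | after  _ = refl

project-node : ∀ {C : Subset n} {t ts} → t List.∈ ts → Node (node C ts) → Node t
project-node {t = t} p root = rootOf t
project-node p (child q c)  = project p q c

project-link : ∀ {C : Subset n} {t ts v} (p : t List.∈ ts) {x y} →
  VLink v {node C ts} x y → EqClosure (VLink v) (project-node p x) (project-node p y)
project-link p (top q , _) rewrite project-root p q = ε
project-link p (under q l , v∈x , v∈y) with position p q
... | same     = fwd (l , v∈x , v∈y) ◅ ε
... | before _ = ε
... | after  _ = ε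

subtree-child : ∀ {C : Subset n} {t ts} → t List.∈ ts → SubtreeProperty (node C ts) → SubtreeProperty t
subtree-child p conn v c c′ v∈c v∈c′ =
  subst₂ (EqClosure (VLink v)) (project-same p c) (project-same p c′)
    (Star.kleisliStar (project-node p)
      (λ { (fwd l) → project-link p l ; (bwd l) → Star.reverse (Sym.symmetric _) (project-link p l) })
      (conn v (child p c) (child p c′) v∈c v∈c′))

child-injective : ∀ {C : Subset n} {t ts} {p : t List.∈ ts} {c c′} → child {C = C} p c ≡ child p c′ → c ≡ c′
child-injective refl = refl

-- By `leaving`, a vertex shared with a sibling or with the parent belongs to both ends of the link
-- above the child; this gives disjointness and `meets`. An inclusion between the labels of parent
-- and child would identify two distinct nodes; this gives `new` and `old`.
coherent⁺ : (t : Tree n) → SubtreeProperty t → Antichain t → Coherent t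
coherent⁺ (node C ts) conn anti = node (go ts id) (AllPairs-tabulate disjoint)
  where
  disjoint : ∀ {t t′} {p : t List.∈ ts} {q : t′ List.∈ ts} → Before p q →
             ∀ {v} → v ∈ᵗ t → v ∈ᵗ t′ → v ∈ C
  disjoint {p = p} {q} p<q (c , v∈c) (c′ , v∈c′) =
    proj₁ (leaving p (conn _ (child p c) (child q c′) v∈c v∈c′) under λ { under → Before-irrefl p<q })
  go : ∀ ts′ → (∀ {t} → t List.∈ ts′ → t List.∈ ts) → All (Hangs C) ts′
  go []                   ∈ts = []
  go (t@(node D us) ∷ ts′) ∈ts = hangs
    (coherent⁺ t (subtree-child p conn) λ c c′ c⊆c′ → child-injective (anti (child p c) (child p c′) c⊆c′))
    (λ { (c , v∈c) v∈C → proj₂ (leaving p (conn _ (child p c) root v∈c v∈C) under λ ()) })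
    (λ D⊆C → case anti (child p root) root D⊆C of λ ())
    (λ C⊆D → case anti root (child p root) C⊆D of λ ())
    ∷ go ts′ (∈ts ∘ there)
    where p = ∈ts (here refl)

module _ {C : Subset n} {ts : List (Tree n)} (all : All (Hangs C) ts)
         (pairs : AllPairs (λ t t′ → ∀ {v} → v ∈ᵗ t → v ∈ᵗ t′ → v ∈ C) ts) where

  siblings-meet : ∀ {t t′} {p : t List.∈ ts} {q : t′ List.∈ ts} → Before p q ⊎ Before q p →
                  ∀ {v} → v ∈ᵗ t → v ∈ᵗ t′ → v ∈ C
  siblings-meet (inj₁ l) v∈t v∈t′ = AllPairs-lookup pairs l v∈t v∈t′
  siblings-meet (inj₂ l) v∈t v∈t′ = AllPairs-lookup pairs l v∈t′ v∈t

lift-chain : ∀ {C : Subset n} {t ts v} (p : t List.∈ ts) {c c′} →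
  EqClosure (VLink v) c c′ → EqClosure (VLink v {node C ts}) (child p c) (child p c′)
lift-chain p = Star.gmap (child p) (Sym.gmap (child p) λ (l , v∈c , v∈c′) → under p l , v∈c , v∈c′)

chain-sym : ∀ {t : Tree n} {v} {c c′ : Node t} → EqClosure (VLink v) c c′ → EqClosure (VLink v) c′ c
chain-sym = Star.reverse (Sym.symmetric _)

chain-to-root : ∀ {t : Tree n} → Coherent t → ∀ {v} (c : Node t) → v ∈ label c → v ∈ top-label t →
                EqClosure (VLink v) c (rootOf t)
chain-to-root (node all pairs) root v∈c v∈C = ε
chain-to-root (node all pairs) (child {t = node D us} p c) v∈c v∈C =
  lift-chain p (chain-to-root (coherent h) c v∈c v∈D) ◅◅ bwd (top p , v∈C , v∈D) ◅ ε
  where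
  h = All.lookup all p
  v∈D = meets h (c , v∈c) v∈C

coherent⇒subtree : ∀ {t : Tree n} → Coherent t → SubtreeProperty t
coherent⇒subtree co@(node _ _) v c root v∈c v∈c′ = chain-to-root co c v∈c v∈c′
coherent⇒subtree co@(node _ _) v root c′@(child _ _) v∈c v∈c′ = chain-sym (chain-to-root co c′ v∈c′ v∈c)
coherent⇒subtree {t = node C ts} co@(node all pairs) v (child p c) (child q c′) v∈c v∈c′ with position p q
... | same     = lift-chain p (coherent⇒subtree (coherent (All.lookup all p)) v c c′ v∈c v∈c′)
... | before l = through (siblings-meet all pairs (inj₁ l) (c , v∈c) (c′ , v∈c′))
  where
  through : v ∈ C → EqClosure (VLink v) (child p c) (child q c′)
  through v∈C = chain-to-root co (child p c) v∈c v∈C ◅◅ chain-sym (chain-to-root co (child q c′) v∈c′ v∈C)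
... | after l  = through (siblings-meet all pairs (inj₂ l) (c , v∈c) (c′ , v∈c′))
  where
  through : v ∈ C → EqClosure (VLink v) (child p c) (child q c′)
  through v∈C = chain-to-root co (child p c) v∈c v∈C ◅◅ chain-sym (chain-to-root co (child q c′) v∈c′ v∈C)

-- If `c` lay below a child, `meets` would put its label inside the label of that child. By
-- induction `c` would be the root of the child, whose label cannot lie inside `C` because of `new`.
⊆top⇒root : ∀ {t : Tree n} → Coherent t → (c : Node t) → label c ⊆ top-label t → c ≡ rootOf t
⊆top⇒root (node all pairs) root c⊆C = refl
⊆top⇒root {t = node C ts} (node all pairs) (child {t = t} p c) c⊆C = ⊥-elim
  (new h λ {v} v∈D → c⊆C (subst (λ c → v ∈ label c) (sym c≡root) (subst (v ∈_) (sym (label-root t)) v∈D)))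
  where
  h = All.lookup all p
  c≡root = ⊆top⇒root (coherent h) c λ v∈c → meets h (c , v∈c) (c⊆C v∈c)

coherent⇒antichain : ∀ {t : Tree n} → Coherent t → Antichain t
coherent⇒antichain (node _ _) root root _ = refl
coherent⇒antichain (node all pairs) root (child p c) C⊆c =
  ⊥-elim (old h λ v∈C → meets h (c , C⊆c v∈C) v∈C)
  where h = All.lookup all p
coherent⇒antichain co@(node _ _) c@(child _ _) root c⊆C = ⊆top⇒root co c c⊆C
coherent⇒antichain co@(node all pairs) (child p c) (child q c′) c⊆c′ with position p q
... | same     = cong (child p) (coherent⇒antichain (coherent (All.lookup all p)) c c′ c⊆c′)
... | before l = case ⊆top⇒root co (child p c) (λ v∈c → siblings-meet all pairs (inj₁ l) (c , v∈c) (c′ , c⊆c′ v∈c)) of λ ()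
... | after l  = case ⊆top⇒root co (child p c) (λ v∈c → siblings-meet all pairs (inj₂ l) (c , v∈c) (c′ , c⊆c′ v∈c)) of λ ()

-- Building a clique tree

∈ᵗ-node⁻ : ∀ {C : Subset n} {ts v} → v ∈ᵗ node C ts → v ∈ C ⊎ Any (v ∈ᵗ_) ts
∈ᵗ-node⁻ (root , v∈C)      = inj₁ v∈C
∈ᵗ-node⁻ (child p c , v∈c) = inj₂ (lose p (c , v∈c))

∈ᵗ-node⁺ : ∀ {C : Subset n} {ts v} → v ∈ C ⊎ Any (v ∈ᵗ_) ts → v ∈ᵗ node C ts
∈ᵗ-node⁺ (inj₁ v∈C)  = root , v∈C
∈ᵗ-node⁺ (inj₂ v∈ts) with _ , p , c , v∈c ← find v∈ts = child p c , v∈c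

mutual
  size : Tree n → ℕ
  size (node C ts) = suc (sizes ts)

  sizes : List (Tree n) → ℕ
  sizes []       = 0
  sizes (t ∷ ts) = size t + sizes ts

leaf-∈ : ∀ {C : Subset n} {v} → v ∈ᵗ node C [] → v ∈ C
leaf-∈ (root , v∈C) = v∈C

-- The invariant of the construction, relative to the label P of the
-- parent: a vertex brings its lower neighbours along where it is new.

data Filled {n} (G : Graph n) (P : Subset n) : Tree n → Set where
  node : ∀ {C ts} → IsClique G C → (∀ {v} → v ∈ C → v ∉ P → lower G v ⊆ C) →
         All (Filled G C) ts → Filled G P (node C ts)

Filled-⊆ : ∀ {G : Graph n} {P Q t} → P ⊆ Q → Filled G P t → Filled G Q t
Filled-⊆ P⊆Q (node clique fill all) = node clique (λ v∈C v∉Q → fill v∈C (v∉Q ∘ P⊆Q)) all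

Filled-clique : ∀ {G : Graph n} {P t} → Filled G P t → (c : Node t) → IsClique G (label c)
Filled-clique (node clique _ _) root        = clique
Filled-clique (node _ _ all)    (child p c) = Filled-clique (All.lookup all p) c

Filled-home : ∀ {G : Graph n} {P t} → Filled G P t → ∀ {p} → p ∈ᵗ t → p ∉ P →
              ∃[ c ] p ∈ label {t = t} c × lower G p ⊆ label c
Filled-home {t = node C ts} (node _ fill all) {p} p∈t p∉P with p ∈? C | p∈t
... | yes p∈C | _                 = root , p∈C , fill p∈C p∉P
... | no  p∉C | root , p∈C        = contradiction p∈C p∉C
... | no  p∉C | child q c , p∈c
  with c′ , p∈c′ , fills ← Filled-home (All.lookup all q) (c , p∈c) p∉C = child q c′ , p∈c′ , fills

data IsGreatest {n} (S : Subset n) : Maybe (Fin n) → Set where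
  nothing : (∀ {v} → v ∉ S) → IsGreatest S nothing
  just    : ∀ {p} → p ∈ S → (∀ {v} → v ∈ S → v ≢ p → v Fin.< p) → IsGreatest S (just p)

last-greatest : (S : Subset n) → IsGreatest S (last (elements S))
last-greatest {n} S = go (elements S) refl
  where
  sorted : AllPairs Fin._<_ (elements S)
  sorted = AllPairs.filter⁺ (_∈? S) (AllPairs.tabulate⁺-< id)
  last-max : ∀ {x : Fin n} {xs} → AllPairs Fin._<_ (x ∷ xs) →
             ∃[ p ] last (x ∷ xs) ≡ just p × p List.∈ (x ∷ xs) × (∀ {v} → v List.∈ (x ∷ xs) → v ≢ p → v Fin.< p)
  last-max {x} {[]} _ = x , refl , here refl , λ { (here v≡x) v≢x → contradiction v≡x v≢x }
  last-max {x} {y ∷ xs} (x< ∷ rest) with p , eq , p∈ , max ← last-max rest =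
    p , eq , there p∈ , λ { (here refl) _ → All.lookup x< p∈ ; (there v∈) v≢p → max v∈ v≢p }
  go : ∀ xs → elements S ≡ xs → IsGreatest S (last xs)
  go []       eq = nothing λ v∈S → case subst (_ List.∈_) eq (∈-elements⁺ v∈S) of λ ()
  go (x ∷ xs) eq with p , eq′ , p∈ , max ← last-max (subst (AllPairs Fin._<_) eq sorted) rewrite eq′ =
    just (∈-elements⁻ (subst (p List.∈_) (sym eq) p∈)) λ v∈S → max (subst (_ List.∈_) eq (∈-elements⁺ v∈S))

∪⁅⁆⁻ : ∀ (S : Subset n) {k v} → v ∈ S ∪ ⁅ k ⁆ → v ∈ S ⊎ v ≡ k
∪⁅⁆⁻ S {k} v∈ = Sum.map₂ (x∈⁅y⁆⇒x≡y k) (x∈p∪q⁻ S ⁅ k ⁆ v∈)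

⊆∪⁅⁆ : ∀ (S : Subset n) k → S ⊆ S ∪ ⁅ k ⁆
⊆∪⁅⁆ S k = p⊆p∪q ⁅ k ⁆

∈∪⁅⁆ : ∀ (S : Subset n) k → k ∈ S ∪ ⁅ k ⁆
∈∪⁅⁆ S k = q⊆p∪q S ⁅ k ⁆ (x∈⁅x⁆ k)

-- k is inserted into t below P.

record Grown {n} (G : Graph n) (k : Fin n) (P : Subset n) (t t′ : Tree n) : Set where
  field
    coherent  : Coherent t′
    filled    : Filled G P t′
    ∈ᵗ⁺       : ∀ {v} → v ∈ᵗ t → v ∈ᵗ t′
    ∈ᵗ⁻       : ∀ {v} → v ∈ᵗ t′ → v ∈ᵗ t ⊎ v ≡ k
    k∈t′      : k ∈ᵗ t′
    top-label⁺ : top-label t ⊆ top-label t′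
    top-label⁻ : ∀ {v} → v ∈ top-label t′ → v ∈ top-label t ⊎ v ≡ k
    size≤     : size t′ ≤ suc (size t)

-- Exactly one entry changes. In an insertion it is the child that contains the greatest lower
-- neighbour `p` of `k`: two such children would force `p` into the label of their parent.
data Replaced {A : Set} (R : Rel A 0ℓ) : Rel (List A) 0ℓ where
  here  : ∀ {x y xs} → R x y → Replaced R (x ∷ xs) (y ∷ xs)
  there : ∀ {x xs ys} → Replaced R xs ys → Replaced R (x ∷ xs) (x ∷ ys)

module Insertion {n} (G : Graph n) (simple : IsSimple G) (peo : ∀ k → IsClique G (lower G k))
                 {F : Set ℓᶠ} (k : Fin n) where

  private
    N : Subset n
    N = lower G k

    N∪k-clique : IsClique G (N ∪ ⁅ k ⁆)
    N∪k-clique i∈ j∈ i≢j with ∪⁅⁆⁻ N i∈ | ∪⁅⁆⁻ N j∈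
    ... | inj₁ i∈N  | inj₁ j∈N  = peo k i∈N j∈N i≢j
    ... | inj₁ i∈N  | inj₂ refl = IsSimple.symmetric simple (lower⇒adjacent G k i∈N)
    ... | inj₂ refl | inj₁ j∈N  = lower⇒adjacent G k j∈N
    ... | inj₂ refl | inj₂ refl = contradiction refl i≢j

  module _ {P C : Subset n} {ts} (N⊆C : N ⊆ C) (k∉t : ¬ k ∈ᵗ node C ts) where

    private
      t : Tree n
      t = node C ts

      k∉C : k ∉ C
      k∉C k∈C = k∉t (root , k∈C)

      k∉ts : ∀ {u} → u List.∈ ts → ¬ k ∈ᵗ u
      k∉ts u∈ts k∈u = k∉t (∈-child u∈ts k∈u)

      drop-k : ∀ {S T : Subset n} → k ∉ S → S ⊆ T ∪ ⁅ k ⁆ → S ⊆ T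
      drop-k {T = T} k∉S S⊆ v∈S with ∪⁅⁆⁻ T (S⊆ v∈S)
      ... | inj₁ v∈T  = v∈T
      ... | inj₂ refl = contradiction v∈S k∉S

    grow-root : Coherent t → Filled G P t → C ≡ N → Grown G k P t (node (C ∪ ⁅ k ⁆) ts)
    grow-root (node all pairs) (node clique fill all′) C≡N = record
      { coherent = node
          (All.tabulate λ u∈ts → let h = All.lookup all u∈ts in hangs (Hangs.coherent h)
            (λ v∈u v∈C∪k → case ∪⁅⁆⁻ C v∈C∪k of λ where
              (inj₁ v∈C)  → meets h v∈u v∈C
              (inj₂ refl) → contradiction v∈u (k∉ts u∈ts))
            (λ D⊆C∪k → new h (drop-k (k∉ts u∈ts ∘ ∈-top) D⊆C∪k))
            (λ C∪k⊆D → old h (C∪k⊆D ∘ ⊆∪⁅⁆ C k)))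
          (AllPairs.map (λ f {v} v∈u v∈u′ → ⊆∪⁅⁆ C k (f v∈u v∈u′)) pairs)
      ; filled = node
          (subst (λ S → IsClique G (S ∪ ⁅ k ⁆)) (sym C≡N) N∪k-clique)
          (λ v∈C∪k v∉P → case ∪⁅⁆⁻ C v∈C∪k of λ where
            (inj₁ v∈C)  → ⊆∪⁅⁆ C k ∘ fill v∈C v∉P
            (inj₂ refl) → ⊆∪⁅⁆ C k ∘ N⊆C)
          (All.map (Filled-⊆ (⊆∪⁅⁆ C k)) all′)
      ; ∈ᵗ⁺ = ∈ᵗ-node⁺ ∘ Sum.map₁ (⊆∪⁅⁆ C k) ∘ ∈ᵗ-node⁻
      ; ∈ᵗ⁻ = λ v∈t′ → case ∈ᵗ-node⁻ v∈t′ of λ where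
          (inj₁ v∈C∪k) → Sum.map₁ (root ,_) (∪⁅⁆⁻ C v∈C∪k)
          (inj₂ v∈ts)  → inj₁ (∈ᵗ-node⁺ (inj₂ v∈ts))
      ; k∈t′ = root , ∈∪⁅⁆ C k
      ; top-label⁺ = ⊆∪⁅⁆ C k
      ; top-label⁻ = ∪⁅⁆⁻ C
      ; size≤ = ℕ.n≤1+n _
      }

    grow-leaf : Coherent t → Filled G P t → C ≢ N → Grown G k P t (node C (node (N ∪ ⁅ k ⁆) [] ∷ ts))
    grow-leaf (node all pairs) (node clique fill all′) C≢N = record
      { coherent = node
          (hangs (node [] []) (λ v∈l _ → leaf-∈ v∈l)
            (λ N∪k⊆C → k∉C (N∪k⊆C (∈∪⁅⁆ N k)))
            -- Since `k` is fresh, such a `C` would lie inside `N` and hence equal it, which is the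
            -- case handled by `grow-root`.
            (λ C⊆N∪k → C≢N (⊆-antisym (drop-k k∉C C⊆N∪k) N⊆C))
          ∷ all)
          (All.tabulate (λ u∈ts v∈l v∈u → case ∪⁅⁆⁻ N (leaf-∈ v∈l) of λ where
            (inj₁ v∈N)  → N⊆C v∈N
            (inj₂ refl) → contradiction v∈u (k∉ts u∈ts))
          ∷ pairs)
      ; filled = node clique fill
          (node N∪k-clique
            (λ v∈N∪k v∉C → case ∪⁅⁆⁻ N v∈N∪k of λ where
              (inj₁ v∈N)  → contradiction (N⊆C v∈N) v∉C
              (inj₂ refl) → ⊆∪⁅⁆ N k)
            []
          ∷ all′)
      ; ∈ᵗ⁺ = ∈ᵗ-node⁺ ∘ Sum.map₂ there ∘ ∈ᵗ-node⁻
      ; ∈ᵗ⁻ = λ v∈t′ → case ∈ᵗ-node⁻ v∈t′ of λ where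
          (inj₁ v∈C)          → inj₁ (root , v∈C)
          (inj₂ (here v∈l))   → Sum.map₁ (λ v∈N → root , N⊆C v∈N) (∪⁅⁆⁻ N (leaf-∈ v∈l))
          (inj₂ (there v∈ts)) → inj₁ (∈ᵗ-node⁺ (inj₂ v∈ts))
      ; k∈t′ = child (here refl) root , ∈∪⁅⁆ N k
      ; top-label⁺ = id
      ; top-label⁻ = inj₁
      ; size≤ = ℕ.≤-refl
      }

    extend-runs : Coherent t → Filled G P t → Runs (extend k N C ts) (n + n) F (Grown G k P t)
    extend-runs co fi with Vec.≡-dec Bool._≟_ C N
    ... | yes C≡N = Runs-map (ℕ.≤-reflexive (cong (n +_) (ℕ.+-identityʳ n))) id
                      (Runs-cost n (Runs-cost n (Runs-return (grow-root co fi C≡N))))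
    ... | no  C≢N = Runs-map (ℕ.≤-reflexive (cong (n +_) (ℕ.+-identityʳ n))) id
                      (Runs-cost n (Runs-cost n (Runs-return (grow-leaf co fi C≢N))))

  -- Coherence survives because `k` is fresh: it is the only new member of the grown child, and it
  -- occurs neither in `C` nor in any sibling.
  grow-children : ∀ {P C : Subset n} {ts ts′} → ¬ k ∈ᵗ node C ts → Coherent (node C ts) → Filled G P (node C ts) →
                  Replaced (Grown G k C) ts ts′ → Grown G k P (node C ts) (node C ts′)
  grow-children {P} {C} {ts} {ts′} k∉t (node all pairs) (node clique fill all′) rep = record
    { coherent   = node (hang all rep) (pair (λ k∈ts → k∉t (∈ᵗ-node⁺ (inj₂ k∈ts))) pairs rep)
    ; filled     = node clique fill (fills all′ rep)
    ; ∈ᵗ⁺        = ∈ᵗ-node⁺ ∘ Sum.map₂ (any⁺ rep) ∘ ∈ᵗ-node⁻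
    ; ∈ᵗ⁻        = λ v∈t′ → case ∈ᵗ-node⁻ v∈t′ of λ where
        (inj₁ v∈C)   → inj₁ (root , v∈C)
        (inj₂ v∈ts′) → Sum.map₁ (∈ᵗ-node⁺ ∘ inj₂) (any⁻ rep v∈ts′)
    ; k∈t′       = ∈ᵗ-node⁺ (inj₂ (any-k rep))
    ; top-label⁺ = id
    ; top-label⁻ = inj₁
    ; size≤      = s≤s (sizes≤ rep)
    }
    where
    open Grown
    Rep = Replaced (Grown G k C)
    k∉C : k ∉ C
    k∉C k∈C = k∉t (root , k∈C)
    grown-hangs : ∀ {t t′} → Hangs C t → Grown G k C t t′ → Hangs C t′
    grown-hangs h g = hangs (coherent g)
      (λ v∈t′ v∈C → case ∈ᵗ⁻ g v∈t′ of λ where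
        (inj₁ v∈t)  → top-label⁺ g (meets h v∈t v∈C)
        (inj₂ refl) → contradiction v∈C k∉C)
      (λ D′⊆C → new h (D′⊆C ∘ top-label⁺ g))
      (λ C⊆D′ → old h λ v∈C → case top-label⁻ g (C⊆D′ v∈C) of λ where
        (inj₁ v∈D)  → v∈D
        (inj₂ refl) → contradiction v∈C k∉C)
    hang : ∀ {us us′} → All (Hangs C) us → Rep us us′ → All (Hangs C) us′
    hang (h ∷ hs) (here g)  = grown-hangs h g ∷ hs
    hang (h ∷ hs) (there r) = h ∷ hang hs r
    fills : ∀ {us us′} → All (Filled G C) us → Rep us us′ → All (Filled G C) us′
    fills (_ ∷ fs) (here g)  = filled g ∷ fs
    fills (f ∷ fs) (there r) = f ∷ fills fs r
    any⁺ : ∀ {us us′ v} → Rep us us′ → Any (v ∈ᵗ_) us → Any (v ∈ᵗ_) us′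
    any⁺ (here g)  (here v∈)  = here (∈ᵗ⁺ g v∈)
    any⁺ (here g)  (there v∈) = there v∈
    any⁺ (there r) (here v∈)  = here v∈
    any⁺ (there r) (there v∈) = there (any⁺ r v∈)
    any⁻ : ∀ {us us′ v} → Rep us us′ → Any (v ∈ᵗ_) us′ → Any (v ∈ᵗ_) us ⊎ v ≡ k
    any⁻ (here g)  (here v∈)  = Sum.map₁ here (∈ᵗ⁻ g v∈)
    any⁻ (here g)  (there v∈) = inj₁ (there v∈)
    any⁻ (there r) (here v∈)  = inj₁ (here v∈)
    any⁻ (there r) (there v∈) = Sum.map₁ there (any⁻ r v∈)
    any-k : ∀ {us us′} → Rep us us′ → Any (k ∈ᵗ_) us′
    any-k (here g)  = here (k∈t′ g)
    any-k (there r) = there (any-k r)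
    Meet : Rel (Tree n) 0ℓ
    Meet t t′ = ∀ {v} → v ∈ᵗ t → v ∈ᵗ t′ → v ∈ C
    pair : ∀ {us us′} → ¬ Any (k ∈ᵗ_) us → AllPairs Meet us → Rep us us′ → AllPairs Meet us′
    pair k∉ (m ∷ ms) (here g) =
      All.tabulate (λ u∈ v∈t′ v∈u → case ∈ᵗ⁻ g v∈t′ of λ where
        (inj₁ v∈t)  → All.lookup m u∈ v∈t v∈u
        (inj₂ refl) → contradiction (there (lose u∈ v∈u)) k∉) ∷ ms
    pair {t ∷ _} k∉ (m ∷ ms) (there r) = meet (k∉ ∘ here) m r ∷ pair (k∉ ∘ there) ms r
      where
      meet : ∀ {us us′} → ¬ k ∈ᵗ t → All (Meet t) us → Rep us us′ → All (Meet t) us′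
      meet k∉t (m ∷ ms) (here g) =
        (λ v∈t v∈u′ → case ∈ᵗ⁻ g v∈u′ of λ where
          (inj₁ v∈u)  → m v∈t v∈u
          (inj₂ refl) → contradiction v∈t k∉t) ∷ ms
      meet k∉t (m ∷ ms) (there r) = m ∷ meet k∉t ms r
    sizes≤ : ∀ {us us′} → Rep us us′ → sizes us′ ≤ suc (sizes us)
    sizes≤ {us = t ∷ us} (here g)  = ℕ.+-monoˡ-≤ (sizes us) (size≤ g)
    sizes≤ {us = t ∷ us} (there r) = ℕ.≤-trans (ℕ.+-monoʳ-≤ (size t) (sizes≤ r)) (ℕ.≤-reflexive (ℕ.+-suc _ _))

  mutual
    -- The search enters all children, also those without `p`. Such subtrees come back unchanged at
    -- one step per node, so an insertion costs at most the size of the tree plus the two scans of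
    -- `extend`.
    insert-absent : ∀ {p} t → ¬ p ∈ᵗ t → Runs (insert k N (just p) t) (size t) F (_≡ t)
    insert-absent {p} (node C ts) p∉t with p ∈? C
    ... | yes p∈C = contradiction (root , p∈C) p∉t
    ... | no  _   = Runs-cost 1 (Runs-map (ℕ.≤-reflexive (ℕ.+-identityʳ _)) id
      (Runs-bind (insertAll-absent ts (λ p∈ts → p∉t (∈ᵗ-node⁺ (inj₂ p∈ts)))) λ { refl → Runs-return refl }))

    insertAll-absent : ∀ {p} ts → ¬ Any (p ∈ᵗ_) ts → Runs (insertAll k N (just p) ts) (sizes ts) F (_≡ ts)
    insertAll-absent []       _    = Runs-return refl
    insertAll-absent (t ∷ ts) p∉ts =
      Runs-bind (insert-absent t (p∉ts ∘ here)) λ { refl →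
      Runs-map (ℕ.≤-reflexive (ℕ.+-identityʳ _)) id
        (Runs-bind (insertAll-absent ts (p∉ts ∘ there)) λ { refl → Runs-return refl }) }

  module _ {p} (p∈N : p ∈ N) (p-max : ∀ {v} → v ∈ N → v ≢ p → v Fin.< p) where

    private
      N⊆ : ∀ {C} → p ∈ C → lower G p ⊆ C → N ⊆ C
      N⊆ p∈C p⊆C {v} v∈N with v Fin.≟ p
      ... | yes refl = p∈C
      ... | no v≢p   = p⊆C (∈-lower⁺ G p (peo k p∈N v∈N (v≢p ∘ sym)) (p-max v∈N v≢p))

    mutual
      insert-runs : ∀ {P} t → Coherent t → Filled G P t → ¬ k ∈ᵗ t → p ∈ᵗ t → p ∉ P →
                    Runs (insert k N (just p) t) (size t + (n + n)) F (Grown G k P t)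
      insert-runs {P} (node C ts) co@(node all pairs) fi@(node _ fill all′) k∉t p∈t p∉P with p ∈? C
      ... | yes p∈C = Runs-cost 1 (Runs-map (ℕ.m≤n+m _ (sizes ts)) id (extend-runs {P} {C} {ts} (N⊆ {C} p∈C (fill p∈C p∉P)) k∉t co fi))
      ... | no  p∉C = Runs-cost 1 (Runs-map (ℕ.≤-reflexive (ℕ.+-identityʳ _)) id
        (Runs-bind (insertAll-runs ts p∉C all pairs all′ (λ k∈ts → k∉t (∈ᵗ-node⁺ (inj₂ k∈ts)))
                     ([ (λ p∈C → contradiction p∈C p∉C) , id ]′ (∈ᵗ-node⁻ p∈t)))
          λ rep → Runs-return (grow-children k∉t co fi rep)))

      insertAll-runs : ∀ {C} ts → p ∉ C → All (Hangs C) ts →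
        AllPairs (λ t t′ → ∀ {v} → v ∈ᵗ t → v ∈ᵗ t′ → v ∈ C) ts → All (Filled G C) ts →
        ¬ Any (k ∈ᵗ_) ts → Any (p ∈ᵗ_) ts →
        Runs (insertAll k N (just p) ts) (sizes ts + (n + n)) F (Replaced (Grown G k C) ts)
      insertAll-runs (t ∷ ts) p∉C (h ∷ _) (m ∷ _) (fi ∷ _) k∉ (here p∈t) =
        Runs-map (ℕ.≤-reflexive arith) id
          (Runs-bind (insert-runs t (Hangs.coherent h) fi (k∉ ∘ here) p∈t p∉C) λ g →
           Runs-bind (insertAll-absent ts λ p∈ts → case find p∈ts of λ (_ , u∈ , p∈u) →
             p∉C (All.lookup m u∈ p∈t p∈u)) λ { refl → Runs-return (here g) })
        where
        open +-*-Solver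
        arith : size t + (n + n) + (sizes ts + 0) ≡ size t + sizes ts + (n + n)
        arith = solve 3 (λ a b m → a :+ (m :+ m) :+ (b :+ con 0) := a :+ b :+ (m :+ m)) refl (size t) (sizes ts) n
      insertAll-runs (t ∷ ts) p∉C (_ ∷ hs) (m ∷ ms) (_ ∷ fis) k∉ (there p∈ts) =
        Runs-map (ℕ.≤-reflexive (trans (cong (size t +_) (ℕ.+-identityʳ _)) (sym (ℕ.+-assoc (size t) _ _)))) id
          (Runs-bind (insert-absent t λ p∈t → case find p∈ts of λ (_ , u∈ , p∈u) →
             p∉C (All.lookup m u∈ p∈t p∈u)) λ { refl →
           Runs-bind (insertAll-runs ts p∉C hs ms fis (k∉ ∘ there) p∈ts) λ rep → Runs-return (there rep) })

module _ (G : Graph n) (simple : IsSimple G) (peo : ∀ k → IsClique G (lower G k)) where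

  -- The bound `suc m` on the size counts the initial root, labelled `⊥`, and at most one further
  -- node per inserted vertex.
  record Partial (m : ℕ) (t : Tree n) : Set where
    field
      coherent : Coherent t
      filled   : Filled G ⊥ t
      covers   : ∀ {v} → toℕ v < m → v ∈ᵗ t
      covers⁻  : ∀ {v} → v ∈ᵗ t → toℕ v < m
      size≤    : size t ≤ suc m

  Partial-suc : ∀ k {t t′} → Partial (toℕ k) t → Grown G k ⊥ t t′ → Partial (suc (toℕ k)) t′
  Partial-suc k {t} {t′} pa g = record
    { coherent = Grown.coherent g
    ; filled   = Grown.filled g
    ; covers   = covers′
    ; covers⁻  = λ v∈t′ → case Grown.∈ᵗ⁻ g v∈t′ of λ where
        (inj₁ v∈t)  → ℕ.m<n⇒m<1+n (Partial.covers⁻ pa v∈t)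
        (inj₂ refl) → ℕ.n<1+n _
    ; size≤    = ℕ.≤-trans (Grown.size≤ g) (s≤s (Partial.size≤ pa))
    }
    where
    covers′ : ∀ {v} → toℕ v < suc (toℕ k) → v ∈ᵗ t′
    covers′ {v} v≤k with v Fin.≟ k
    ... | yes refl = Grown.k∈t′ g
    ... | no v≢k   = Grown.∈ᵗ⁺ g (Partial.covers pa (ℕ.≤∧≢⇒< (ℕ.≤-pred v≤k) (v≢k ∘ Fin.toℕ-injective)))

  insert-Partial : ∀ {F : Set ℓᶠ} k {t} → Partial (toℕ k) t → ∀ {p} → IsGreatest (lower G k) p →
                   Runs (insert k (lower G k) p t) (n + (n + n)) F (Partial (suc (toℕ k)))
  insert-Partial k {t} pa greatest = Runs-map (ℕ.+-monoˡ-≤ (n + n) (ℕ.≤-trans (Partial.size≤ pa) (Fin.toℕ<n k)))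
    (Partial-suc k pa) (go t (Partial.coherent pa) (Partial.filled pa) (λ k∈t → ℕ.<-irrefl refl (Partial.covers⁻ pa k∈t))
      (Partial.covers pa) greatest)
    where
    open Insertion G simple peo k
    go : ∀ t → Coherent t → Filled G ⊥ t → ¬ k ∈ᵗ t → (∀ {v} → toℕ v < toℕ k → v ∈ᵗ t) →
         ∀ {p} → IsGreatest (lower G k) p →
         Runs (insert k (lower G k) p t) (size t + (n + n)) _ (Grown G k ⊥ t)
    go (node C ts) co fi k∉t covers (nothing N-empty) =
      Runs-cost 1 (Runs-map (ℕ.m≤n+m _ (sizes ts)) id (extend-runs {⊥} {C} {ts} (λ v∈N → contradiction v∈N N-empty) k∉t co fi))
    go t co fi k∉t covers (just p∈N p-max) =
      insert-runs p∈N p-max t co fi k∉t (covers (lower⇒< G k p∈N)) ∉⊥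

  build-runs : ∀ {F : Set ℓᶠ} → Runs (buildCliqueTree n G) (n * suc (n + (n + (n + (n + n))))) F (Partial n)
  build-runs = Runs-forEach-tabulate id Partial
    (λ k pa → Runs-cost n (Runs-cost n (insert-Partial k pa (last-greatest (lower G k)))))
    record { coherent = node [] []
           ; filled   = node (λ i∈ → contradiction i∈ ∉⊥) (λ v∈ → contradiction v∈ ∉⊥) []
           ; covers   = λ ()
           ; covers⁻  = λ v∈ → contradiction (leaf-∈ v∈) ∉⊥
           ; size≤    = ℕ.≤-refl
           }

  partial-tree : ∃[ t ] Partial n t
  partial-tree = map₂ proj₂ (Runs-result (build-runs {F = Empty.⊥}))

  -- The greatest vertex of a clique Q has the rest of Q among its lower
  -- neighbours.

  clique⊆node : ∀ {t} → Partial n t → ∀ Q → IsClique G Q → ∃[ c ] Q ⊆ label {t = t} c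
  clique⊆node {t} pa Q clique with last (elements Q) | last-greatest Q
  ... | nothing | nothing empty    = rootOf t , λ v∈Q → contradiction v∈Q empty
  ... | just p  | just p∈Q p-max
    with c , p∈c , fills ← Filled-home (Partial.filled pa) (Partial.covers pa (Fin.toℕ<n p)) ∉⊥ = c , Q⊆c
    where
    Q⊆c : Q ⊆ label c
    Q⊆c {v} v∈Q with v Fin.≟ p
    ... | yes refl = p∈c
    ... | no v≢p   = fills (∈-lower⁺ G p (clique p∈Q v∈Q (v≢p ∘ sym)) (p-max v∈Q v≢p))

  Partial⇒IsCliqueTree : ∀ {t} → Partial n t → IsCliqueTree G t
  Partial⇒IsCliqueTree {t} pa = record
    { maximal   = λ c → Filled-clique filled c , λ Q clique c⊆Q →
        let c′ , Q⊆c′ = clique⊆node pa Q clique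
            c≡c′ = coherent⇒antichain co c c′ (Q⊆c′ ∘ c⊆Q)
        in λ v∈Q → subst (λ c → _ ∈ label c) (sym c≡c′) (Q⊆c′ v∈Q)
    ; complete  = λ Q (clique , max) →
        let c , Q⊆c = clique⊆node pa Q clique
        in c , ⊆-antisym (max (label c) (Filled-clique filled c) Q⊆c) Q⊆c
    ; injective = λ c c′ eq → coherent⇒antichain co c c′ (⊆-reflexive eq)
    ; subtree   = coherent⇒subtree co
    }
    where
    co = Partial.coherent pa
    filled = Partial.filled pa

buildCliqueTree-correct : IsCliqueTreeRoutine buildCliqueTree
buildCliqueTree-correct = record
  { correct = λ n E simple → Runs-result (build (triangulate E) (triangulate-simple E simple) (lower-clique E))
  -- Each round takes one step for the loop, two scans, and an insertion of at most `n + (n + n)`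
  -- steps: `1 + 5n`, which is at most `6n` as soon as there is a vertex.
  ; fast    = 6 , λ n E simple → ℕ.≤-trans (time (build (triangulate E) (triangulate-simple E simple) (lower-clique E)))
      (bound n)
  }
  where
  open Runs
  build : ∀ {n} G → IsSimple G → (∀ k → IsClique G (lower G k)) →
          Runs (buildCliqueTree n G) (n * suc (n + (n + (n + (n + n))))) Empty.⊥ (IsCliqueTree G)
  build {n} G simple peo = Runs-map {p = buildCliqueTree n G} ℕ.≤-refl (Partial⇒IsCliqueTree G simple peo) (build-runs G simple peo {F = Empty.⊥})
  bound : ∀ n → n * suc (n + (n + (n + (n + n)))) ≤ 6 * (n * n)
  bound zero    = z≤n
  bound n@(suc _) = begin
    n * suc (n + (n + (n + (n + n)))) ≤⟨ ℕ.*-monoʳ-≤ n (ℕ.+-monoˡ-≤ (n + (n + (n + (n + n)))) (s≤s z≤n)) ⟩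
    n * (n + (n + (n + (n + (n + n))))) ≡⟨ solve 1 (λ n → n :* (n :+ (n :+ (n :+ (n :+ (n :+ n))))) := con 6 :* (n :* n)) refl n ⟩
    6 * (n * n) ∎
    where
    open ℕ.≤-Reasoning
    open +-*-Solver

-- Separation in clique trees

⊈⇒∃ : ∀ {S T : Subset n} → S ⊈ T → ∃[ x ] x ∈ S × x ∉ T
⊈⇒∃ {S = S} {T} S⊈T with nonempty? (S ─ T)
... | yes (x , x∈) = x , p─q⊆p S T x∈ , x∈p─q⇒x∉q S T x∈
... | no empty = ⊥-elim (S⊈T λ {x} x∈S → decidable-stable (x ∈? T) λ x∉T → empty (x , x∈p∧x∉q⇒x∈p─q x∈S x∉T))

∈⇒0<∣∣ : ∀ {S : Subset n} {x} → x ∈ S → 0 < ∣ S ∣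
∈⇒0<∣∣ {S = S} {x} x∈S = subst (_≤ ∣ S ∣) (∣⁅x⁆∣≡1 x)
  (p⊆q⇒∣p∣≤∣q∣ λ y∈ → subst (_∈ S) (sym (x∈⁅y⁆⇒x≡y x y∈)) x∈S)

-- The subtree t hangs below a node labelled P, and U is the set of the
-- vertices visited before t.

record Region {n} (G : Graph n) (P U : Subset n) (t : Tree n) : Set where
  field
    coherent : Coherent t
    cliques  : ∀ (c : Node t) → IsClique G (label c)
    meets    : ∀ {v} → v ∈ᵗ t → v ∈ P → v ∈ top-label t
    seen     : ∀ {v} → v ∈ᵗ t → v ∈ U → v ∈ P
    edges    : ∀ {x y} → Adjacent G x y → x ∈ᵗ t → x ∉ P → ∃[ c ] x ∈ label {t = t} c × y ∈ label c

Meet : Subset n → Rel (Tree n) 0ℓ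
Meet C t t′ = ∀ {v} → v ∈ᵗ t → v ∈ᵗ t′ → v ∈ C

module _ {G : Graph n} {P U : Subset n} where

  -- For the field `edges`: the node that covers an edge at `x` lies below the same child as `x`,
  -- since different children share only members of `C` and `x ∉ C`.
  Region-children : ∀ {C ts} → Region G P U (node C ts) →
                    All (λ t → Hangs C t × Region G C (U ∪ C) t) ts × AllPairs (Meet C) ts
  Region-children {C} {ts} reg with Region.coherent reg
  ... | node all pairs = All.tabulate (λ p → All.lookup all p , record
    { coherent = Hangs.coherent (All.lookup all p)
    ; cliques  = λ c → Region.cliques reg (child p c)
    ; meets    = Hangs.meets (All.lookup all p)
    ; seen     = λ v∈t v∈U∪C → case x∈p∪q⁻ U C v∈U∪C of λ where
        (inj₁ v∈U) → let v∈ = ∈-child p v∈t in Region.meets reg v∈ (Region.seen reg v∈ v∈U)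
        (inj₂ v∈C) → v∈C
    ; edges    = λ x~y x∈t x∉C → let x∈ = ∈-child p x∈t in
        inside p x∈t x∉C (Region.edges reg x~y x∈ (λ x∈P → x∉C (Region.meets reg x∈ x∈P)))
    }) , pairs
    where
    inside : ∀ {x y t} (p : t List.∈ ts) → x ∈ᵗ t → x ∉ C →
             ∃[ c ] x ∈ label {t = node C ts} c × y ∈ label c → ∃[ c ] x ∈ label {t = t} c × y ∈ label c
    inside p x∈t x∉C (root , x∈C , _) = contradiction x∈C x∉C
    inside p x∈t x∉C (child q c , x∈c , y∈c) with position p q
    ... | same     = c , x∈c , y∈c
    ... | before l = contradiction (siblings-meet all pairs (inj₁ l) x∈t (c , x∈c)) x∉C
    ... | after l  = contradiction (siblings-meet all pairs (inj₂ l) x∈t (c , x∈c)) x∉C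

  -- Applied after a sibling `t` of `u` has been traversed: the vertices visited meanwhile belong to
  -- `t`, and those that recur in `u` lie in `P`.
  Region-grow : ∀ {U′ t u} → Meet P t u → (∀ {v} → v ∈ U′ → v ∈ U ⊎ v ∈ᵗ t) → Region G P U u → Region G P U′ u
  Region-grow meet U′⊆ reg = record
    { coherent = Region.coherent reg
    ; cliques  = Region.cliques reg
    ; meets    = Region.meets reg
    ; seen     = λ v∈u v∈U′ → [ Region.seen reg v∈u , (λ v∈t → meet v∈t v∈u) ]′ (U′⊆ v∈U′)
    ; edges    = Region.edges reg
    }

  module _ {t} (reg : Region G P U t) where

    Inner : Fin n → Set
    Inner v = v ∈ᵗ t × v ∉ P

    -- The separation property of the tree. An edge from an inner vertex is covered by a node of
    -- `t`, and if its other end belongs to `P`, then `meets` lifts that end to the top label.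
    Inner-step : ∀ {x y} → Adjacent G x y → Inner x → Inner y ⊎ y ∈ top-label t ∩ P
    Inner-step {x} {y} x~y (x∈t , x∉P) with c , _ , y∈c ← Region.edges reg x~y x∈t x∉P | y ∈? P
    ... | yes y∈P = inj₂ (x∈p∩q⁺ (Region.meets reg (c , y∈c) y∈P , y∈P))
    ... | no  y∉P = inj₁ ((c , y∈c) , y∉P)

    -- The separated pair is some `a` in the top label only and some `b` in `P` only. Each `x` in
    -- the intersection is adjacent to both, as the two labels are cliques, so a proper subset that
    -- omits `x` leaves the path from `a` through `x` to `b`.
    minimal-separator : IsClique G P → top-label t ⊈ P → P ⊈ top-label t → IsMinimalSeparator G (top-label t ∩ P)
    minimal-separator clique C⊈P P⊈C
      with a , a∈C , a∉P ← ⊈⇒∃ C⊈P | b , b∈P , b∉C ← ⊈⇒∃ P⊈C =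
      a , b , (a∉P ∘ proj₂ ∘ x∈p∩q⁻ C P , b∉C ∘ proj₁ ∘ x∈p∩q⁻ C P , λ w → proj₂ (walk w (∈-top a∈C , a∉P)) b∈P) ,
      λ S′ (S′⊆S , x , x∈S , x∉S′) (a∉S′ , b∉S′ , ¬path) → let x∈C , x∈P = x∈p∩q⁻ C P x∈S in
        ¬path ((a∉S′ , x∉S′ , C-clique a∈C x∈C λ { refl → a∉P x∈P }) ◅
               (x∉S′ , b∉S′ , clique x∈P b∈P λ { refl → b∉C x∈C }) ◅ ε)
      where
      C = top-label t
      C-clique : IsClique G C
      C-clique = subst (IsClique G) (label-root t) (Region.cliques reg (rootOf t))
      walk : ∀ {x y} → PathWithin G (_∉ C ∩ P) x y → Inner x → Inner y
      walk ε inner = inner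
      walk ((_ , y∉S , x~y) ◅ w) inner with Inner-step x~y inner
      ... | inj₁ inner′ = walk w inner′
      ... | inj₂ y∈S    = contradiction y∈S y∉S

link-separator : ∀ {G : Graph n} {P U t} → Region G P U t → {c c′ : Node t} → Link c c′ →
                 IsMinimalSeparator G (label c′ ∩ label c)
link-separator {t = node C ts} reg (top p) with h , reg′ ← All.lookup (proj₁ (Region-children reg)) p =
  minimal-separator reg′ (Region.cliques reg root) (new h) (old h)
link-separator {t = node C ts} reg (under p l) = link-separator (proj₂ (All.lookup (proj₁ (Region-children reg)) p)) l

module _ {n} {G : Graph n} (simple : IsSimple G) (peo : ∀ k → IsClique G (lower G k))
         {t} (tree : IsCliqueTree G t) where

  open IsCliqueTree tree

  -- A maximal clique around `Q` is read off the constructed tree, and `complete` finds it again in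
  -- the given one.
  clique⊆label : ∀ Q → IsClique G Q → ∃[ c ] Q ⊆ label {t = t} c
  clique⊆label Q clique =
    let _ , pa    = partial-tree G simple peo
        c , Q⊆c   = clique⊆node G simple peo pa Q clique
        c′ , c′≡c = complete (label c) (IsCliqueTree.maximal (Partial⇒IsCliqueTree G simple peo pa) c)
    in c′ , λ v∈Q → subst (_ ∈_) (sym c′≡c) (Q⊆c v∈Q)

  edge∈label : ∀ {x y} → Adjacent G x y ⊎ x ≡ y → ∃[ c ] x ∈ label {t = t} c × y ∈ label c
  edge∈label {x} {y} x~y =
    let c , ⊆c = clique⊆label (⁅ x ⁆ ∪ ⁅ y ⁆) clique
    in c , ⊆c (p⊆p∪q ⁅ y ⁆ (x∈⁅x⁆ x)) , ⊆c (q⊆p∪q ⁅ x ⁆ ⁅ y ⁆ (x∈⁅x⁆ y))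
    where
    adjacent : x ≢ y → Adjacent G x y
    adjacent x≢y = [ id , (λ x≡y → contradiction x≡y x≢y) ]′ x~y
    clique : IsClique G (⁅ x ⁆ ∪ ⁅ y ⁆)
    clique i∈ j∈ i≢j with ∪⁅⁆⁻ ⁅ x ⁆ i∈ | ∪⁅⁆⁻ ⁅ x ⁆ j∈
    ... | inj₁ i∈x  | inj₁ j∈x  = contradiction (trans (x∈⁅y⁆⇒x≡y x i∈x) (sym (x∈⁅y⁆⇒x≡y x j∈x))) i≢j
    ... | inj₁ i∈x  | inj₂ refl rewrite x∈⁅y⁆⇒x≡y x i∈x = adjacent i≢j
    ... | inj₂ refl | inj₁ j∈x  rewrite x∈⁅y⁆⇒x≡y x j∈x = IsSimple.symmetric simple (adjacent (i≢j ∘ sym))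
    ... | inj₂ refl | inj₂ refl = contradiction refl i≢j

  ∈-tree : ∀ v → v ∈ᵗ t
  ∈-tree v = let c , v∈c , _ = edge∈label {v} (inj₂ refl) in c , v∈c

  Region-root : Region G ⊥ ⊥ t
  Region-root = record
    { coherent = coherent⁺ t subtree λ c c′ c⊆c′ →
        injective c c′ (⊆-antisym c⊆c′ (proj₂ (maximal c) (label c′) (proj₁ (maximal c′)) c⊆c′))
    ; cliques  = proj₁ ∘ maximal
    ; meets    = λ _ v∈⊥ → contradiction v∈⊥ ∉⊥
    ; seen     = λ _ → id
    ; edges    = λ x~y _ _ → edge∈label (inj₁ x~y)
    }

  link≤ : ∀ {s} → IsLargestMinimalSeparatorSize G s → {c c′ : Node t} → Link c c′ → ∣ label c′ ∩ label c ∣ ≤ s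
  link≤ (inj₁ (_ , max)) l = max _ (_ , link-separator Region-root l , refl)
  link≤ (inj₂ (none , _)) l = contradiction (_ , link-separator Region-root l , refl) (none _)

-- Connectedness enters here: removing no vertex separates nothing.
separator-nonempty : ∀ {E : Graph n} → (∀ i j → Star (Adjacent E) i j) → ∀ {S} → IsMinimalSeparator E S → 0 < ∣ S ∣
separator-nonempty connected {S} (u , v , (_ , _ , ¬path) , _) = ℕ.n≢0⇒n>0 λ ∣S∣≡0 →
  let empty : ∀ {x} → x ∉ S
      empty x∈S = ℕ.<-irrefl (sym ∣S∣≡0) (∈⇒0<∣∣ x∈S)
  in ¬path (Star.map (λ x~y → empty , empty , x~y) (connected u v))

-- If the clique tree is a single node, its clique contains all vertices; otherwise the link to the
-- first child already yields a nonempty separator.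
complete⊎separated : ∀ {G : Graph n} → IsSimple G → (∀ k → IsClique G (lower G k)) →
  (∀ i j → Star (Adjacent G) i j) → ∀ {t} → IsCliqueTree G t → ∀ {s} → IsLargestMinimalSeparatorSize G s →
  (∀ i j → i ≢ j → Adjacent G i j) ⊎ 0 < s
complete⊎separated simple peo connected {node C []} tree _ = inj₁ λ i j →
  IsCliqueTree.maximal tree root .proj₁ (leaf-∈ (∈-tree simple peo tree i)) (leaf-∈ (∈-tree simple peo tree j))
complete⊎separated {G = G} simple peo connected {node C (node D ts ∷ us)} tree largest = inj₂
  (ℕ.≤-trans (separator-nonempty {E = G} connected (link-separator (Region-root simple peo tree) link)) (link≤ simple peo tree largest link))
  where
  link : Link {t = node C (node D ts ∷ us)} root (child (here refl) root)
  link = top (here refl)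

-- Extended weights and paths

module Weights {a ℓ₁ ℓ₂} (R : OrderedAbelianGroup a ℓ₁ ℓ₂) where

  open OrderedAbelianGroup R public
    renaming (_≤_ to _≤ᴿ_; _<_ to _<ᴿ_; _≤?_ to _≤ᴿ?_; _≟_ to _≈?_; _<?_ to _<ᴿ?_)
  open APSP R public
  open AbelianGroup abelianGroup public using ()
    renaming (refl to ≈-refl; sym to ≈-sym; trans to ≈-trans; assoc to ⊕-assoc; comm to ⊕-comm;
              identityˡ to ⊕-identityˡ; identityʳ to ⊕-identityʳ; ∙-cong to ⊕-cong; ∙-congˡ to ⊕-congˡ; ∙-congʳ to ⊕-congʳ)
  open IsDecTotalOrder isDecTotalOrder public using ()
    renaming (refl to ≤ᴿ-refl; reflexive to ≤ᴿ-reflexive; trans to ≤ᴿ-trans; antisym to ≤ᴿ-antisym; total to ≤ᴿ-total)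

  infix 4 _≤∞_

  _≤∞_ : Rel R∞ (a ⊔ ℓ₂)
  _≤∞_ = Supremum._≤⁺_ _≤ᴿ_

  pattern ⟦_⟧ x≤y = Supremum.[ x≤y ]

  ⊕-mono : ∀ {x x′ y y′} → x ≤ᴿ x′ → y ≤ᴿ y′ → x ⊕ y ≤ᴿ x′ ⊕ y′
  ⊕-mono {x} {x′} {y} {y′} x≤x′ y≤y′ = ≤ᴿ-trans (⊕-monoˡ-≤ y x≤x′)
    (≤ᴿ-trans (≤ᴿ-reflexive (⊕-comm x′ y)) (≤ᴿ-trans (⊕-monoˡ-≤ x′ y≤y′) (≤ᴿ-reflexive (⊕-comm y′ x′))))

  ≮0⇒≥0 : ∀ {x} → ¬ x <ᴿ 0# → 0# ≤ᴿ x
  ≮0⇒≥0 {x} x≮0 with ≤ᴿ-total 0# x | x ≈? 0#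
  ... | inj₁ 0≤x | _       = 0≤x
  ... | inj₂ x≤0 | yes x≈0 = ≤ᴿ-reflexive (≈-sym x≈0)
  ... | inj₂ x≤0 | no x≉0  = contradiction (x≤0 , x≉0) x≮0

  ≥0⇒≮0 : ∀ {x} → 0# ≤ᴿ x → ¬ x <ᴿ 0#
  ≥0⇒≮0 0≤x (x≤0 , x≉0) = x≉0 (≤ᴿ-antisym x≤0 0≤x)

  ≤∞-refl : Reflexive _≤∞_
  ≤∞-refl {[ x ]} = ⟦ ≤ᴿ-refl ⟧
  ≤∞-refl {⊤⁺}    = ⊤⁺ Supremum.≤⊤⁺

  ≤∞-reflexive : ∀ {x y} → x ≡ y → x ≤∞ y
  ≤∞-reflexive refl = ≤∞-refl

  ≤∞-trans : Transitive _≤∞_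
  ≤∞-trans = Supremum.≤⁺-trans _≤ᴿ_ ≤ᴿ-trans

  ⊕∞-⊤⁺ : ∀ x → x ⊕∞ ⊤⁺ ≡ ⊤⁺
  ⊕∞-⊤⁺ [ _ ] = refl
  ⊕∞-⊤⁺ ⊤⁺    = refl

  ⊕∞-mono : ∀ {x x′ y y′} → x ≤∞ x′ → y ≤∞ y′ → x ⊕∞ y ≤∞ x′ ⊕∞ y′
  ⊕∞-mono                  ⟦ x≤x′ ⟧            ⟦ y≤y′ ⟧            = ⟦ ⊕-mono x≤x′ y≤y′ ⟧
  ⊕∞-mono                  (_ Supremum.≤⊤⁺)    _                   = _ Supremum.≤⊤⁺
  ⊕∞-mono {x′ = x′} {y = y} _                  (_ Supremum.≤⊤⁺) rewrite ⊕∞-⊤⁺ x′ = _ Supremum.≤⊤⁺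

  ⊓∞≤ˡ : ∀ x y → x ⊓∞ y ≤∞ x
  ⊓∞≤ˡ x y with x ≤∞? y
  ... | yes x≤y = ≤∞-refl
  ... | no  x≰y = [ (λ x≤y → contradiction x≤y x≰y) , id ]′ (Supremum.≤⁺-total _≤ᴿ_ ≤ᴿ-total x y)

  ⊓∞≤ʳ : ∀ x y → x ⊓∞ y ≤∞ y
  ⊓∞≤ʳ x y with x ≤∞? y
  ... | yes x≤y = x≤y
  ... | no  x≰y = ≤∞-refl

  ⊓∞-sel : ∀ x y → x ⊓∞ y ≡ x ⊎ x ⊓∞ y ≡ y
  ⊓∞-sel x y with x ≤∞? y
  ... | yes x≤y = inj₁ refl
  ... | no  x≰y = inj₂ refl

  ⊕∞-finite : ∀ {x y z} → x ⊕∞ y ≡ [ z ] → ∃[ x′ ] ∃[ y′ ] x ≡ [ x′ ] × y ≡ [ y′ ] × z ≡ x′ ⊕ y′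
  ⊕∞-finite {[ x ]} {[ y ]} refl = x , y , refl , refl , refl

  ≤∞[] : ∀ {x y} → x ≤∞ [ y ] → ∃[ z ] x ≡ [ z ] × z ≤ᴿ y
  ≤∞[] ⟦ z≤y ⟧ = _ , refl , z≤y

  negative?-false : ∀ x → negative? x ≡ false → [ 0# ] ≤∞ x
  negative?-false [ x ] eq = ⟦ ≮0⇒≥0 (does⇒¬ (x <ᴿ? 0#) eq) ⟧
  negative?-false ⊤⁺ _ = _ Supremum.≤⊤⁺

  negative?-true : ∀ x → negative? x ≡ true → ∃[ y ] x ≡ [ y ] × y <ᴿ 0#
  negative?-true [ x ] eq = x , refl , does⇒ (x <ᴿ? 0#) eq

  module _ {G : Digraph n} where

    infixr 5 _◅◅ₚ_

    -- The length of the composite is existential because concatenation reassociates the sum, and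
    -- the group laws hold only up to `_≈_`.
    _◅◅ₚ_ : ∀ {i j k x y} → Path G i j x → Path G j k y → ∃[ z ] Path G i k z × z ≈ x ⊕ y
    [] ◅◅ₚ q = _ , q , ≈-sym (⊕-identityˡ _)
    (arc ∷ p) ◅◅ₚ q = let _ , r , z≈ = p ◅◅ₚ q in
      _ , arc ∷ r , ≈-trans (⊕-congˡ z≈) (≈-sym (⊕-assoc _ _ _))

    HasNegativeCycle⇐ : ∀ {i x y} → Path G i i x → x ≈ y → y <ᴿ 0# → HasNegativeCycle G
    HasNegativeCycle⇐ p x≈y (y≤0 , y≉0) = _ , _ , p , ≤ᴿ-trans (≤ᴿ-reflexive x≈y) y≤0 , y≉0 ∘ ≈-trans (≈-sym x≈y)

    noNegativeCycle⇒noNegative2Cycle : ¬ HasNegativeCycle G → NoNegative2Cycle G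
    noNegativeCycle⇒noNegative2Cycle none i j x y i→j j→i = ≮0⇒≥0 λ x⊕y<0 →
      none (HasNegativeCycle⇐ (i→j ∷ j→i ∷ []) (⊕-congˡ (⊕-identityʳ y)) x⊕y<0)

    arc⇒≢ : ∀ {i j x} → arc G i j ≡ [ x ] → i ≢ j
    arc⇒≢ {i} i→i refl with () ← trans (sym i→i) (loopless G i)

    arc⇒adjacent : ∀ {i j x} → arc G i j ≡ [ x ] → Adjacent (underlying G) i j
    arc⇒adjacent {i} {j} i→j = lookup⇒∈ (trans (lookup₂-tabulate (λ i j → is-just (arc G i j) ∨ is-just (arc G j i)) i j)
      (cong (λ w → is-just w ∨ is-just (arc G j i)) i→j))

    adjacent⇒arc : ∀ {i j} → Adjacent (underlying G) i j → is-just (arc G i j) ≡ true ⊎ is-just (arc G j i) ≡ true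
    adjacent⇒arc {i} {j} i~j with is-just (arc G i j)
      | trans (sym (lookup₂-tabulate (λ i j → is-just (arc G i j) ∨ is-just (arc G j i)) i j)) (∈⇒lookup i~j)
    ... | true  | _  = inj₁ refl
    ... | false | eq = inj₂ eq

    underlying-simple : IsSimple (underlying G)
    underlying-simple = record
      { symmetric = λ {i} {j} i~j → lookup⇒∈ (begin
          underlying G ⟨ j , i ⟩                       ≡⟨ lookup₂-tabulate (λ i j → is-just (arc G i j) ∨ is-just (arc G j i)) j i ⟩
          is-just (arc G j i) ∨ is-just (arc G i j)    ≡⟨ Bool.∨-comm (is-just (arc G j i)) _ ⟩
          is-just (arc G i j) ∨ is-just (arc G j i)    ≡⟨ lookup₂-tabulate (λ i j → is-just (arc G i j) ∨ is-just (arc G j i)) i j ⟨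
          underlying G ⟨ i , j ⟩                       ≡⟨ ∈⇒lookup i~j ⟩
          true                                         ∎)
      ; irreflexive = λ {i} i~i → no-loop i (adjacent⇒arc i~i)
      }
      where
      open ≡-Reasoning
      no-loop : ∀ i → ¬ (is-just (arc G i i) ≡ true ⊎ is-just (arc G i i) ≡ true)
      no-loop i p rewrite loopless G i = case p of λ { (inj₁ ()) ; (inj₂ ()) }

  -- If W satisfies the triangle inequality at every greater vertex, all
  -- walks can be shortened to walks built outwards, each step of which
  -- reaches a vertex greater than both previous ends.

  module Rolling {n} (W : Fin n → Fin n → R∞) (W-refl : ∀ i → W i i ≡ [ 0# ])
    (W-△ : ∀ {i j k} → i Fin.< k → j Fin.< k → W i j ≤∞ W i k ⊕∞ W k j) where

    data Walk : Fin n → Fin n → Carrier → Set a where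
      []   : ∀ {i} → Walk i i 0#
      up   : ∀ {i j k x y} → Walk i j x → W j k ≡ [ y ] → i Fin.< k → j Fin.< k → Walk i k (x ⊕ y)
      down : ∀ {i j k x y} → W k j ≡ [ y ] → Walk j i x → j Fin.< k → i Fin.< k → Walk k i (y ⊕ x)

    closed⇒0 : ∀ {i x} → Walk i i x → x ≡ 0#
    closed⇒0 []                 = refl
    closed⇒0 (up _ _ i<i _)     = contradiction i<i (ℕ.<-irrefl refl)
    closed⇒0 (down _ _ _ i<i)   = contradiction i<i (ℕ.<-irrefl refl)

    Shorter : Fin n → Fin n → Carrier → Set (a ⊔ ℓ₂)
    Shorter i j x = ∃[ z ] Walk i j z × z ≤ᴿ x

    shorter-≤ : ∀ {i j x y} → x ≤ᴿ y → Shorter i j x → Shorter i j y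
    shorter-≤ x≤y (z , w , z≤x) = z , w , ≤ᴿ-trans z≤x x≤y

    step-walk : ∀ {i j y} → W i j ≤∞ [ y ] → Shorter i j y
    step-walk {i} {j} W≤y with z , i→j , z≤y ← ≤∞[] W≤y | Fin.<-cmp i j
    ... | tri< i<j _ _ = _ , up [] i→j i<j i<j , ≤ᴿ-trans (≤ᴿ-reflexive (⊕-identityˡ z)) z≤y
    ... | tri> _ _ j<i = _ , down i→j [] j<i j<i , ≤ᴿ-trans (≤ᴿ-reflexive (⊕-identityʳ z)) z≤y
    ... | tri≈ _ refl _ with refl ← trans (sym i→j) (W-refl i) = 0# , [] , z≤y

    private
      △ : ∀ {i j k x y} → W i k ≡ [ x ] → W k j ≡ [ y ] → i Fin.< k → j Fin.< k → W i j ≤∞ [ x ⊕ y ]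
      △ eq eq′ i<k j<k = ≤∞-trans (W-△ i<k j<k) (≤∞-reflexive (cong₂ _⊕∞_ eq eq′))

      extend-up : ∀ {i j k x y} → Shorter i j x → W j k ≡ [ y ] → i Fin.< k → j Fin.< k → Shorter i k (x ⊕ y)
      extend-up (z , w , z≤x) j→k i<k j<k = _ , up w j→k i<k j<k , ⊕-mono z≤x ≤ᴿ-refl

      extend-down : ∀ {i j k x y} → W k j ≡ [ y ] → Shorter j i x → j Fin.< k → i Fin.< k → Shorter k i (y ⊕ x)
      extend-down k→j (z , w , z≤x) j<k i<k = _ , down k→j w j<k i<k , ⊕-mono ≤ᴿ-refl z≤x

      interchange : ∀ x u v y → (x ⊕ (u ⊕ v)) ⊕ y ≈ (x ⊕ u) ⊕ (v ⊕ y)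
      interchange x u v y = ≈-trans (⊕-congʳ (≈-sym (⊕-assoc x u v))) (⊕-assoc (x ⊕ u) v y)

      rotate : ∀ u x y v → (v ⊕ u) ⊕ (x ⊕ y) ≈ (u ⊕ x) ⊕ (y ⊕ v)
      rotate u x y v = ≈-trans (⊕-assoc v u (x ⊕ y)) (≈-trans (⊕-comm v _)
        (≈-trans (⊕-congʳ (≈-sym (⊕-assoc u x y))) (⊕-assoc (u ⊕ x) y v)))

      smaller : ∀ {i k : Fin n} {m} → i Fin.< k → toℕ k < suc m → toℕ i < m
      smaller i<k k≤m = ℕ.<-≤-trans i<k (ℕ.≤-pred k≤m)

      -- The bound m on the three vertices decreases in each recursive call.

      join : ∀ m {i l j x y} → toℕ i < m → toℕ l < m → toℕ j < m →
             Walk i l x → Walk l j y → Shorter i j (x ⊕ y)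
      join m _ _ _ [] q = _ , q , ≤ᴿ-reflexive (≈-sym (⊕-identityˡ _))
      join m _ _ _ p [] = _ , p , ≤ᴿ-reflexive (≈-sym (⊕-identityʳ _))
      -- The middle vertex `l` is the greatest. The triangle inequality replaces its two arcs by one
      -- step that avoids `l`, and the pieces are joined below it.
      join (suc m) _ l<m _ (up {x = x} p e i<l j<l) (down {x = y} f q k<l h<l) =
        let _ , r , r≤ = step-walk (△ e f j<l k<l)
            _ , s , s≤ = join m (smaller i<l l<m) (smaller j<l l<m) (smaller k<l l<m) p r
        in shorter-≤ (≤ᴿ-trans (⊕-mono (≤ᴿ-trans s≤ (⊕-mono ≤ᴿ-refl r≤)) ≤ᴿ-refl) (≤ᴿ-reflexive (interchange x _ _ y)))
             (join m (smaller i<l l<m) (smaller k<l l<m) (smaller h<l l<m) s q)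
      join (suc m) _ _ j<m p@(up _ _ i<l _) (up q f l<j k<j) =
        shorter-≤ (≤ᴿ-reflexive (⊕-assoc _ _ _))
          (extend-up (join m (smaller (ℕ.<-trans i<l l<j) j<m) (smaller l<j j<m) (smaller k<j j<m) p q) f (ℕ.<-trans i<l l<j) k<j)
      join (suc m) i<m _ _ (down e p k<i l<i) q@(down _ _ _ j<l) =
        shorter-≤ (≤ᴿ-reflexive (≈-sym (⊕-assoc _ _ _)))
          (extend-down e (join m (smaller k<i i<m) (smaller l<i i<m) (smaller (ℕ.<-trans j<l l<i) i<m) p q) k<i (ℕ.<-trans j<l l<i))
      -- Both walks start low and end high. The outer arc at the greater end is kept as the last
      -- step outwards, and the rest is joined below that end.
      join (suc m) {i} {l} {j} i<m _ j<m p@(down {x = x} e p′ h<i l<i) q@(up {x = y} q′ f l<j k<j) with Fin.<-cmp i j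
      ... | tri< i<j _ _ = shorter-≤ (≤ᴿ-reflexive (⊕-assoc _ _ _))
        (extend-up (join m (smaller i<j j<m) (smaller l<j j<m) (smaller k<j j<m) p q′) f i<j k<j)
      ... | tri> _ _ j<i = shorter-≤ (≤ᴿ-reflexive (≈-sym (⊕-assoc _ _ _)))
        (extend-down e (join m (smaller h<i i<m) (smaller l<i i<m) (smaller j<i i<m) p′ q) h<i j<i)
      -- The walks form a cycle whose greatest vertex is `i`. It is cut at `i`: the arcs from `k` to
      -- `i` and from `i` to `h` become one step, which together with the joined inner walks closes
      -- up at `k`. A closed walk has length `0#`, so the cycle was not negative and the empty walk
      -- is short enough.
      ... | tri≈ _ refl _ =
        let _ , r , r≤ = step-walk (△ f e k<j h<i)
            _ , s , s≤ = join m (smaller h<i i<m) (smaller l<i i<m) (smaller k<j j<m) p′ q′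
            _ , c , c≤ = join m (smaller k<j j<m) (smaller h<i i<m) (smaller k<j j<m) r s
        in 0# , [] , ≤ᴿ-trans (≤ᴿ-reflexive (≈-sym (AbelianGroup.reflexive abelianGroup (closed⇒0 c))))
             (≤ᴿ-trans c≤ (≤ᴿ-trans (⊕-mono r≤ s≤) (≤ᴿ-reflexive (rotate _ x y _))))

    path⇒walk : {G : Digraph n} → (∀ {i j x} → arc G i j ≡ [ x ] → W i j ≤∞ [ x ]) →
                ∀ {i j x} → Path G i j x → Shorter i j x
    path⇒walk W≤ [] = 0# , [] , ≤ᴿ-refl
    path⇒walk W≤ (i→j ∷ p) =
      let _ , s , s≤ = step-walk (W≤ i→j)
          _ , w , w≤ = path⇒walk W≤ p
      in shorter-≤ (⊕-mono s≤ w≤) (join n (Fin.toℕ<n _) (Fin.toℕ<n _) (Fin.toℕ<n _) s w)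

-- DPC and P³C

module Consistency {a ℓ₁ ℓ₂} (R : OrderedAbelianGroup a ℓ₁ ℓ₂) where

  open Weights R

  infix 4 _≼_

  _≼_ : Rel (Matrix R∞ n) (a ⊔ ℓ₂)
  M ≼ M′ = ∀ i j → M ⟨ i , j ⟩ ≤∞ M′ ⟨ i , j ⟩

  relaxed : Matrix R∞ n → Fin n → Fin n → Fin n → Matrix R∞ n
  relaxed M i j k = M [ i , k ]≔ (M ⟨ i , k ⟩ ⊓∞ (M ⟨ i , j ⟩ ⊕∞ M ⟨ j , k ⟩))

  module _ (M : Matrix R∞ n) where

    ≔-cases : ∀ i j {x} k l → (k ≡ i × l ≡ j × (M [ i , j ]≔ x) ⟨ k , l ⟩ ≡ x) ⊎ (M [ i , j ]≔ x) ⟨ k , l ⟩ ≡ M ⟨ k , l ⟩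
    ≔-cases i j k l with k Fin.≟ i | l Fin.≟ j
    ... | yes refl | yes refl = inj₁ (refl , refl , lookup-≔-same M i j)
    ... | yes _    | no l≢j   = inj₂ (lookup-≔-other M i j (inj₂ l≢j))
    ... | no k≢i   | _        = inj₂ (lookup-≔-other M i j (inj₁ k≢i))

    relaxed-≼ : ∀ i j k → relaxed M i j k ≼ M
    relaxed-≼ i j k p q with ≔-cases i k {M ⟨ i , k ⟩ ⊓∞ (M ⟨ i , j ⟩ ⊕∞ M ⟨ j , k ⟩)} p q
    ... | inj₁ (refl , refl , eq) = ≤∞-trans (≤∞-reflexive eq) (⊓∞≤ˡ (M ⟨ i , k ⟩) (M ⟨ i , j ⟩ ⊕∞ M ⟨ j , k ⟩))
    ... | inj₂ eq                 = ≤∞-reflexive eq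

    relaxed-at : ∀ i j k → relaxed M i j k ⟨ i , k ⟩ ≤∞ M ⟨ i , j ⟩ ⊕∞ M ⟨ j , k ⟩
    relaxed-at i j k = ≤∞-trans (≤∞-reflexive (lookup-≔-same M i k)) (⊓∞≤ʳ (M ⟨ i , k ⟩) (M ⟨ i , j ⟩ ⊕∞ M ⟨ j , k ⟩))

    relaxed-other : ∀ i j k {p q} → p ≢ i ⊎ q ≢ k → relaxed M i j k ⟨ p , q ⟩ ≡ M ⟨ p , q ⟩
    relaxed-other i j k = lookup-≔-other M i k

  Sound : Digraph n → Matrix R∞ n → Set (a ⊔ ℓ₁)
  Sound G M = ∀ i j {x} → M ⟨ i , j ⟩ ≡ [ x ] → ∃[ y ] Path G i j y × y ≈ x

  -- DPC misses some negative 2-cycles of the input; without them the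
  -- entry bounds every path from below.

  Tight : Digraph n → Matrix R∞ n → Fin n → Fin n → Set (a ⊔ ℓ₂)
  Tight G M i j = NoNegative2Cycle G → ∀ {x} → Path G i j x → M ⟨ i , j ⟩ ≤∞ [ x ]

  Tight-≼ : {G : Digraph n} {M M′ : Matrix R∞ n} → M′ ≼ M → ∀ {i j} → Tight G M i j → Tight G M′ i j
  Tight-≼ M′≼M tight no2 p = ≤∞-trans (M′≼M _ _) (tight no2 p)

  module _ {G : Digraph n} {M : Matrix R∞ n} (sound : Sound G M) where

    Sound-via : ∀ {i j k x} → M ⟨ i , j ⟩ ⊕∞ M ⟨ j , k ⟩ ≡ [ x ] → ∃[ y ] Path G i k y × y ≈ x
    Sound-via eq =
      let _ , _ , ij , jk , x≡ = ⊕∞-finite eq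
          _ , p , p≈ = sound _ _ ij
          _ , q , q≈ = sound _ _ jk
          _ , r , r≈ = p ◅◅ₚ q
      in _ , r , ≈-trans r≈ (≈-trans (⊕-cong p≈ q≈) (AbelianGroup.reflexive abelianGroup (sym x≡)))

    relaxed-sound : ∀ i j k → Sound G (relaxed M i j k)
    relaxed-sound i j k p q eq with ≔-cases M i k {M ⟨ i , k ⟩ ⊓∞ (M ⟨ i , j ⟩ ⊕∞ M ⟨ j , k ⟩)} p q
    ... | inj₂ unchanged = sound p q (trans (sym unchanged) eq)
    ... | inj₁ (refl , refl , new) with ⊓∞-sel (M ⟨ i , k ⟩) (M ⟨ i , j ⟩ ⊕∞ M ⟨ j , k ⟩)
    ...   | inj₁ left  = sound p q (trans (sym (trans new left)) eq)
    ...   | inj₂ right = Sound-via (trans (sym (trans new right)) eq)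

  Adjacent-≔ : (E : Graph n) → ∀ i j {k l} → Adjacent E k l → Adjacent (E [ i , j ]≔ true) k l
  Adjacent-≔ E i j {k} {l} k~l with k Fin.≟ i | l Fin.≟ j
  ... | yes refl | yes refl = lookup⇒∈ (lookup-≔-same E i j)
  ... | yes _    | no l≢j   = lookup⇒∈ (trans (lookup-≔-other E i j (inj₂ l≢j)) (∈⇒lookup k~l))
  ... | no k≢i   | _        = lookup⇒∈ (trans (lookup-≔-other E i j (inj₁ k≢i)) (∈⇒lookup k~l))

  Adjacent-≔⁻ : (E : Graph n) → ∀ i j {k l} → Adjacent (E [ i , j ]≔ true) k l → Adjacent E k l ⊎ (k ≡ i × l ≡ j)
  Adjacent-≔⁻ E i j {k} {l} k~l with k Fin.≟ i | l Fin.≟ j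
  ... | yes refl | yes refl = inj₂ (refl , refl)
  ... | yes _    | no l≢j   = inj₁ (lookup⇒∈ (trans (sym (lookup-≔-other E i j (inj₂ l≢j))) (∈⇒lookup k~l)))
  ... | no k≢i   | _        = inj₁ (lookup⇒∈ (trans (sym (lookup-≔-other E i j (inj₁ k≢i))) (∈⇒lookup k~l)))

  Graph-ext : {E E₁ : Graph n} → (∀ {i j} → Adjacent E i j → Adjacent E₁ i j) →
              (∀ {i j} → Adjacent E₁ i j → Adjacent E i j) → E ≡ E₁
  Graph-ext E⊆E₁ E₁⊆E = Matrix-ext λ i j → Bool.⇔→≡ (mk⇔ (λ eq → ∈⇒lookup (E⊆E₁ (lookup⇒∈ eq))) (λ eq → ∈⇒lookup (E₁⊆E (lookup⇒∈ eq))))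

  module _ {n} (G : Digraph n) where

    private
      E₀ : Graph n
      E₀ = underlying G

      W₀ : Matrix R∞ n
      W₀ = weights (initial G)

    entry : Fin n → Fin n → R∞
    entry i j = if does (i Fin.≟ j) then [ 0# ] else arc G i j

    W₀-at : ∀ i j → W₀ ⟨ i , j ⟩ ≡ entry i j
    W₀-at i j = lookup₂-tabulate entry i j

    W₀-diagonal : ∀ i → entry i i ≡ [ 0# ]
    W₀-diagonal i rewrite dec-true (i Fin.≟ i) refl = refl

    W₀-off : ∀ {i j} → i ≢ j → W₀ ⟨ i , j ⟩ ≡ arc G i j
    W₀-off {i} {j} i≢j = trans (W₀-at i j) (cong (if_then [ 0# ] else arc G i j) (dec-false (i Fin.≟ j) i≢j))

    record Labelled (net : Network n) : Set (a ⊔ ℓ₁ ⊔ ℓ₂) where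
      private
        w = weights net
        E = edges net
      field
        sound    : Sound G w
        bounded  : w ≼ W₀
        diagonal : ∀ i → w ⟨ i , i ⟩ ≡ [ 0# ]
        support  : ∀ {i j x} → i ≢ j → w ⟨ i , j ⟩ ≡ [ x ] → Adjacent E i j
        2-cycles : NoNegative2Cycle G → ∀ i j → i ≢ j → [ 0# ] ≤∞ w ⟨ i , j ⟩ ⊕∞ w ⟨ j , i ⟩

    -- `consistent` leaves out `i ≡ j`, where it would say that the 2-cycle between `i` and `k` is
    -- not negative. That instance depends on `NoNegative2Cycle` and is kept separately as
    -- `Labelled.2-cycles`.
    record Directed (m : ℕ) (net : Network n) : Set (a ⊔ ℓ₁ ⊔ ℓ₂) where
      private w = weights net
      field
        labelled   : Labelled net
        stage≡     : edges net ≡ stage E₀ m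
        consistent : ∀ {i j k} → m ≤ toℕ k → i Fin.< k → j Fin.< k → i ≢ j →
                     w ⟨ i , j ⟩ ≤∞ w ⟨ i , k ⟩ ⊕∞ w ⟨ k , j ⟩

    join-neighbours : Fin n → Network n → Fin n → Fin n → Run (Network n)
    join-neighbours k net i j = if does (i Fin.<? j)
      then (relax (weights net) i k j >>= λ w → relax w j k i >>= λ w →
          assign (edges net) i j true >>= λ E → assign E j i true >>= λ E →
          if negative? (w ⟨ i , j ⟩ ⊕∞ w ⟨ j , i ⟩) then inconsistent else return (network w E))
      else return net

    -- One elimination step, from the network (w₀ , E).

    module Step (k : Fin n) (w₀ : Matrix R∞ n) (E : Graph n) (simple : IsSimple E) where

      L : Subset n
      L = lower E k

      Low : Fin n → Fin n → Set
      Low i j = i Fin.< k × j Fin.< k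

      -- By `frozen`, entries with an end at `k` or above are read but never changed in this step.
      -- Hence the right-hand sides of the triangle inequalities at `k` and at all greater vertices
      -- stay fixed, while the left-hand sides only decrease.
      record Stepped (net : Network n) : Set (a ⊔ ℓ₁ ⊔ ℓ₂) where
        private w = weights net
        field
          labelled : Labelled net
          frozen   : ∀ i j → ¬ Low i j → w ⟨ i , j ⟩ ≡ w₀ ⟨ i , j ⟩
          lowers   : w ≼ w₀
          kept      : ∀ {i j} → Adjacent E i j → Adjacent (edges net) i j
          added      : ∀ {i j} → Adjacent (edges net) i j → Adjacent E i j ⊎ (i ∈ L × j ∈ L × i ≢ j)

      record Later (net net′ : Network n) : Set (a ⊔ ℓ₂) where
        constructor later
        field
          ≼-weights : weights net′ ≼ weights net
          ⊆-edges   : ∀ {i j} → Adjacent (edges net) i j → Adjacent (edges net′) i j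

      Later-refl : Reflexive Later
      Later-refl = later (λ _ _ → ≤∞-refl) id

      Later-trans : Transitive Later
      Later-trans (later p q) (later p′ q′) = later (λ i j → ≤∞-trans (p′ i j) (p i j)) (q′ ∘ q)

      record Joined (i j : Fin n) (net : Network n) : Set (a ⊔ ℓ₂) where
        private w = weights net
        field
          i→j : w ⟨ i , j ⟩ ≤∞ w₀ ⟨ i , k ⟩ ⊕∞ w₀ ⟨ k , j ⟩
          j→i : w ⟨ j , i ⟩ ≤∞ w₀ ⟨ j , k ⟩ ⊕∞ w₀ ⟨ k , i ⟩
          i~j : Adjacent (edges net) i j
          j~i : Adjacent (edges net) j i

      Joined-later : ∀ {i j net net′} → Later net net′ → (i Fin.< j → Joined i j net) → i Fin.< j → Joined i j net′
      Joined-later (later ≼ ⊆) joined i<j = let open Joined (joined i<j) in record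
        { i→j = ≤∞-trans (≼ _ _) i→j ; j→i = ≤∞-trans (≼ _ _) j→i ; i~j = ⊆ i~j ; j~i = ⊆ j~i }

      module _ {i j : Fin n} (i∈L : i ∈ L) (j∈L : j ∈ L) (i<j : i Fin.< j) {net : Network n} (inner : Stepped net) where

        open Stepped inner
        open Labelled labelled

        private
          w  = weights net
          w′ = relaxed w i k j
          w″ = relaxed w′ j k i
          E₁ = edges net [ i , j ]≔ true
          E₂ = E₁ [ j , i ]≔ true

          i≢j : i ≢ j
          i≢j = Fin.<⇒≢ i<j

          i<k : i Fin.< k
          i<k = lower⇒< E k i∈L

          j<k : j Fin.< k
          j<k = lower⇒< E k j∈L

          sound″ : Sound G w″
          sound″ = relaxed-sound {G = G} {w′} (relaxed-sound {G = G} {w} sound i k j) j k i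

          w″≼w : w″ ≼ w
          w″≼w = λ p q → ≤∞-trans (relaxed-≼ w′ j k i p q) (relaxed-≼ w i k j p q)

          untouched : ∀ p q → ¬ (p ≡ i × q ≡ j) → ¬ (p ≡ j × q ≡ i) → w″ ⟨ p , q ⟩ ≡ w ⟨ p , q ⟩
          untouched p q ≢ij ≢ji = trans (relaxed-other w′ j k i (other ≢ji)) (relaxed-other w i k j (other ≢ij))
            where
            other : ∀ {a b} → ¬ (p ≡ a × q ≡ b) → p ≢ a ⊎ q ≢ b
            other {a} {b} ≢ab with p Fin.≟ a
            ... | no p≢a   = inj₁ p≢a
            ... | yes refl = inj₂ λ q≡b → ≢ab (refl , q≡b)

          j→k : w′ ⟨ j , k ⟩ ≡ w ⟨ j , k ⟩
          j→k = relaxed-other w i k j (inj₁ (i≢j ∘ sym))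

          k→i : w′ ⟨ k , i ⟩ ≡ w ⟨ k , i ⟩
          k→i = relaxed-other w i k j (inj₂ i≢j)

          touched : ∀ p q → (p ≡ i × q ≡ j) ⊎ (p ≡ j × q ≡ i) ⊎ (¬ (p ≡ i × q ≡ j) × ¬ (p ≡ j × q ≡ i))
          touched p q with (p Fin.≟ i) ×-dec (q Fin.≟ j) | (p Fin.≟ j) ×-dec (q Fin.≟ i)
          ... | yes ≡ij | _       = inj₁ ≡ij
          ... | no _    | yes ≡ji = inj₂ (inj₁ ≡ji)
          ... | no ≢ij  | no ≢ji  = inj₂ (inj₂ (≢ij , ≢ji))

          support″ : ∀ {p q x} → p ≢ q → w″ ⟨ p , q ⟩ ≡ [ x ] → Adjacent E₂ p q
          support″ {p} {q} p≢q eq with touched p q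
          ... | inj₁ (refl , refl)        = Adjacent-≔ E₁ j i (lookup⇒∈ (lookup-≔-same (edges net) i j))
          ... | inj₂ (inj₁ (refl , refl)) = lookup⇒∈ (lookup-≔-same E₁ j i)
          ... | inj₂ (inj₂ (≢ij , ≢ji))   = Adjacent-≔ E₁ j i (Adjacent-≔ (edges net) i j
            (support p≢q (trans (sym (untouched p q ≢ij ≢ji)) eq)))

          ⊕∞-comm : ∀ x y → x ⊕∞ y ≤∞ y ⊕∞ x
          ⊕∞-comm [ x ] [ y ] = ⟦ ≤ᴿ-reflexive (⊕-comm x y) ⟧
          ⊕∞-comm [ x ] ⊤⁺    = ≤∞-refl
          ⊕∞-comm ⊤⁺    y     = ≤∞-reflexive (sym (⊕∞-⊤⁺ y))

          2-cycles″ : [ 0# ] ≤∞ w″ ⟨ i , j ⟩ ⊕∞ w″ ⟨ j , i ⟩ → NoNegative2Cycle G →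
                      ∀ p q → p ≢ q → [ 0# ] ≤∞ w″ ⟨ p , q ⟩ ⊕∞ w″ ⟨ q , p ⟩
          2-cycles″ ij≥0 no2 p q p≢q with touched p q
          ... | inj₁ (refl , refl)        = ij≥0
          ... | inj₂ (inj₁ (refl , refl)) = ≤∞-trans ij≥0 (⊕∞-comm (w″ ⟨ i , j ⟩) (w″ ⟨ j , i ⟩))
          ... | inj₂ (inj₂ (≢ij , ≢ji))   = subst₂ (λ x y → [ 0# ] ≤∞ x ⊕∞ y)
            (sym (untouched p q ≢ij ≢ji)) (sym (untouched q p (≢ji ∘ swap) (≢ij ∘ swap))) (2-cycles no2 p q p≢q)

        inner-ok : [ 0# ] ≤∞ w″ ⟨ i , j ⟩ ⊕∞ w″ ⟨ j , i ⟩ →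
                   Stepped (network w″ E₂) × Later net (network w″ E₂) × Joined i j (network w″ E₂)
        inner-ok ij≥0 =
          record
            { labelled = record
              { sound    = sound″
              ; bounded  = λ p q → ≤∞-trans (w″≼w p q) (bounded p q)
              ; diagonal = λ p → trans (untouched p p (λ (p≡i , p≡j) → i≢j (trans (sym p≡i) p≡j)) (λ (p≡j , p≡i) → i≢j (trans (sym p≡i) p≡j))) (diagonal p)
              ; support  = support″
              ; 2-cycles = 2-cycles″ ij≥0
              }
            ; frozen = λ p q ¬low → trans (untouched p q (λ { (refl , refl) → ¬low (i<k , j<k) }) (λ { (refl , refl) → ¬low (j<k , i<k) })) (frozen p q ¬low)
            ; lowers = λ p q → ≤∞-trans (w″≼w p q) (lowers p q)
            ; kept    = Adjacent-≔ E₁ j i ∘ Adjacent-≔ (edges net) i j ∘ kept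
            ; added    = λ p~q → case Adjacent-≔⁻ E₁ j i p~q of λ where
                (inj₂ (refl , refl)) → inj₂ (j∈L , i∈L , i≢j ∘ sym)
                (inj₁ p~q) → case Adjacent-≔⁻ (edges net) i j p~q of λ where
                  (inj₂ (refl , refl)) → inj₂ (i∈L , j∈L , i≢j)
                  (inj₁ p~q)           → added p~q
            } ,
          later w″≼w (Adjacent-≔ E₁ j i ∘ Adjacent-≔ (edges net) i j) ,
          record
            { i→j = ≤∞-trans (relaxed-≼ w′ j k i i j) (≤∞-trans (relaxed-at w i k j) (⊕∞-mono (lowers i k) (lowers k j)))
            ; j→i = ≤∞-trans (relaxed-at w′ j k i) (⊕∞-mono (≤∞-trans (≤∞-reflexive j→k) (lowers j k)) (≤∞-trans (≤∞-reflexive k→i) (lowers k i)))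
            ; i~j = Adjacent-≔ E₁ j i (lookup⇒∈ (lookup-≔-same (edges net) i j))
            ; j~i = lookup⇒∈ (lookup-≔-same E₁ j i)
            }

        -- By soundness both entries are lengths of paths of `G`, and the two paths close up at `i`.
        inner-fails : negative? (w″ ⟨ i , j ⟩ ⊕∞ w″ ⟨ j , i ⟩) ≡ true → HasNegativeCycle G
        inner-fails neg =
          let _ , eq , x<0 = negative?-true (w″ ⟨ i , j ⟩ ⊕∞ w″ ⟨ j , i ⟩) neg
              _ , p , p≈   = Sound-via {G = G} {M = w″} sound″ {i} {j} {i} eq
          in HasNegativeCycle⇐ {G = G} p p≈ x<0

        update-runs : Runs (if negative? (w″ ⟨ i , j ⟩ ⊕∞ w″ ⟨ j , i ⟩) then inconsistent else return (network w″ E₂)) 0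
                           (HasNegativeCycle G) (λ net′ → Stepped net′ × Later net net′ × Joined i j net′)
        update-runs with negative? (w″ ⟨ i , j ⟩ ⊕∞ w″ ⟨ j , i ⟩) in eq
        ... | true  = runs z≤n (failed (inner-fails eq))
        ... | false = Runs-return (inner-ok (negative?-false (w″ ⟨ i , j ⟩ ⊕∞ w″ ⟨ j , i ⟩) eq))

      join-neighbours-runs : ∀ {i j net} → i ∈ L → j ∈ L → Stepped net →
        Runs (join-neighbours k net i j) 4 (HasNegativeCycle G)
             (λ net′ → Stepped net′ × Later net net′ × (i Fin.< j → Joined i j net′))
      join-neighbours-runs {i} {j} i∈L j∈L inner = Runs-if (i Fin.<? j)
        (λ i<j → Runs-cost 1 (Runs-cost 1 (Runs-cost 1 (Runs-cost 1
          (Runs-map z≤n (λ (inner′ , late , joined) → inner′ , late , λ _ → joined) (update-runs i∈L j∈L i<j inner))))))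
        (λ i≮j → Runs-map z≤n id (Runs-return (inner , Later-refl , λ i<j → contradiction i<j i≮j)))

      loops-run : Labelled (network w₀ E) →
        Runs (forEach (elements L) (network w₀ E) λ net i → forEach (elements L) net λ net j → join-neighbours k net i j)
             (∣ L ∣ * suc (∣ L ∣ * 5)) (HasNegativeCycle G)
             (λ net → Stepped net × (∀ {i j} → i ∈ L → j ∈ L → i Fin.< j → Joined i j net))
      loops-run lab = Runs-map
        (ℕ.≤-reflexive (cong (λ l → l * suc (l * 5)) (length-elements L)))
        (λ (inner , _ , joined) → inner , λ i∈L j∈L → joined _ (∈-elements⁺ i∈L) _ (∈-elements⁺ j∈L))
        (Runs-forEach₂ Stepped Later-refl Later-trans Joined-later (elements L) (elements L)
          (λ i∈ j∈ → join-neighbours-runs (∈-elements⁻ i∈) (∈-elements⁻ j∈))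
          record { labelled = lab ; frozen = λ _ _ _ → refl ; lowers = λ _ _ → ≤∞-refl ; kept = id ; added = inj₁ })

      module _ {net : Network n} (inner : Stepped net) (joined : ∀ {i j} → i ∈ L → j ∈ L → i Fin.< j → Joined i j net) where

        open Stepped inner
        private w = weights net

        joined-edge : ∀ {i j} → i ∈ L → j ∈ L → i ≢ j → Adjacent (edges net) i j
        joined-edge {i} {j} i∈ j∈ i≢j with Fin.<-cmp i j
        ... | tri< i<j _ _ = Joined.i~j (joined i∈ j∈ i<j)
        ... | tri≈ _ i≡j _ = contradiction i≡j i≢j
        ... | tri> _ _ j<i = Joined.j~i (joined j∈ i∈ j<i)

        edges≡ : edges net ≡ eliminate k E
        edges≡ = Graph-ext
          (λ i~j → case added i~j of λ where
            (inj₁ i~j)             → eliminate-⊇ E k i~j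
            (inj₂ (i∈ , j∈ , i≢j)) → eliminate-joins E k i∈ j∈ i≢j)
          (λ i~j → case eliminate⁻ E k i~j of λ where
            (inj₁ i~j)             → kept i~j
            (inj₂ (i∈ , j∈ , i≢j)) → joined-edge i∈ j∈ i≢j)

        joined-△ : ∀ {i j} → i ∈ L → j ∈ L → i ≢ j → w ⟨ i , j ⟩ ≤∞ w₀ ⟨ i , k ⟩ ⊕∞ w₀ ⟨ k , j ⟩
        joined-△ {i} {j} i∈ j∈ i≢j with Fin.<-cmp i j
        ... | tri< i<j _ _ = Joined.i→j (joined i∈ j∈ i<j)
        ... | tri≈ _ i≡j _ = contradiction i≡j i≢j
        ... | tri> _ _ j<i = Joined.j→i (joined j∈ i∈ j<i)

        -- The relaxations reach only pairs in `L`, but the other pairs have an infinite right-hand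
        -- side: by `support`, a finite entry joins adjacent vertices.
        triangle : Labelled (network w₀ E) → ∀ {i j} → i Fin.< k → j Fin.< k → i ≢ j →
                   w ⟨ i , j ⟩ ≤∞ w₀ ⟨ i , k ⟩ ⊕∞ w₀ ⟨ k , j ⟩
        triangle lab {i} {j} i<k j<k i≢j with w₀ ⟨ i , k ⟩ in ik | w₀ ⟨ k , j ⟩ in kj
        ... | ⊤⁺    | _     = _ Supremum.≤⊤⁺
        ... | [ _ ] | ⊤⁺    = _ Supremum.≤⊤⁺
        ... | [ _ ] | [ _ ] = subst₂ (λ x y → w ⟨ i , j ⟩ ≤∞ x ⊕∞ y) ik kj (joined-△
          (∈-lower⁺ E k (IsSimple.symmetric simple (Labelled.support lab (Fin.<⇒≢ i<k) ik)) i<k)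
          (∈-lower⁺ E k (Labelled.support lab (Fin.<⇒≢ j<k ∘ sym) kj) j<k) i≢j)

    module _ {b} (lower≤b : ∀ k → ∣ lower (triangulate E₀) k ∣ ≤ b) where

      directed : ∀ k {w₀ E} → E ≡ stage E₀ (suc (toℕ k)) → (simple : IsSimple E) → Directed (suc (toℕ k)) (network w₀ E) →
        let open Step k w₀ E simple in
        ∀ {net} → Stepped net → (∀ {i j} → i ∈ L → j ∈ L → i Fin.< j → Joined i j net) → Directed (toℕ k) net
      directed k {w₀} {E} E≡ simple dir {net} inner joined = record
        { labelled   = Stepped.labelled inner
        ; stage≡     = trans (edges≡ inner joined) (trans (cong (eliminate k) E≡) (sym (stage-step E₀ k)))
        ; consistent = λ {i} {j} {l} k≤l i<l j<l i≢j → subst₂ (λ x y → weights net ⟨ i , j ⟩ ≤∞ x ⊕∞ y)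
            (sym (Stepped.frozen inner i l (λ (_ , l<k) → ℕ.<⇒≱ l<k k≤l)))
            (sym (Stepped.frozen inner l j (λ (l<k , _) → ℕ.<⇒≱ l<k k≤l)))
            (case ℕ.m≤n⇒m<n∨m≡n k≤l of λ where
              (inj₁ k<l) → ≤∞-trans (Stepped.lowers inner i j) (Directed.consistent dir k<l i<l j<l i≢j)
              (inj₂ k≡l) → case Fin.toℕ-injective k≡l of λ { refl → triangle inner joined (Directed.labelled dir) i<l j<l i≢j })
        }
        where open Step k w₀ E simple

      dpc-step : ∀ k {net} → Directed (suc (toℕ k)) net →
        Runs (lowerNeighbours (edges net) k >>= λ ns →
              forEach ns net λ net i → forEach ns net λ net j → join-neighbours k net i j)
             (n + n + b * suc (b * 5)) (HasNegativeCycle G) (Directed (toℕ k))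
      dpc-step k {network w₀ E} dir = Runs-cost (n + n) (Runs-map
        (ℕ.*-mono-≤ L≤b (s≤s (ℕ.*-monoˡ-≤ 5 L≤b)))
        (λ (inner , joined) → directed k E≡ simple dir inner joined)
        (loops-run (Directed.labelled dir)))
        where
        E≡ = Directed.stage≡ dir
        simple : IsSimple E
        simple = subst IsSimple (sym E≡) (stage-simple E₀ (underlying-simple {G = G}) (Fin.toℕ<n k))
        open Step k w₀ E simple
        L≤b : ∣ L ∣ ≤ b
        L≤b = ℕ.≤-trans (p⊆q⇒∣p∣≤∣q∣ λ x∈ → lower-stage⇒triangulate E₀ k (subst (λ E → _ ∈ lower E k) E≡ x∈)) (lower≤b k)

      dpc-start : Directed n (initial G)
      dpc-start = record
        { labelled = record
          { sound    = λ i j eq → sound i j (trans (sym (W₀-at i j)) eq)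
          ; bounded  = λ _ _ → ≤∞-refl
          ; diagonal = λ i → trans (W₀-at i i) (W₀-diagonal i)
          ; support  = λ {i} {j} i≢j eq → arc⇒adjacent {G = G} (trans (sym (W₀-off i≢j)) eq)
          ; 2-cycles = λ no2 i j i≢j → 2-cycles no2 i j i≢j
          }
        ; stage≡     = sym (stage-start E₀)
        ; consistent = λ {_} {_} {k} n≤k → contradiction (Fin.toℕ<n k) (ℕ.≤⇒≯ n≤k)
        }
        where
        sound : ∀ i j {x} → entry i j ≡ [ x ] → ∃[ y ] Path G i j y × y ≈ x
        sound i j eq with i Fin.≟ j
        sound i j refl | yes refl = _ , [] , ≈-refl
        sound i j eq   | no _     = _ , eq ∷ [] , ⊕-identityʳ _
        2-cycles : NoNegative2Cycle G → ∀ i j → i ≢ j → [ 0# ] ≤∞ W₀ ⟨ i , j ⟩ ⊕∞ W₀ ⟨ j , i ⟩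
        2-cycles no2 i j i≢j = subst₂ (λ x y → [ 0# ] ≤∞ x ⊕∞ y) (sym (W₀-off i≢j)) (sym (W₀-off (i≢j ∘ sym))) arcs
          where
          arcs : [ 0# ] ≤∞ arc G i j ⊕∞ arc G j i
          arcs with arc G i j in ij | arc G j i in ji
          ... | ⊤⁺    | _     = _ Supremum.≤⊤⁺
          ... | [ _ ] | ⊤⁺    = _ Supremum.≤⊤⁺
          ... | [ x ] | [ y ] = ⟦ no2 i j x y ij ji ⟧

      dpc-runs : Runs (dpc (initial G)) (n * suc (n + n + b * suc (b * 5))) (HasNegativeCycle G) (Directed 0)
      dpc-runs = Runs-forEach-reverse-tabulate id Directed dpc-step dpc-start

-- Distances along the edges, and the traversal of the clique tree

mutual
  -- Counts how often the traversal takes a vertex as new. Comparison with the growth of the visited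
  -- set, in `Visited.counted`, bounds the total.
  newCount : ∀ {n} → Subset n → Tree n → ℕ
  newCount P (node C ts) = ∣ C ─ P ∣ + newCounts C ts

  newCounts : ∀ {n} → Subset n → List (Tree n) → ℕ
  newCounts P []       = 0
  newCounts P (t ∷ ts) = newCount P t + newCounts P ts

module Distances {a ℓ₁ ℓ₂} (R : OrderedAbelianGroup a ℓ₁ ℓ₂) {n} (G : APSP.Digraph R n) where

  open Weights R
  open Consistency R

  E₀ E⁺ : Graph n
  E₀ = underlying G
  E⁺ = triangulate E₀

  E₀-simple : IsSimple E₀
  E₀-simple = underlying-simple {G = G}

  E⁺-simple : IsSimple E⁺
  E⁺-simple = triangulate-simple E₀ E₀-simple

  Near : Rel (Fin n) 0ℓ
  Near i j = i ≡ j ⊎ Adjacent E⁺ i j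

  Near-sym : ∀ {i j} → Near i j → Near j i
  Near-sym = Sum.map sym (IsSimple.symmetric E⁺-simple)

  clique⇒Near : ∀ {C} → IsClique E⁺ C → ∀ {i j} → i ∈ C → j ∈ C → Near i j
  clique⇒Near clique {i} {j} i∈ j∈ with i Fin.≟ j
  ... | yes i≡j = inj₁ i≡j
  ... | no  i≢j = inj₂ (clique i∈ j∈ i≢j)

  record Solved (net : Network n) : Set (a ⊔ ℓ₁ ⊔ ℓ₂) where
    private w = weights net
    field
      edges≡   : edges net ≡ E⁺
      sound    : Sound G w
      diagonal : ∀ i → w ⟨ i , i ⟩ ≡ [ 0# ]
      tight    : ∀ {i j} → Near i j → Tight G w i j
      no-cycle : NoNegative2Cycle G → ¬ HasNegativeCycle G

  -- The second phase of P³C, from the network (W , E⁺) left by DPC.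

  module Ascent (W : Matrix R∞ n) (dir : Directed G 0 (network W E⁺)) where

    open Labelled (Directed.labelled dir) using (bounded; support; 2-cycles) renaming (sound to W-sound; diagonal to W-diagonal)

    △ : NoNegative2Cycle G → ∀ {i j k} → i Fin.< k → j Fin.< k → W ⟨ i , j ⟩ ≤∞ W ⟨ i , k ⟩ ⊕∞ W ⟨ k , j ⟩
    △ no2 {i} {j} {k} i<k j<k with i Fin.≟ j
    ... | no i≢j   = Directed.consistent dir z≤n i<k j<k i≢j
    ... | yes refl = ≤∞-trans (≤∞-reflexive (W-diagonal i)) (2-cycles no2 i k (Fin.<⇒≢ i<k))

    module Walks (no2 : NoNegative2Cycle G) = Rolling (λ i j → W ⟨ i , j ⟩) W-diagonal (△ no2)

    shorten : (no2 : NoNegative2Cycle G) → ∀ {i j x} → Path G i j x → Walks.Shorter no2 i j x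
    shorten no2 = Walks.path⇒walk no2 λ {i} {j} i→j → ≤∞-trans (bounded i j)
      (≤∞-reflexive (trans (W₀-off G (arc⇒≢ {G = G} i→j)) i→j))

    no-negative-cycle : NoNegative2Cycle G → ¬ HasNegativeCycle G
    no-negative-cycle no2 (i , x , p , x<0) with z , w , z≤x ← shorten no2 p with refl ← Walks.closed⇒0 no2 w = ≥0⇒≮0 z≤x x<0

    record Ascended (m : ℕ) (net : Network n) : Set (a ⊔ ℓ₁ ⊔ ℓ₂) where
      private w = weights net
      field
        edges≡   : edges net ≡ E⁺
        sound    : Sound G w
        lowered  : w ≼ W
        diagonal : ∀ i → w ⟨ i , i ⟩ ≡ [ 0# ]
        short    : ∀ {i j} → toℕ i < m → toℕ j < m → Near i j →
                   (no2 : NoNegative2Cycle G) → ∀ {z} → Walks.Walk no2 i j z → w ⟨ i , j ⟩ ≤∞ [ z ]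

    sweep : Fin n → Network n → Fin n → Fin n → Run (Network n)
    sweep k net i j = relax (weights net) i j k >>= λ w → relax w k i j >>= λ w → return (network w (edges net))

    module _ (k : Fin n) (w₀ : Matrix R∞ n) where

      private
        L : Subset n
        L = lower E⁺ k

      record Swept (net : Network n) : Set (a ⊔ ℓ₁ ⊔ ℓ₂) where
        private w = weights net
        field
          edges≡   : edges net ≡ E⁺
          sound    : Sound G w
          lowered  : w ≼ w₀
          diagonal : ∀ i → w ⟨ i , i ⟩ ≡ [ 0# ]

      record Improved (i j : Fin n) (net : Network n) : Set (a ⊔ ℓ₂) where
        private w = weights net
        field
          i→k : w ⟨ i , k ⟩ ≤∞ w₀ ⟨ i , j ⟩ ⊕∞ w₀ ⟨ j , k ⟩
          k→j : w ⟨ k , j ⟩ ≤∞ w₀ ⟨ k , i ⟩ ⊕∞ w₀ ⟨ i , j ⟩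

      _⊑_ : Rel (Network n) (a ⊔ ℓ₂)
      net ⊑ net′ = weights net′ ≼ weights net

      sweep-runs : ∀ {i j net} → i ∈ L → j ∈ L → Swept net →
        Runs (sweep k net i j) 2 (HasNegativeCycle G) (λ net′ → Swept net′ × (net ⊑ net′) × Improved i j net′)
      sweep-runs {i} {j} {net} i∈ j∈ sw = Runs-cost 1 (Runs-cost 1 (Runs-return
        ( record
          { edges≡   = edges≡
          ; sound    = relaxed-sound {G = G} {w′} (relaxed-sound {G = G} {w} sound i j k) k i j
          ; lowered  = λ p q → ≤∞-trans (w″≼w p q) (lowered p q)
          ; diagonal = λ p → trans (relaxed-other w′ k i j (off-diagonal {p} (Fin.<⇒≢ (lower⇒< E⁺ k j∈) ∘ sym)))
                                   (trans (relaxed-other w i j k (off-diagonal {p} (Fin.<⇒≢ (lower⇒< E⁺ k i∈)))) (diagonal p))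
          }
        , w″≼w
        , record
          { i→k = ≤∞-trans (relaxed-≼ w′ k i j i k) (≤∞-trans (relaxed-at w i j k) (⊕∞-mono (lowered i j) (lowered j k)))
          ; k→j = ≤∞-trans (relaxed-at w′ k i j) (⊕∞-mono
              (≤∞-trans (relaxed-≼ w i j k k i) (lowered k i)) (≤∞-trans (relaxed-≼ w i j k i j) (lowered i j)))
          } )))
        where
        open Swept sw
        w  = weights net
        w′ = relaxed w i j k
        w″≼w : relaxed w′ k i j ≼ w
        w″≼w p q = ≤∞-trans (relaxed-≼ w′ k i j p q) (relaxed-≼ w i j k p q)
        off-diagonal : ∀ {p q r : Fin n} → q ≢ r → p ≢ q ⊎ p ≢ r
        off-diagonal {p} {q} q≢r with p Fin.≟ q
        ... | no p≢q   = inj₁ p≢q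
        ... | yes refl = inj₂ q≢r

      sweeps-run : Swept (network w₀ E⁺) →
        Runs (forEach (elements L) (network w₀ E⁺) λ net i → forEach (elements L) net λ net j → sweep k net i j)
             (∣ L ∣ * suc (∣ L ∣ * 3)) (HasNegativeCycle G)
             (λ net → Swept net × (∀ {i j} → i ∈ L → j ∈ L → Improved i j net))
      sweeps-run sw = Runs-map
        (ℕ.≤-reflexive (cong (λ l → l * suc (l * 3)) (length-elements L)))
        (λ (swept , _ , improved) → swept , λ i∈L j∈L → improved _ (∈-elements⁺ i∈L) _ (∈-elements⁺ j∈L))
        (Runs-forEach₂ Swept {_⊑_} (λ _ _ → ≤∞-refl) (λ p q i j → ≤∞-trans (q i j) (p i j))
          {Improved} (λ later imp → record
            { i→k = ≤∞-trans (later _ _) (Improved.i→k imp) ; k→j = ≤∞-trans (later _ _) (Improved.k→j imp) })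
          (elements L) (elements L) (λ i∈ j∈ → sweep-runs (∈-elements⁻ i∈) (∈-elements⁻ j∈)) sw)

      ascended : Ascended (toℕ k) (network w₀ E⁺) → ∀ {net} → Swept net →
                 (∀ {i j} → i ∈ L → j ∈ L → Improved i j net) → Ascended (suc (toℕ k)) net
      ascended asc {net} swept improved = record
        { edges≡   = Swept.edges≡ swept
        ; sound    = Swept.sound swept
        ; lowered  = λ i j → ≤∞-trans (Swept.lowered swept i j) (Ascended.lowered asc i j)
        ; diagonal = Swept.diagonal swept
        ; short    = λ i≤k j≤k → short (≤k⇒ i≤k) (≤k⇒ j≤k)
        }
        where
        w = weights net
        ≤k⇒ : ∀ {i : Fin n} → toℕ i < suc (toℕ k) → i Fin.< k ⊎ i ≡ k
        ≤k⇒ i≤k = Sum.map₂ Fin.toℕ-injective (ℕ.m≤n⇒m<n∨m≡n (ℕ.≤-pred i≤k))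
        neighbour : ∀ {i x} → i Fin.< k → W ⟨ i , k ⟩ ≡ [ x ] ⊎ W ⟨ k , i ⟩ ≡ [ x ] ⊎ Near i k → i ∈ L
        neighbour i<k (inj₁ i→k) = ∈-lower⁺ E⁺ k (IsSimple.symmetric E⁺-simple (support (Fin.<⇒≢ i<k) i→k)) i<k
        neighbour i<k (inj₂ (inj₁ k→i)) = ∈-lower⁺ E⁺ k (support (Fin.<⇒≢ i<k ∘ sym) k→i) i<k
        neighbour i<k (inj₂ (inj₂ (inj₁ i≡k))) = contradiction i≡k (Fin.<⇒≢ i<k)
        neighbour i<k (inj₂ (inj₂ (inj₂ i~k))) = ∈-lower⁺ E⁺ k (IsSimple.symmetric E⁺-simple i~k) i<k
        arc≤ : ∀ i j {x} → W ⟨ i , j ⟩ ≡ [ x ] → w₀ ⟨ i , j ⟩ ≤∞ [ x ]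
        arc≤ i j eq = ≤∞-trans (Ascended.lowered asc i j) (≤∞-reflexive eq)
        low-near : ∀ {i j} → i ∈ L → j ∈ L → Near i j
        low-near = clique⇒Near (lower-clique E₀ k)
        short : ∀ {i j} → i Fin.< k ⊎ i ≡ k → j Fin.< k ⊎ j ≡ k → Near i j →
                (no2 : NoNegative2Cycle G) → ∀ {z} → Walks.Walk no2 i j z → w ⟨ i , j ⟩ ≤∞ [ z ]
        short (inj₁ i<k) (inj₁ j<k) near no2 walk =
          ≤∞-trans (Swept.lowered swept _ _) (Ascended.short asc i<k j<k near no2 walk)
        short (inj₂ refl) (inj₂ refl) near no2 walk with refl ← Walks.closed⇒0 no2 walk =
          ≤∞-reflexive (Swept.diagonal swept k)
        short {i} (inj₁ i<k) (inj₂ refl) near no2 Rolling.[] = contradiction i<k (ℕ.<-irrefl refl)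
        short {i} (inj₁ i<k) (inj₂ refl) near no2 (Rolling.down _ _ _ k<i) = contradiction k<i (ℕ.<-asym i<k)
        -- The final arc comes from a lower neighbour `j` of `k`, and `i` is a lower neighbour as
        -- well. These form a clique, so `i` and `j` are near and the induction hypothesis covers
        -- the remaining walk.
        short {i} (inj₁ i<k) (inj₂ refl) near no2 (Rolling.up {j = j} {y = y} walk j→k _ j<k) =
          ≤∞-trans (Improved.i→k (improved i∈L j∈L))
            (⊕∞-mono (Ascended.short asc i<k j<k (low-near i∈L j∈L) no2 walk) (arc≤ j k j→k))
          where
          i∈L = neighbour {x = y} i<k (inj₂ (inj₂ near))
          j∈L = neighbour j<k (inj₁ j→k)
        short {j = j} (inj₂ refl) (inj₁ j<k) near no2 Rolling.[] = contradiction j<k (ℕ.<-irrefl refl)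
        short {j = j} (inj₂ refl) (inj₁ j<k) near no2 (Rolling.up _ _ k<j _) = contradiction k<j (ℕ.<-asym j<k)
        short {j = j} (inj₂ refl) (inj₁ j<k) near no2 (Rolling.down {j = i} {y = y} k→i walk i<k _) =
          ≤∞-trans (Improved.k→j (improved i∈L j∈L))
            (⊕∞-mono (arc≤ k i k→i) (Ascended.short asc i<k j<k (low-near i∈L j∈L) no2 walk))
          where
          i∈L = neighbour i<k (inj₂ (inj₁ k→i))
          j∈L = neighbour {x = y} j<k (inj₂ (inj₂ (Near-sym near)))

    module _ {b} (lower≤b : ∀ k → ∣ lower E⁺ k ∣ ≤ b) where

      ascent-step : ∀ k {net} → Ascended (toℕ k) net →
        Runs (lowerNeighbours (edges net) k >>= λ ns →
              forEach ns net λ net i → forEach ns net λ net j → sweep k net i j)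
             (n + n + b * suc (b * 3)) (HasNegativeCycle G) (Ascended (suc (toℕ k)))
      ascent-step k {network w E} asc with refl ← Ascended.edges≡ asc = Runs-cost (n + n) (Runs-map
        (ℕ.*-mono-≤ (lower≤b k) (s≤s (ℕ.*-monoˡ-≤ 3 (lower≤b k))))
        (λ (swept , improved) → ascended k w asc swept improved)
        (sweeps-run k w record
          { edges≡ = refl ; sound = Ascended.sound asc ; lowered = λ _ _ → ≤∞-refl ; diagonal = Ascended.diagonal asc }))

      ascent-runs : Runs (forEach (allFin n) (network W E⁺) λ net k → lowerNeighbours (edges net) k >>= λ ns →
                          forEach ns net λ net i → forEach ns net λ net j → sweep k net i j)
                         (n * suc (n + n + b * suc (b * 3))) (HasNegativeCycle G) Solved
      ascent-runs = Runs-map ℕ.≤-refl solved (Runs-forEach-tabulate id Ascended ascent-step record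
        { edges≡ = refl ; sound = W-sound ; lowered = λ _ _ → ≤∞-refl ; diagonal = W-diagonal ; short = λ () })
        where
        solved : ∀ {net} → Ascended n net → Solved net
        solved asc = record
          { edges≡   = Ascended.edges≡ asc
          ; sound    = Ascended.sound asc
          ; diagonal = Ascended.diagonal asc
          ; tight    = λ near no2 p → let _ , walk , z≤x = shorten no2 p in
              ≤∞-trans (Ascended.short asc (Fin.toℕ<n _) (Fin.toℕ<n _) near no2 walk) ⟦ z≤x ⟧
          ; no-cycle = no-negative-cycle
          }

  p³c-runs : ∀ {b} → (∀ k → ∣ lower E⁺ k ∣ ≤ b) →
    Runs (p³c (initial G)) (n * suc (n + n + b * suc (b * 5)) + n * suc (n + n + b * suc (b * 3))) (HasNegativeCycle G) Solved
  p³c-runs lower≤b = Runs-bind (dpc-runs G lower≤b) λ { {network W E} dir →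
    -- `stage E₀ 0` is `triangulate E₀` by computation.
    case Directed.stage≡ dir of λ { refl → Ascent.ascent-runs W dir lower≤b } }

-- Initial distances and relaxation along the clique tree

module Traversal {a ℓ₁ ℓ₂} (R : OrderedAbelianGroup a ℓ₁ ℓ₂) {n} (G : APSP.Digraph R n) where

  open Weights R
  open Consistency R
  open Distances R G

  record Initialised (D : Matrix R∞ n) : Set (a ⊔ ℓ₁ ⊔ ℓ₂) where
    field
      sound : Sound G D
      near  : ∀ {i j} → Near i j → Tight G D i j

  module _ {net : Network n} (solved : Solved net) where

    private
      w = weights net

    -- Entries are written repeatedly, once from each end of an edge. That is harmless as long as
    -- every value written is the entry of `w`; for the diagonal this value is `0#`.
    Copy : Matrix R∞ n → Set a
    Copy D = ∀ i j → D ⟨ i , j ⟩ ≡ ⊤⁺ ⊎ D ⟨ i , j ⟩ ≡ w ⟨ i , j ⟩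

    Keeps : Rel (Matrix R∞ n) a
    Keeps D D′ = ∀ i j → D ⟨ i , j ⟩ ≡ w ⟨ i , j ⟩ → D′ ⟨ i , j ⟩ ≡ w ⟨ i , j ⟩

    copy-entry : ∀ {D} i j {x} → x ≡ w ⟨ i , j ⟩ → Copy D →
                 Copy (D [ i , j ]≔ x) × Keeps D (D [ i , j ]≔ x)
    copy-entry {D} i j {x} x≡ copy = copied , kept
      where
      copied : Copy (D [ i , j ]≔ x)
      copied p q with ≔-cases D i j {x} p q
      ... | inj₁ (refl , refl , eq) = inj₂ (trans eq x≡)
      ... | inj₂ eq                 = Sum.map (trans eq) (trans eq) (copy p q)
      kept : Keeps D (D [ i , j ]≔ x)
      kept p q with ≔-cases D i j {x} p q
      ... | inj₁ (refl , refl , eq) = λ _ → trans eq x≡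
      ... | inj₂ eq                 = trans eq

    initialDistances-runs : Runs (initialDistances net) (n * n + n * suc (1 + (n + n * 3))) Empty.⊥ Initialised
    initialDistances-runs = Runs-cost (n * n) (Runs-map
      (ℕ.≤-reflexive (cong (_* suc (1 + (n + n * 3))) (List.length-tabulate {n = n} id)))
      (λ (copy , _ , filled) → initialised copy λ i → filled i (List.∈-allFin i))
      (Runs-forEach Copy {Keeps} (λ _ _ → id) (λ p q i j → q i j ∘ p i j) {Row}
        (λ keeps (ii , ij) → keeps _ _ ii , λ i~j → keeps _ _ (ij i~j))
        (allFin n) (λ {i} {D} _ → row-runs i D) λ i j → inj₁ (blank i j)))
      where
      Row : Fin n → Matrix R∞ n → Set a
      Row i D = D ⟨ i , i ⟩ ≡ w ⟨ i , i ⟩ × (∀ {j} → Adjacent (edges net) i j → D ⟨ i , j ⟩ ≡ w ⟨ i , j ⟩)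
      blank : ∀ i j → replicate n (replicate n ⊤⁺) ⟨ i , j ⟩ ≡ ⊤⁺
      blank i j = trans (cong (λ r → lookup r j) (Vec.lookup-replicate i (replicate n ⊤⁺))) (Vec.lookup-replicate j ⊤⁺)
      copy-edge : Fin n → Matrix R∞ n → Fin n → Run (Matrix R∞ n)
      copy-edge i D j = assign D i j (w ⟨ i , j ⟩) >>= λ D → assign D j i (w ⟨ j , i ⟩)
      copy-edge-runs : ∀ i {j D} → Copy D → Runs (copy-edge i D j) 2 Empty.⊥ (λ D′ → Copy D′ × Keeps D D′ × D′ ⟨ i , j ⟩ ≡ w ⟨ i , j ⟩)
      copy-edge-runs i {j} {D} copy =
        let D₁ = D [ i , j ]≔ (w ⟨ i , j ⟩)
            copy₁ , keeps₁ = copy-entry {D} i j refl copy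
            copy₂ , keeps₂ = copy-entry {D₁} j i refl copy₁
        in Runs-cost 1 (Runs-cost 1 (Runs-return
             (copy₂ , (λ p q → keeps₂ p q ∘ keeps₁ p q) , keeps₂ i j (lookup-≔-same D i j))))
      row-runs : ∀ i D → Copy D →
        Runs (assign D i i [ 0# ] >>= λ D → scan elements (neighbours (edges net) i) >>= λ js → forEach js D (copy-edge i))
             (1 + (n + n * 3)) Empty.⊥ (λ D′ → Copy D′ × Keeps D D′ × Row i D′)
      row-runs i D copy =
        let N = neighbours (edges net) i
            D₁ = D [ i , i ]≔ [ 0# ]
            copy₁ , keeps₁ = copy-entry {D} i i (sym (Solved.diagonal solved i)) copy
        in Runs-cost 1 (Runs-cost n (Runs-map
             (ℕ.*-monoˡ-≤ 3 (ℕ.≤-trans (ℕ.≤-reflexive (length-elements N)) (∣p∣≤n N)))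
             (λ (copy₂ , keeps₂ , row) → copy₂ , (λ p q → keeps₂ p q ∘ keeps₁ p q) ,
               keeps₂ i i (trans (lookup-≔-same D i i) (sym (Solved.diagonal solved i))) ,
               λ {j} i~j → row j (∈-elements⁺ {S = N} i~j))
             (Runs-forEach Copy {Keeps} (λ _ _ → id) (λ p q i j → q i j ∘ p i j)
               {λ j D → D ⟨ i , j ⟩ ≡ w ⟨ i , j ⟩} (λ keeps → keeps _ _)
               (elements N) (λ _ → copy-edge-runs i) copy₁)))
      initialised : ∀ {D} → Copy D → (∀ i → Row i D) → Initialised D
      initialised {D} copy rows = record
        { sound = λ i j eq → case copy i j of λ where
            (inj₁ ∞)  → case trans (sym ∞) eq of λ ()
            (inj₂ ≡w) → Solved.sound solved i j (trans (sym ≡w) eq)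
        ; near = λ near no2 p → ≤∞-trans (≤∞-reflexive (copied near)) (Solved.tight solved near no2 p)
        }
        where
        copied : ∀ {i j} → Near i j → D ⟨ i , j ⟩ ≡ w ⟨ i , j ⟩
        copied (inj₁ refl) = proj₁ (rows _)
        copied {i} {j} (inj₂ i~j) = proj₂ (rows i) (subst (λ E → Adjacent E i j) (sym (Solved.edges≡ solved)) i~j)

  arc⇒E⁺ : ∀ {i j x} → arc G i j ≡ [ x ] → Adjacent E⁺ i j
  arc⇒E⁺ i→j = ⊆-triangulate E₀ (arc⇒adjacent {G = G} i→j)

  Splits : Subset n → Fin n → Fin n → Carrier → Set (a ⊔ ℓ₁)
  Splits S i k x = ∃[ j ] j ∈ S × ∃[ y ] ∃[ z ] Path G i j y × Path G j k z × y ⊕ z ≈ x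

  module _ {P U t} (reg : Region E⁺ P U t) where

    private
      S : Subset n
      S = top-label t ∩ P

    splits-∷ : ∀ {i j k x y} → arc G i j ≡ [ x ] → Splits S j k y → Splits S i k (x ⊕ y)
    splits-∷ i→j (l , l∈S , y , z , p , q , eq) =
      l , l∈S , _ , z , i→j ∷ p , q , ≈-trans (⊕-assoc _ y z) (⊕-congˡ eq)

    splits-from : ∀ {i k x} → Path G i k x → Inner reg i → ¬ Inner reg k → Splits S i k x
    splits-from []        inner ¬inner = contradiction inner ¬inner
    splits-from (i→j ∷ p) inner ¬inner with Inner-step reg (arc⇒E⁺ i→j) inner
    ... | inj₁ inner′ = splits-∷ i→j (splits-from p inner′ ¬inner)
    ... | inj₂ j∈S    = _ , j∈S , _ , _ , i→j ∷ [] , p , ⊕-congʳ (⊕-identityʳ _)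

    -- A path is unfolded from its start while the inner vertex is its end, so the recursion reports
    -- whether the start is inner too. `explore` rules that out, since visited vertices are never
    -- inner.
    splits-to : ∀ {i k x} → Path G i k x → Inner reg k → Inner reg i ⊎ Splits S i k x
    splits-to []        inner = inj₁ inner
    splits-to (i→j ∷ p) inner with splits-to p inner
    ... | inj₂ split  = inj₂ (splits-∷ i→j split)
    ... | inj₁ inner′ with Inner-step reg (IsSimple.symmetric E⁺-simple (arc⇒E⁺ i→j)) inner′
    ...   | inj₁ inner″ = inj₁ inner″
    ...   | inj₂ i∈S    = inj₂ (_ , i∈S , _ , _ , [] , i→j ∷ p , ⊕-identityˡ _)

  record Explored (D : Matrix R∞ n) (U : Subset n) : Set (a ⊔ ℓ₁ ⊔ ℓ₂) where
    field
      sound    : Sound G D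
      near     : ∀ {i j} → Near i j → Tight G D i j
      explored : ∀ {i j} → i ∈ U → j ∈ U → Tight G D i j

  module _ {P C U : Subset n} {ts} (reg : Region E⁺ P U (node C ts)) (P⊆U : P ⊆ U) where

    private
      New Sep Other : Subset n
      New   = C ─ P
      Sep   = C ∩ P
      Other = U ─ C

      C-near : ∀ {i j} → i ∈ C → j ∈ C → Near i j
      C-near = clique⇒Near (Region.cliques reg root)

      new-inner : ∀ {i} → i ∈ C → i ∉ U → Inner reg i
      new-inner i∈C i∉U = (root , i∈C) , i∉U ∘ P⊆U

      other-outer : ∀ {k} → k ∈ U → ¬ Inner reg k
      other-outer k∈U (k∈t , k∉P) = k∉P (Region.seen reg k∈t k∈U)

    record Routed (D : Matrix R∞ n) (i j k : Fin n) (D′ : Matrix R∞ n) : Set (a ⊔ ℓ₂) where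
      field
        i→k : D′ ⟨ i , k ⟩ ≤∞ D ⟨ i , j ⟩ ⊕∞ D ⟨ j , k ⟩
        k→i : D′ ⟨ k , i ⟩ ≤∞ D ⟨ k , j ⟩ ⊕∞ D ⟨ j , i ⟩

    -- A path between a new and a previously visited vertex splits at a member of `Sep`. The part at
    -- the new end joins two members of the clique `C`, the other part joins two visited vertices,
    -- and `D` is tight for both. One relaxation through the splitting vertex then suffices.
    explore : ∀ {D D′} → Explored D U → Sound G D′ → D′ ≼ D →
      (∀ {i j k} → i ∈ New → j ∈ Sep → k ∈ Other → Routed D i j k D′) → Explored D′ (U ∪ C)
    explore {D} {D′} exp sound′ D′≼D routed = record
      { sound    = sound′
      ; near     = λ near → Tight-≼ {G = G} {D} {D′} D′≼D (Explored.near exp near)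
      ; explored = λ i∈ j∈ → explored i∈ j∈
      }
      where
      C∖U : ∀ {i} → i ∈ U ∪ C → i ∉ U → i ∈ C
      C∖U i∈ i∉U = [ (λ i∈U → contradiction i∈U i∉U) , id ]′ (x∈p∪q⁻ U C i∈)
      is-new : ∀ {i} → i ∈ C → i ∉ U → i ∈ New
      is-new i∈C i∉U = x∈p∧x∉q⇒x∈p─q i∈C (i∉U ∘ P⊆U)
      via : ∀ {i j k x y z} → D′ ⟨ i , k ⟩ ≤∞ D ⟨ i , j ⟩ ⊕∞ D ⟨ j , k ⟩ →
            D ⟨ i , j ⟩ ≤∞ [ y ] → D ⟨ j , k ⟩ ≤∞ [ z ] → y ⊕ z ≈ x → D′ ⟨ i , k ⟩ ≤∞ [ x ]
      via route ij jk eq = ≤∞-trans route (≤∞-trans (⊕∞-mono ij jk) ⟦ ≤ᴿ-reflexive eq ⟧)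
      explored : ∀ {i j} → i ∈ U ∪ C → j ∈ U ∪ C → Tight G D′ i j
      explored {i} {j} i∈ j∈ no2 p with i ∈? U | j ∈? U | i ∈? C | j ∈? C
      ... | yes i∈U | yes j∈U | _       | _       = ≤∞-trans (D′≼D i j) (Explored.explored exp i∈U j∈U no2 p)
      ... | _       | _       | yes i∈C | yes j∈C = ≤∞-trans (D′≼D i j) (Explored.near exp (C-near i∈C j∈C) no2 p)
      ... | no i∉U  | no j∉U  | no i∉C  | _       = contradiction (C∖U i∈ i∉U) i∉C
      ... | no i∉U  | no j∉U  | _       | no j∉C  = contradiction (C∖U j∈ j∉U) j∉C
      ... | no i∉U  | yes j∈U | no i∉C  | _       = contradiction (C∖U i∈ i∉U) i∉C
      ... | yes i∈U | no j∉U  | _       | no j∉C  = contradiction (C∖U j∈ j∉U) j∉C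
      ... | no i∉U  | yes j∈U | yes i∈C | no j∉C
        with l , l∈S , _ , _ , q , r , eq ← splits-from reg p (new-inner i∈C i∉U) (other-outer j∈U) =
        let l∈C , l∈P = x∈p∩q⁻ C P l∈S in
        via (Routed.i→k (routed (is-new i∈C i∉U) l∈S (x∈p∧x∉q⇒x∈p─q j∈U j∉C)))
            (Explored.near exp (C-near i∈C l∈C) no2 q) (Explored.explored exp (P⊆U l∈P) j∈U no2 r) eq
      ... | yes i∈U | no j∉U  | no i∉C  | yes j∈C with splits-to reg p (new-inner j∈C j∉U)
      ...   | inj₁ inner = contradiction inner (other-outer i∈U)
      ...   | inj₂ (l , l∈S , _ , _ , q , r , eq) =
        let l∈C , l∈P = x∈p∩q⁻ C P l∈S in
        via (Routed.k→i (routed (is-new j∈C j∉U) l∈S (x∈p∧x∉q⇒x∈p─q i∈U i∉C)))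
            (Explored.explored exp i∈U (P⊆U l∈P) no2 q) (Explored.near exp (C-near l∈C j∈C) no2 r) eq

    fromParent-runs : ∀ {s} → ∣ Sep ∣ ≤ s → ∀ {D} → Explored D U →
      Runs (fromParent (just P) C D U) (n + (n + (n + (n + (n + (n + ∣ New ∣ * suc (s * suc (n * 3)))))))) Empty.⊥
           (λ D′ → Explored D′ (U ∪ C))
    fromParent-runs {s} Sep≤s {D} exp =
      Runs-cost n (Runs-cost n (Runs-cost n (Runs-cost n (Runs-cost n (Runs-cost n (Runs-map times
        (λ ((sound′ , D′≼D) , _ , routed) → explore exp sound′ D′≼D
          λ i∈ j∈ k∈ → routed _ (∈-elements⁺ i∈) _ (∈-elements⁺ j∈) _ (∈-elements⁺ k∈))
        (Runs-forEach Inv {_⊑_} (λ _ _ → ≤∞-refl) (λ p q i j → ≤∞-trans (q i j) (p i j)) (λ later r j j∈ k k∈ → resp later (r j j∈ k k∈)) (elements New)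
          (λ {i} _ → Runs-forEach₂ Inv {_⊑_} (λ _ _ → ≤∞-refl) (λ p q i j → ≤∞-trans (q i j) (p i j)) {Routed D i} resp (elements Sep) (elements Other)
            (λ {j} {k} _ _ → route-runs i j k))
          (Explored.sound exp , λ _ _ → ≤∞-refl))))))))
      where
      Inv : Matrix R∞ n → Set (a ⊔ ℓ₁ ⊔ ℓ₂)
      Inv D′ = Sound G D′ × D′ ≼ D
      _⊑_ : Rel (Matrix R∞ n) (a ⊔ ℓ₂)
      M ⊑ M′ = M′ ≼ M
      resp : ∀ {i j k M M′} → M ⊑ M′ → Routed D i j k M → Routed D i j k M′
      resp later r = record { i→k = ≤∞-trans (later _ _) (Routed.i→k r) ; k→i = ≤∞-trans (later _ _) (Routed.k→i r) }
      route-runs : ∀ i j k {M} → Inv M → Runs (relax M i j k >>= λ M → relax M k j i) 2 Empty.⊥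
        (λ M′ → Inv M′ × M ⊑ M′ × Routed D i j k M′)
      route-runs i j k {M} (sound , M≼D) = Runs-cost 1 (Runs-cost 1 (Runs-return
        ( (relaxed-sound {G = G} {M₁} (relaxed-sound {G = G} {M} sound i j k) k j i , λ p q → ≤∞-trans (M₂≼M p q) (M≼D p q))
        , M₂≼M
        , record
          { i→k = ≤∞-trans (relaxed-≼ M₁ k j i i k) (≤∞-trans (relaxed-at M i j k) (⊕∞-mono (M≼D i j) (M≼D j k)))
          ; k→i = ≤∞-trans (relaxed-at M₁ k j i) (⊕∞-mono (≤∞-trans (relaxed-≼ M i j k k j) (M≼D k j))
                                                            (≤∞-trans (relaxed-≼ M i j k j i) (M≼D j i)))
          } )))
        where
        M₁ = relaxed M i j k
        M₂≼M : relaxed M₁ k j i ≼ M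
        M₂≼M p q = ≤∞-trans (relaxed-≼ M₁ k j i p q) (relaxed-≼ M i j k p q)
      times : length (elements New) * suc (length (elements Sep) * suc (length (elements Other) * 3)) ≤ ∣ New ∣ * suc (s * suc (n * 3))
      times = ℕ.*-mono-≤ (ℕ.≤-reflexive (length-elements New)) (s≤s (ℕ.*-mono-≤
        (ℕ.≤-trans (ℕ.≤-reflexive (length-elements Sep)) Sep≤s)
        (s≤s (ℕ.*-monoˡ-≤ 3 (ℕ.≤-trans (ℕ.≤-reflexive (length-elements Other)) (∣p∣≤n Other))))))

  AllTight : Matrix R∞ n → Set (a ⊔ ℓ₁ ⊔ ℓ₂)
  AllTight D = Sound G D × (∀ i j → Tight G D i j)

  module _ (s : ℕ) where

    SeparatorsWithin : Subset n → Tree n → Set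
    SeparatorsWithin P t = ∣ top-label t ∩ P ∣ ≤ s × (∀ {c c′ : Node t} → Link c c′ → ∣ label c′ ∩ label c ∣ ≤ s)

    separators-children : ∀ {C : Subset n} {ts} → (∀ {c c′ : Node (node C ts)} → Link c c′ → ∣ label c′ ∩ label c ∣ ≤ s) →
                          All (SeparatorsWithin C) ts
    separators-children {C} {ts} within = All.tabulate λ p → top-within p , λ l → within (under p l)
      where
      top-within : ∀ {t} → t List.∈ ts → ∣ top-label t ∩ C ∣ ≤ s
      top-within {node D us} p = within (top p)

    perNew : ℕ
    perNew = suc (s * suc (n * 3))

    -- Every node but the root has a new vertex, which is charged with the
    -- scans of the node.

    perVertex : ℕ
    perVertex = suc (n + (n + (n + (n + (n + (n + (n + perNew)))))))

    -- `counted` is the amortisation: every vertex taken as new enlarges the visited set, so over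
    -- the whole traversal at most `n` vertices are charged. `only` ensures that the next sibling
    -- still finds its own new vertices unvisited.
    record Visited (U : Subset n) (count : ℕ) (∈new : Fin n → Set) (st : Matrix R∞ n × Subset n) : Set (a ⊔ ℓ₁ ⊔ ℓ₂) where
      private U′ = proj₂ st
      field
        explored : Explored (proj₁ st) U′
        kept     : U ⊆ U′
        reached  : ∀ {v} → ∈new v → v ∈ U′
        only     : ∀ {v} → v ∈ U′ → v ∈ U ⊎ ∈new v
        counted  : ∣ U ∣ + count ≤ ∣ U′ ∣

    charge : ∀ c m → 1 ≤ c → 1 + (n + (n + (n + (n + (n + (n + c * perNew))))) + (n + perVertex * m)) ≤ perVertex * (c + m)
    charge c m 1≤c = begin
      1 + (n + (n + (n + (n + (n + (n + c * perNew))))) + (n + perVertex * m))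
        ≡⟨ solve 4 (λ n r p m → con 1 :+ (n :+ (n :+ (n :+ (n :+ (n :+ (n :+ r))))) :+ (n :+ p :* m)) :=
             con 1 :* (con 1 :+ con 7 :* n) :+ r :+ p :* m) refl n (c * perNew) perVertex m ⟩
      1 * (1 + 7 * n) + c * perNew + perVertex * m
        ≤⟨ ℕ.+-monoˡ-≤ (perVertex * m) (ℕ.+-monoˡ-≤ (c * perNew) (ℕ.*-monoˡ-≤ (1 + 7 * n) 1≤c)) ⟩
      c * (1 + 7 * n) + c * perNew + perVertex * m
        ≡⟨ solve 4 (λ n c k m →
             let v = con 1 :+ (n :+ (n :+ (n :+ (n :+ (n :+ (n :+ (n :+ k))))))) in
             c :* (con 1 :+ con 7 :* n) :+ c :* k :+ v :* m := v :* (c :+ m)) refl n c perNew m ⟩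
      perVertex * (c + m) ∎
      where
      open ℕ.≤-Reasoning
      open +-*-Solver

    processTime : Subset n → Tree n → ℕ
    processTime P (node C ts) = n + (n + (n + (n + (n + (n + ∣ C ─ P ∣ * perNew))))) + (n + perVertex * newCounts C ts)

    processTime≤ : ∀ {P} t → top-label t ⊈ P → 1 + processTime P t ≤ perVertex * newCount P t
    processTime≤ {P} (node C ts) C⊈P =
      let x , x∈C , x∉P = ⊈⇒∃ C⊈P in charge ∣ C ─ P ∣ (newCounts C ts) (∈⇒0<∣∣ (x∈p∧x∉q⇒x∈p─q x∈C x∉P))

    mutual
      process-runs : ∀ t {P U D} → Region E⁺ P U t → P ⊆ U → SeparatorsWithin P t → Explored D U →
        Runs (process t (just P) (D , U)) (processTime P t) Empty.⊥ (Visited U (newCount P t) (_∈ᵗ t))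
      process-runs (node C ts) {P} {U} {D} reg P⊆U (sep , seps) exp = Runs-map
        ℕ.≤-refl
        (λ vis → record
          { explored = Visited.explored vis
          ; kept     = Visited.kept vis ∘ p⊆p∪q C
          ; reached  = λ v∈t → case ∈ᵗ-node⁻ v∈t of λ where
              (inj₁ v∈C)  → Visited.kept vis (q⊆p∪q U C v∈C)
              (inj₂ v∈ts) → Visited.reached vis v∈ts
          ; only     = λ v∈U′ → case Visited.only vis v∈U′ of λ where
              (inj₁ v∈U∪C) → Sum.map₂ (root ,_) (x∈p∪q⁻ U C v∈U∪C)
              (inj₂ v∈ts)  → inj₂ (∈ᵗ-node⁺ (inj₂ v∈ts))
          ; counted  = ℕ.≤-trans (ℕ.≤-trans (ℕ.≤-reflexive (sym (ℕ.+-assoc ∣ U ∣ _ _))) (ℕ.+-monoˡ-≤ (newCounts C ts) new-counted))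
                                 (Visited.counted vis)
          })
        (Runs-bind (fromParent-runs reg P⊆U sep exp) λ exp′ →
          Runs-cost n (processChildren-runs ts (All.map proj₂ hr) (All.map (Hangs.new ∘ proj₁) hr) pairs (q⊆p∪q U C)
            (separators-children seps) exp′))
        where
        hr = proj₁ (Region-children reg)
        pairs = proj₂ (Region-children reg)
        new-counted : ∣ U ∣ + ∣ C ─ P ∣ ≤ ∣ U ∪ C ∣
        new-counted = ∣disjoint∣ U (C ─ P) (U ∪ C) (p⊆p∪q C) (q⊆p∪q U C ∘ p─q⊆p C P) λ v∈U v∈new →
          x∈p─q⇒x∉q C P v∈new (Region.seen reg (root , p─q⊆p C P v∈new) v∈U)

      processChildren-runs : ∀ ts {C U D} → All (Region E⁺ C U) ts → All (λ t → top-label t ⊈ C) ts → AllPairs (Meet C) ts →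
        C ⊆ U → All (SeparatorsWithin C) ts → Explored D U →
        Runs (processChildren ts C (D , U)) (perVertex * newCounts C ts) Empty.⊥ (Visited U (newCounts C ts) (λ v → Any (v ∈ᵗ_) ts))
      processChildren-runs [] {U = U} _ _ _ _ _ exp = Runs-map z≤n id (Runs-return record
        { explored = exp ; kept = id ; reached = λ () ; only = inj₁ ; counted = ℕ.≤-reflexive (ℕ.+-identityʳ ∣ U ∣) })
      processChildren-runs (t ∷ ts) {C} {U} (reg ∷ regs) (C⊉ ∷ news) (meet ∷ meets) C⊆U (sep ∷ seps) exp = Runs-map
        (ℕ.≤-trans (ℕ.+-monoˡ-≤ (perVertex * newCounts C ts) (processTime≤ t C⊉))
                   (ℕ.≤-reflexive (sym (ℕ.*-distribˡ-+ perVertex (newCount C t) (newCounts C ts))))) id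
        (Runs-cost 1 (Runs-bind (process-runs t reg C⊆U sep exp) λ {st} vis →
         Runs-map ℕ.≤-refl
           (λ vis′ → record
             { explored = Visited.explored vis′
             ; kept     = Visited.kept vis′ ∘ Visited.kept vis
             ; reached  = λ where
                 (here v∈t)   → Visited.kept vis′ (Visited.reached vis v∈t)
                 (there v∈ts) → Visited.reached vis′ v∈ts
             ; only     = λ v∈U″ → case Visited.only vis′ v∈U″ of λ where
                 (inj₁ v∈U′) → Sum.map₂ here (Visited.only vis v∈U′)
                 (inj₂ v∈ts) → inj₂ (there v∈ts)
             ; counted  = ℕ.≤-trans (ℕ.≤-reflexive (sym (ℕ.+-assoc ∣ U ∣ (newCount C t) _)))
                 (ℕ.≤-trans (ℕ.+-monoˡ-≤ (newCounts C ts) (Visited.counted vis)) (Visited.counted vis′))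
             })
           (processChildren-runs ts
             (All.tabulate λ u∈ts → Region-grow {t = t} (λ {v} → All.lookup meet u∈ts {v}) (Visited.only vis) (All.lookup regs u∈ts)) news meets
             (Visited.kept vis ∘ C⊆U) seps (Visited.explored vis))))

    traverse-runs : ∀ {t} → IsCliqueTree E⁺ t → (∀ {c c′ : Node t} → Link c c′ → ∣ label c′ ∩ label c ∣ ≤ s) →
      ∀ {D} → Initialised D →
      Runs (process t nothing (D , ⊥)) (n + perVertex * n) Empty.⊥ (AllTight ∘ proj₁)
    traverse-runs {node C ts} tree seps {D} init =
      let reg = Region-root E⁺-simple (lower-clique E₀) tree
          hr , pairs = Region-children reg
          children = processChildren-runs ts (All.map proj₂ hr) (All.map (Hangs.new ∘ proj₁) hr) pairs (q⊆p∪q ⊥ C)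
            (separators-children seps) (start reg)
          (_ , U′) , _ , vis = Runs-result children
          -- The bound on the time is taken from the outcome of the run itself: its final visited
          -- set has at most `n` members.
          few : newCounts C ts ≤ n
          few = ℕ.≤-trans (ℕ.m≤n+m _ ∣ ⊥ ∪ C ∣) (ℕ.≤-trans (Visited.counted vis) (∣p∣≤n U′))
      in Runs-cost n (Runs-map (ℕ.*-monoʳ-≤ perVertex few) finish children)
      where
      start : Region E⁺ ⊥ ⊥ (node C ts) → Explored D (⊥ ∪ C)
      start reg = record
        { sound    = Initialised.sound init
        ; near     = Initialised.near init
        ; explored = λ i∈ j∈ → Initialised.near init (clique⇒Near (Region.cliques reg root) (⊥∪⁻ i∈) (⊥∪⁻ j∈))
        }
        where
        ⊥∪⁻ : ∀ {i} → i ∈ ⊥ ∪ C → i ∈ C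
        ⊥∪⁻ i∈ = [ (λ i∈⊥ → contradiction i∈⊥ ∉⊥) , id ]′ (x∈p∪q⁻ ⊥ C i∈)
      finish : ∀ {st} → Visited (⊥ ∪ C) (newCounts C ts) (λ v → Any (v ∈ᵗ_) ts) st → AllTight (proj₁ st)
      finish {st} vis = Explored.sound (Visited.explored vis) , λ i j → Explored.explored (Visited.explored vis) (all i) (all j)
        where
        all : ∀ v → v ∈ proj₂ st
        all v = case ∈ᵗ-node⁻ (∈-tree E⁺-simple (lower-clique E₀) tree v) of λ where
          (inj₁ v∈C)  → Visited.kept vis (q⊆p∪q ⊥ C v∈C)
          (inj₂ v∈ts) → Visited.reached vis v∈ts

-- Passing between vertices and positions

module Relabelling {a ℓ₁ ℓ₂} (R : OrderedAbelianGroup a ℓ₁ ℓ₂) {n} (G : APSP.Digraph R n) (d : Permutation′ n) where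

  open Weights R

  G′ : Digraph n
  G′ = relabel G d

  arc-relabel : ∀ i j → arc G′ (d ⟨$⟩ʳ i) (d ⟨$⟩ʳ j) ≡ arc G i j
  arc-relabel i j = cong₂ (arc G) (inverseˡ d) (inverseˡ d)

  path⁺ : ∀ {i j x} → Path G i j x → Path G′ (d ⟨$⟩ʳ i) (d ⟨$⟩ʳ j) x
  path⁺ []        = []
  path⁺ (i→j ∷ p) = trans (arc-relabel _ _) i→j ∷ path⁺ p

  path⁻ : ∀ {i j x} → Path G′ i j x → Path G (d ⟨$⟩ˡ i) (d ⟨$⟩ˡ j) x
  path⁻ []        = []
  path⁻ (i→j ∷ p) = i→j ∷ path⁻ p

  negative⁺ : HasNegativeCycle G → HasNegativeCycle G′
  negative⁺ (_ , _ , p , x<0) = _ , _ , path⁺ p , x<0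

  negative⁻ : HasNegativeCycle G′ → HasNegativeCycle G
  negative⁻ (_ , _ , p , x<0) = _ , _ , path⁻ p , x<0

  connected⁺ : Connected G → ∀ i j → Star (Adjacent (underlying G′)) i j
  connected⁺ connected i j = subst₂ (Star (Adjacent (underlying G′))) (inverseʳ d) (inverseʳ d)
    (Star.gmap (d ⟨$⟩ʳ_) adjacent⁺ (connected (d ⟨$⟩ˡ i) (d ⟨$⟩ˡ j)))
    where
    adjacent⁺ : ∀ {i j} → Adjacent (underlying G) i j → Adjacent (underlying G′) (d ⟨$⟩ʳ i) (d ⟨$⟩ʳ j)
    adjacent⁺ {i} {j} i~j = lookup⇒∈ (begin
      underlying G′ ⟨ d ⟨$⟩ʳ i , d ⟨$⟩ʳ j ⟩
        ≡⟨ lookup₂-tabulate (λ i j → is-just (arc G′ i j) ∨ is-just (arc G′ j i)) (d ⟨$⟩ʳ i) (d ⟨$⟩ʳ j) ⟩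
      is-just (arc G′ (d ⟨$⟩ʳ i) (d ⟨$⟩ʳ j)) ∨ is-just (arc G′ (d ⟨$⟩ʳ j) (d ⟨$⟩ʳ i))
        ≡⟨ cong₂ (λ x y → is-just x ∨ is-just y) (arc-relabel i j) (arc-relabel j i) ⟩
      is-just (arc G i j) ∨ is-just (arc G j i)
        ≡⟨ lookup₂-tabulate (λ i j → is-just (arc G i j) ∨ is-just (arc G j i)) i j ⟨
      underlying G ⟨ i , j ⟩
        ≡⟨ ∈⇒lookup i~j ⟩
      true ∎)
      where open ≡-Reasoning

-- Total running time and correctness

-- The summands belong, in order, to DPC, the second phase of P³C, the initial distances, the clique
-- tree, and the traversal from the root.
snowballTime : (K n b s : ℕ) → ℕ
snowballTime K n b s =
  (n * suc (n + n + b * suc (b * 5)) + n * suc (n + n + b * suc (b * 3))) +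
  ((n * n + n * suc (1 + (n + n * 3))) + (K * (n * n) +
    (n + suc (n + (n + (n + (n + (n + (n + (n + suc (s * suc (n * 3))))))))) * n + 0)))

module Snowball {a ℓ₁ ℓ₂} (R : OrderedAbelianGroup a ℓ₁ ℓ₂)
  {build : ∀ n → Graph n → Run (Tree n)} (routine : IsCliqueTreeRoutine build)
  {n} (G : APSP.Digraph R n) (d : Permutation′ n) where

  open Weights R
  open Consistency R
  open Relabelling R G d
  open Distances R G′
  open Traversal R G′

  K : ℕ
  K = proj₁ (IsCliqueTreeRoutine.fast routine)

  Correct : Matrix R∞ n → Set (a ⊔ ℓ₁ ⊔ ℓ₂)
  Correct D = AllTight D × (NoNegative2Cycle G′ → ¬ HasNegativeCycle G′)

  snowball-runs : ∀ {b s} → (∀ k → ∣ lower E⁺ k ∣ ≤ b) →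
    (∀ {t} → IsCliqueTree E⁺ t → {c c′ : Node t} → Link c c′ → ∣ label c′ ∩ label c ∣ ≤ s) →
    Runs (snowballSeparators build G d) (snowballTime K n b s) (HasNegativeCycle G′) Correct
  snowball-runs {b} {s} lower≤b seps≤s =
    Runs-bind (p³c-runs lower≤b) λ {net} solved →
    Runs-bind (Runs-safe (initialDistances-runs solved)) λ {D} init →
    Runs-bind (build-runs′ (Solved.edges≡ solved)) λ {t} tree →
    Runs-bind (Runs-safe (traverse-runs s tree (seps≤s tree) init)) λ tight →
    Runs-return (tight , Solved.no-cycle solved)
    where
    build-runs′ : ∀ {E} → E ≡ E⁺ → Runs (build n E) (K * (n * n)) (HasNegativeCycle G′) (IsCliqueTree E⁺)
    build-runs′ refl = let t , eq , tree = IsCliqueTreeRoutine.correct routine n E₀ E₀-simple in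
      runs (proj₂ (IsCliqueTreeRoutine.fast routine) n E₀ E₀-simple)
        (subst (Post (HasNegativeCycle G′) (IsCliqueTree E⁺)) (sym eq) (done tree))

  -- For correctness only the postcondition matters, so lower neighbourhoods and intersections are
  -- bounded by the number of all vertices.
  outcome : Runs (snowballSeparators build G d) (snowballTime K n n n) (HasNegativeCycle G′) Correct
  outcome = snowball-runs {n} {n} (λ k → ∣p∣≤n (lower E⁺ k)) (λ _ {c} {c′} _ → ∣p∣≤n (label c′ ∩ label c))

  detects : HasNegativeCycle G → NoNegative2Cycle G → result (snowballSeparators build G d) ≡ INCONSISTENT
  detects cycle no2 = conclude (Runs.post outcome)
    where
    no2′ : NoNegative2Cycle G′
    no2′ i j = no2 (d ⟨$⟩ˡ i) (d ⟨$⟩ˡ j)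
    conclude : ∀ {r} → Post (HasNegativeCycle G′) Correct r → r ≡ INCONSISTENT
    conclude (failed _)            = refl
    conclude (done (_ , no-cycle)) = contradiction (negative⁺ cycle) (no-cycle no2′)

  distances : ¬ HasNegativeCycle G → ∃[ D ] result (snowballSeparators build G d) ≡ ok D ×
              (∀ i j → IsDistance G i j (D ⟨ d ⟨$⟩ʳ i , d ⟨$⟩ʳ j ⟩))
  distances none = conclude (Runs.post outcome)
    where
    no2 : NoNegative2Cycle G′
    no2 = noNegativeCycle⇒noNegative2Cycle {G = G′} (none ∘ negative⁻)
    distance : ∀ D → AllTight D → ∀ i j → IsDistance G i j (D ⟨ d ⟨$⟩ʳ i , d ⟨$⟩ʳ j ⟩)
    distance D (sound , tight) i j = from refl
      where
      from : ∀ {v} → D ⟨ d ⟨$⟩ʳ i , d ⟨$⟩ʳ j ⟩ ≡ v → IsDistance G i j v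
      from {⊤⁺} eq = infinite λ y p → case subst (_≤∞ [ y ]) eq (tight _ _ no2 (path⁺ p)) of λ ()
      from {[ x ]} eq = let y , p , y≈x = sound _ _ eq in
        finite (subst₂ (λ i j → Path G i j y) (inverseˡ d) (inverseˡ d) (path⁻ p)) (≈-sym y≈x)
          λ z q → case subst (_≤∞ [ z ]) eq (tight _ _ no2 (path⁺ q)) of λ { ⟦ x≤z ⟧ → x≤z }
    conclude : ∀ {r} → Post (HasNegativeCycle G′) Correct r →
               ∃[ D ] r ≡ ok D × (∀ i j → IsDistance G i j (D ⟨ d ⟨$⟩ʳ i , d ⟨$⟩ʳ j ⟩))
    conclude (failed cycle)       = contradiction (negative⁻ cycle) none
    conclude (done {x = D} (tight , _)) = D , refl , distance D tight

  -- The constant adds up the multiples of `T` that absorb the terms of `snowballTime`: 7, 16 + `K`,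
  -- 2, 8, 1 and 3, where `K` is the constant of the clique tree routine.
  time-bound : 3 ≤ n → Connected G → ∀ w s → IsInducedWidth E₀ w → IsLargestMinimalSeparatorSize E⁺ s →
               steps (snowballSeparators build G d) ≤ (37 + K) * (n * w ^ 2 + n ^ 2 * s)
  time-bound 3≤n connected w s width largest = ℕ.≤-trans
    (Runs.time (snowball-runs lower≤w λ tree → link≤ E⁺-simple (lower-clique E₀) tree largest))
    (time≤ n≤ (complete⊎separated E⁺-simple (lower-clique E₀) E⁺-connected tree largest))
    where
    lower≤w : ∀ k → ∣ lower E⁺ k ∣ ≤ w
    lower≤w = lower≤width E₀ E₀-simple width
    E⁺-connected : ∀ i j → Star (Adjacent E⁺) i j
    E⁺-connected i j = Star.map (⊆-triangulate E₀) (connected⁺ connected i j)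
    tree : IsCliqueTree E⁺ _
    tree = proj₂ (proj₂ (IsCliqueTreeRoutine.correct routine n E₀ E₀-simple))
    T : ℕ
    T = n * (w * w) + n * n * s
    n≤ : (∀ i j → i ≢ j → Adjacent E⁺ i j) → n ≤ suc w
    n≤ complete = go E⁺ complete lower≤w
      where
      go : ∀ {n} (E : Graph n) → (∀ i j → i ≢ j → Adjacent E i j) → (∀ k → ∣ lower E k ∣ ≤ w) → n ≤ suc w
      go {zero}  E _        _       = z≤n
      go {suc n} E complete lower≤w = s≤s (ℕ.≤-trans (complete⇒width {E = E} complete) (lower≤w (Fin.fromℕ n)))
    m≤m*m : ∀ m → m ≤ m * m
    m≤m*m zero    = z≤n
    m≤m*m (suc m) = ℕ.m≤m+n (suc m) (m * suc m)
    time≤ : ∀ {A : Set} → (A → n ≤ suc w) → A ⊎ 0 < s → snowballTime K n w s ≤ (37 + K) * (n * w ^ 2 + n ^ 2 * s)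
    time≤ complete⇒ cases = begin
      snowballTime K n w s
        ≡⟨ solve 4 (λ K n w s →
             (n :* (con 1 :+ (n :+ n :+ w :* (con 1 :+ w :* con 5))) :+ n :* (con 1 :+ (n :+ n :+ w :* (con 1 :+ w :* con 3)))) :+
             ((n :* n :+ n :* (con 1 :+ (con 1 :+ (n :+ n :* con 3)))) :+ (K :* (n :* n) :+
               (n :+ (con 1 :+ (n :+ (n :+ (n :+ (n :+ (n :+ (n :+ (n :+ (con 1 :+ s :* (con 1 :+ n :* con 3)))))))))) :* n :+ con 0)))
             := con 7 :* n :+ (con 16 :+ K) :* (n :* n) :+ con 2 :* (n :* w) :+ con 8 :* (n :* (w :* w)) :+ n :* s :+ con 3 :* (n :* n :* s))
             refl K n w s ⟩
      7 * n + (16 + K) * (n * n) + 2 * (n * w) + 8 * (n * (w * w)) + n * s + 3 * (n * n * s)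
        ≤⟨ ℕ.+-mono-≤ (ℕ.+-mono-≤ (ℕ.+-mono-≤ (ℕ.+-mono-≤ (ℕ.+-mono-≤
             (ℕ.*-monoʳ-≤ 7 (ℕ.≤-trans (m≤m*m n) n²≤)) (ℕ.*-monoʳ-≤ (16 + K) n²≤))
             (ℕ.*-monoʳ-≤ 2 (ℕ.≤-trans (ℕ.*-monoʳ-≤ n (m≤m*m w)) nw²≤))) (ℕ.*-monoʳ-≤ 8 nw²≤))
             (ℕ.≤-trans (ℕ.*-monoˡ-≤ s (m≤m*m n)) n²s≤)) (ℕ.*-monoʳ-≤ 3 n²s≤) ⟩
      7 * T + (16 + K) * T + 2 * T + 8 * T + T + 3 * T
        ≡⟨ solve 2 (λ K T → con 7 :* T :+ (con 16 :+ K) :* T :+ con 2 :* T :+ con 8 :* T :+ T :+ con 3 :* T :=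
             (con 37 :+ K) :* T) refl K T ⟩
      (37 + K) * T
        ≡⟨ cong ((37 + K) *_) (cong₂ (λ x y → n * x + y * s) (sym (cong (w *_) (ℕ.*-identityʳ w))) (sym (cong (n *_) (ℕ.*-identityʳ n)))) ⟩
      (37 + K) * (n * w ^ 2 + n ^ 2 * s) ∎
      where
      open ℕ.≤-Reasoning
      open +-*-Solver
      nw²≤ : n * (w * w) ≤ T
      nw²≤ = ℕ.m≤m+n _ _
      n²s≤ : n * n * s ≤ T
      n²s≤ = ℕ.m≤n+m _ (n * (w * w))
      -- The threshold 3 on `n` originates here: it gives `2 ≤ w`, and thus `1 + w ≤ w * w`, which
      -- fails for `w = 1`.
      n≤w² : n ≤ suc w → n ≤ w * w
      n≤w² n≤1+w = begin
        n           ≤⟨ n≤1+w ⟩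
        1 + w       ≤⟨ ℕ.+-monoˡ-≤ w (ℕ.≤-trans (s≤s z≤n) 2≤w) ⟩
        w + w       ≡⟨ cong (w +_) (ℕ.+-identityʳ w) ⟨
        2 * w       ≤⟨ ℕ.*-monoˡ-≤ w 2≤w ⟩
        w * w       ∎
        where
        2≤w : 2 ≤ w
        2≤w = ℕ.≤-pred (ℕ.≤-trans 3≤n n≤1+w)
      n²≤ : n * n ≤ T
      n²≤ = [ (λ complete → ℕ.≤-trans (ℕ.*-monoʳ-≤ n (n≤w² (complete⇒ complete))) nw²≤)
            , (λ 0<s → ℕ.≤-trans (ℕ.m≤m*n (n * n) s {{ℕ.>-nonZero 0<s}}) n²s≤) ]′ cases

theorem6 : ∀ {a ℓ₁ ℓ₂} (R : OrderedAbelianGroup a ℓ₁ ℓ₂) → let open APSP R in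
    IsCliqueTreeRoutine buildCliqueTree ×
    (∀ (build : ∀ n → Graph n → Run (Tree n)) → IsCliqueTreeRoutine build →
    (∀ n (G : Digraph n) (d : Permutation′ n) → Connected G →
    (HasNegativeCycle G → NoNegative2Cycle G →
    result (snowballSeparators build G d) ≡ INCONSISTENT) ×
    (¬ HasNegativeCycle G →
    ∃[ D ] result (snowballSeparators build G d) ≡ ok D ×
    (∀ i j → IsDistance G i j (D ⟨ d ⟨$⟩ʳ i , d ⟨$⟩ʳ j ⟩)))) ×
    (∃[ c ] ∃[ n₀ ] ∀ n → n₀ ≤ n →
    ∀ (G : Digraph n) (d : Permutation′ n) → Connected G →
    ∀ w s → IsInducedWidth (underlying (relabel G d)) w →
    IsLargestMinimalSeparatorSize (triangulate (underlying (relabel G d))) s →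
    steps (snowballSeparators build G d) ≤ c * (n * w ^ 2 + n ^ 2 * s)))
theorem6 R = buildCliqueTree-correct , λ build routine →
  (λ n G d _ → Snowball.detects R routine G d , Snowball.distances R routine G d) ,
  37 + proj₁ (IsCliqueTreeRoutine.fast routine) , 3 , λ n 3≤n G d → Snowball.time-bound R routine G d 3≤n
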